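{- There is an algorithm that, given a LoadCVRP or LoadGasCVRP instance with no zero-weight edges and $r\in\mathbb N$, decides whether there exists a routing of weight at most $r$ in $f(r)\cdot n^{O(1)}$ steps, for some computable function $f$, where $n=|V(G)|$ is the number of vertices of the input graph.
   Context: All graphs are finite and undirected, and $\mathbb N = \{0,1,2,\dots\}$, $\mathbb N^+=\{1,2,\dots\}$. A walk in $G$ is a sequence of vertices $(v_1,\dots,v_m)$ with consecutive vertices adjacent; vertices and edges may be repeated. It is closed if $v_1 = v_m$. The weight of a walk is $w(p)=\sum_{i=1}^{m-1} w(v_i,v_{i+1})$. LoadCVRP (Load-Capacitated Vehicle Routing Problem): An instance contains a graph $G$ with edge weights $w\colon E(G)\to\mathbb N$, a nonempty set of depots $D\subseteq V(G)$, a set of clients $C\subseteq V(G)$, a number of vehicles $k\in\mathbb N$, a load capacity $\ell\in\mathbb N$, and demands $\Lambda\colon C\to\mathbb N^+$. A routing is a set of $k'$ walks $R=\{p_1,\dots,p_{k'}\}$ (one walk per vehicle) together with an assignment $A\colon C\to[k']$ such that $k'\le k$, every walk starts at a vertex of $D$, every client $c\in C$ is a vertex of $p_{A(c)}$, every walk in $R$ is closed, and $\sum_{c\in A^{ -1}(i)}\Lambda(c)\le\ell$ for every $i\in[k']$. Its weight is $w(R)=\sum_{p\in R}w(p)$. LoadGasCVRP (Load-and-Gas-Capacitated Vehicle Routing Problem): as LoadCVRP, but the instance additionally contains a gas capacity $g\in\mathbb N$, and a routing must additionally satisfy $w(p)\le g$ for every $p\in R$. -}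

module Defs where

open import Algebra.Properties.CommutativeMonoid.Sum using (sum)
open import Data.Bool.Base using (Bool; true; false; T; if_then_else_)
open import Data.Bool.Properties using (T?)
open import Data.Fin.Base using (Fin)
import Data.Fin.Properties as Fin
open import Data.Fin.Subset using (Subset; Nonempty; _∈_)
open import Data.Fin.Subset.Properties using (_∈?_)
open import Data.List.Base using (List; []; _∷_; [_]; _++_; concat; tabulate)
import Data.List.Membership.Propositional as List
open import Data.Nat.Base using (ℕ; zero; suc; _+_; _∸_; _≤_; _<_)
import Data.Nat.Properties as ℕ
open import Data.Product.Base using (∃-syntax; _×_)
open import Function.Bundles using (_⇔_)
open import Relation.Binary.Construct.Closure.ReflexiveTransitive
  using (Star; ε; _◅_)
open import Relation.Binary.PropositionalEquality.Core using (_≡_; _≢_)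
open import Relation.Nullary.Decidable.Core using (Dec; yes; no; ⌊_⌋; _×-dec_)

------------------------------------------------------------------------
-- Edge-weighted graphs and walks

∑ : ∀ {n} → (Fin n → ℕ) → ℕ
∑ = sum ℕ.+-0-commutativeMonoid

record Graph (n : ℕ) : Set where
  field
    adjacent     : Fin n → Fin n → Bool
    adjacent-sym : ∀ u v → adjacent u v ≡ adjacent v u

  Adj : Fin n → Fin n → Set
  Adj u v = T (adjacent u v)

  -- A walk (v₁,…,vₘ) with v₁ = u and vₘ = v; the empty chain ε is the
  -- walk with m = 1.
  Walk : Fin n → Fin n → Set
  Walk = Star Adj

  vertices : ∀ {u v} → Walk u v → List (Fin n)
  vertices {u} ε       = [ u ]
  vertices {u} (_ ◅ p) = u ∷ vertices p

-- The domain E(G) is enforced by the adjacency argument, whose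
-- irrelevance says that a weight depends on the edge only.
record EdgeWeights {n} (G : Graph n) : Set where
  open Graph G
  field
    weight     : ∀ u v → .(Adj u v) → ℕ
    weight-sym : ∀ u v .(e : Adj u v) .(e′ : Adj v u) →
                 weight u v e ≡ weight v u e′

  walkWeight : ∀ {u v} → Walk u v → ℕ
  walkWeight ε                       = 0
  walkWeight (_◅_ {i = u} {j = v} e p) = weight u v e + walkWeight p

  NoZeroWeightEdges : Set
  NoZeroWeightEdges = ∀ u v (e : Adj u v) → weight u v e ≢ 0

------------------------------------------------------------------------
-- The two routing problems

-- The value of a partial function at a decidable point, and 0 outside
-- its domain.
orZero : ∀ {P : Set} → Dec P → (.P → ℕ) → ℕ
orZero (yes p) f = f p
orZero (no  _) f = 0

record LoadCVRP (n : ℕ) : Set where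
  field
    graph           : Graph n
    edgeWeights     : EdgeWeights graph
    depots          : Subset n
    depots-nonempty : Nonempty depots
    clients         : Subset n
    fleet           : ℕ
    loadCapacity    : ℕ
    demand          : ∀ c → .(c ∈ clients) → ℕ
    demand-positive : ∀ c (c∈C : c ∈ clients) → 0 < demand c c∈C

  open Graph graph public
  open EdgeWeights edgeWeights public

record LoadGasCVRP (n : ℕ) : Set where
  field
    loadCVRP    : LoadCVRP n
    gasCapacity : ℕ

  open LoadCVRP loadCVRP public

-- Walks are indexed by the vehicles, so different vehicles may follow the
-- same walk, and each then contributes to the weight.
record Routing {n} (I : LoadCVRP n) : Set where
  open LoadCVRP I
  field
    vehicles       : ℕ
    vehicles≤fleet : vehicles ≤ fleet
    start          : Fin vehicles → Fin n
    start∈depots   : ∀ i → start i ∈ depots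
    walk           : ∀ i → Walk (start i) (start i)
    assign         : ∀ c → .(c ∈ clients) → Fin vehicles
    visits         : ∀ c (c∈C : c ∈ clients) →
                     c List.∈ vertices (walk (assign c c∈C))

  load : Fin vehicles → ℕ
  load i = ∑ λ c → orZero (c ∈? clients) λ c∈C →
                   orZero (assign c c∈C Fin.≟ i) λ _ → demand c c∈C

  field
    load≤capacity : ∀ i → load i ≤ loadCapacity

  routingWeight : ℕ
  routingWeight = ∑ λ i → walkWeight (walk i)

record GasRouting {n} (I : LoadGasCVRP n) : Set where
  open LoadGasCVRP I
  field
    routing : Routing loadCVRP

  open Routing routing public

  field
    gas≤capacity : ∀ i → walkWeight (walk i) ≤ gasCapacity

LoadCVRP-Yes : ∀ {n} → LoadCVRP n → ℕ → Set
LoadCVRP-Yes I r = ∃[ R ] Routing.routingWeight {I = I} R ≤ r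

LoadGasCVRP-Yes : ∀ {n} → LoadGasCVRP n → ℕ → Set
LoadGasCVRP-Yes I r = ∃[ R ] GasRouting.routingWeight {I = I} R ≤ r

------------------------------------------------------------------------
-- Algorithms: structured programs for a unit-cost random access machine.
--
-- Every cell holds a natural number. The store is divided into banks; a
-- bank is named by a constant in the program text, so a program uses
-- finitely many banks, while addresses inside a bank may be computed.
-- Arithmetic is limited to addition and truncated subtraction.

infixl 6 _⊕_ _⊖_
infixr 7 _‼_
infix  5 _‼_≔_
infixr 4 _⨾_

data Expr : Set where
  const   : ℕ → Expr
  _‼_     : (bank : ℕ) (address : Expr) → Expr
  _⊕_ _⊖_ : Expr → Expr → Expr

data Program : Set where
  skip          : Program
  _‼_≔_         : (bank : ℕ) (address value : Expr) → Program
  _⨾_           : Program → Program → Program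
  If_Then_Else_ : Expr → Program → Program → Program
  While_Do_     : Expr → Program → Program

Store : Set
Store = ℕ → ℕ → ℕ

eval : Store → Expr → ℕ
eval σ (const m) = m
eval σ (b ‼ a)   = σ b (eval σ a)
eval σ (d ⊕ e)   = eval σ d + eval σ e
eval σ (d ⊖ e)   = eval σ d ∸ eval σ e

exprCost : Expr → ℕ
exprCost (const _) = 1
exprCost (_ ‼ a)   = 1 + exprCost a
exprCost (d ⊕ e)   = 1 + exprCost d + exprCost e
exprCost (d ⊖ e)   = 1 + exprCost d + exprCost e

update : Store → (bank address value : ℕ) → Store
update σ b a m b′ a′ =
  if ⌊ (b′ ℕ.≟ b) ×-dec (a′ ℕ.≟ a) ⌋ then m else σ b′ a′

-- ⟨ P , σ ⟩⇓⟨ τ , t ⟩: started in σ, the program P halts in τ after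
-- exactly t steps. Nonzero counts as true in tests.
infix 3 ⟨_,_⟩⇓⟨_,_⟩

data ⟨_,_⟩⇓⟨_,_⟩ : Program → Store → Store → ℕ → Set where
  skip⇓ : ∀ {σ} → ⟨ skip , σ ⟩⇓⟨ σ , 1 ⟩

  assign⇓ : ∀ {σ b a e} →
    ⟨ b ‼ a ≔ e , σ ⟩⇓⟨ update σ b (eval σ a) (eval σ e)
                       , 1 + exprCost a + exprCost e ⟩

  seq⇓ : ∀ {P Q ρ σ τ s t} →
    ⟨ P , ρ ⟩⇓⟨ σ , s ⟩ → ⟨ Q , σ ⟩⇓⟨ τ , t ⟩ →
    ⟨ P ⨾ Q , ρ ⟩⇓⟨ τ , s + t ⟩

  ifTrue⇓ : ∀ {e P Q σ τ t} → eval σ e ≢ 0 → ⟨ P , σ ⟩⇓⟨ τ , t ⟩ →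
    ⟨ If e Then P Else Q , σ ⟩⇓⟨ τ , 1 + exprCost e + t ⟩

  ifFalse⇓ : ∀ {e P Q σ τ t} → eval σ e ≡ 0 → ⟨ Q , σ ⟩⇓⟨ τ , t ⟩ →
    ⟨ If e Then P Else Q , σ ⟩⇓⟨ τ , 1 + exprCost e + t ⟩

  whileTrue⇓ : ∀ {e P ρ σ τ s t} → eval ρ e ≢ 0 →
    ⟨ P , ρ ⟩⇓⟨ σ , s ⟩ → ⟨ While e Do P , σ ⟩⇓⟨ τ , t ⟩ →
    ⟨ While e Do P , ρ ⟩⇓⟨ τ , 1 + exprCost e + s + t ⟩

  whileFalse⇓ : ∀ {e P σ} → eval σ e ≡ 0 →
    ⟨ While e Do P , σ ⟩⇓⟨ σ , 1 + exprCost e ⟩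

cells : List ℕ → ℕ → ℕ
cells []       _       = 0
cells (x ∷ xs) zero    = x
cells (x ∷ xs) (suc a) = cells xs a

-- The input occupies the first cells of bank 0; all other cells are 0.
initial : List ℕ → Store
initial input zero    = cells input
initial input (suc _) = λ _ → 0

output : Store → ℕ
output σ = σ 1 0

Computable : (ℕ → ℕ) → Set
Computable f = ∃[ P ] ∀ m → ∃[ σ ] ∃[ t ]
  ⟨ P , initial [ m ] ⟩⇓⟨ σ , t ⟩ × output σ ≡ f m

-- On the given input, P halts within the given number of steps, with
-- output 1 exactly when Yes holds.
DecidesWithin : Program → List ℕ → Set → ℕ → Set
DecidesWithin P input Yes bound = ∃[ σ ] ∃[ t ]
  ⟨ P , initial input ⟩⇓⟨ σ , t ⟩ × t ≤ bound × (output σ ≡ 1 ⇔ Yes)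

------------------------------------------------------------------------
-- Instances as machine input: every number fills one cell, vertex sets
-- are 0/1 vectors, and matrices are stored row by row.

bit : Bool → ℕ
bit false = 0
bit true  = 1

module _ {n} (I : LoadCVRP n) where
  open LoadCVRP I

  matrix : (Fin n → Fin n → ℕ) → List ℕ
  matrix f = concat (tabulate λ u → tabulate (f u))

  encodeBody : List ℕ
  encodeBody =
    tabulate (λ v → bit ⌊ v ∈? depots ⌋) ++
    tabulate (λ v → bit ⌊ v ∈? clients ⌋) ++
    tabulate (λ v → orZero (v ∈? clients) (demand v)) ++
    matrix (λ u v → bit (adjacent u v)) ++
    matrix (λ u v → orZero (T? (adjacent u v)) (weight u v))

encodeLoadCVRP : ∀ {n} → LoadCVRP n → ℕ → List ℕ
encodeLoadCVRP {n} I r =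
  n ∷ r ∷ fleet ∷ loadCapacity ∷ encodeBody I
  where open LoadCVRP I

encodeLoadGasCVRP : ∀ {n} → LoadGasCVRP n → ℕ → List ℕ
encodeLoadGasCVRP {n} I r =
  n ∷ r ∷ fleet ∷ loadCapacity ∷ gasCapacity ∷ encodeBody loadCVRP
  where open LoadGasCVRP I

{-# OPTIONS --safe #-}
module Submission where

-- Since every edge has positive weight, a routing of weight at most r has
-- at most r vehicles that move, each making at most r steps; every
-- other vehicle stands at a depot and serves at most that depot. So the
-- choice of the moving vehicles is described by a tape that lists the
-- weight of each of the r² steps, whether a depot or another client is
-- served after it, and the colour of that client. Given a tape, the
-- least load of a vehicle that follows it is found by dynamic programming
-- over the vertices, for each starting depot. Clients of distinct colours
-- are distinct; hence the routing serves everything if the tape serves as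
-- many clients outside the depots as there are, and it needs no more
-- vehicles than available if enough depots are served on the way.
--
-- Colours are vectors of r² bits of the vertex number, at positions that
-- also stand on the tape: k vertices are told apart by fewer than k of
-- their bits. With O(r²) digits below O(log n) · 2 ^ O(r²) there are only
-- f(r) · n tapes, because L ^ k ≤ k ^ k · 2 ^ L, and all of them are tried.
--
-- The algorithm is written in a language of total terms whose loop counts
-- are fixed parameters, so that its running time is bounded by a fixed
-- power of the largest parameter.

open import Defs
open import Data.Bool.Base using (Bool; true; false; T; if_then_else_)
open import Data.Bool.Properties using (T?)
open import Data.Empty using (⊥)
open import Data.Fin.Base using (Fin; zero; suc; toℕ; fromℕ<; combine; remQuot)
import Data.Fin.Properties as Fin
open import Data.Fin.Subset using (_∈_; _∉_)
open import Data.Fin.Subset.Properties using (_∈?_)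
open import Data.List.Base
  using (List; []; _∷_; [_]; _++_; map; filter; length; lookup; allFin; cartesianProduct; concat; tabulate)
open import Data.List.Membership.Propositional using (find; lose) renaming (_∈_ to _∈ₗ_)
open import Data.List.Membership.Propositional.Properties
open import Data.List.Properties using (length-++; length-map; length-tabulate; ++-assoc; ++-identityʳ)
open import Data.List.Relation.Unary.All using ([]; _∷_)
import Data.List.Relation.Unary.All as All
open import Data.List.Relation.Unary.All.Properties using (all-filter)
open import Data.List.Relation.Unary.Any using (Any; here; there; any?; index)
open import Data.List.Relation.Unary.Any.Properties using (lookup-index)
open import Data.List.Relation.Unary.Unique.Propositional using (Unique; []; _∷_)
import Data.List.Relation.Unary.Unique.Propositional.Properties as Unique
open import Data.Maybe.Base using (Maybe; just; nothing)
import Data.Maybe.Properties as Maybe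
open import Data.Nat.Base
open import Data.Nat.DivMod using (_/_; _%_; m≡m%n+[m/n]*n; m%n<n; m<n*o⇒m/o<n)
open import Data.Nat.Properties
open import Data.Nat.Tactic.RingSolver using (solve-∀)
open import Data.Product.Base using (Σ; ∃-syntax; _×_; _,_; proj₁; proj₂; uncurry)
import Data.Product.Properties as Product
open import Data.Sum.Base using (_⊎_; inj₁; inj₂)
open import Data.Sum.Properties using (inj₁-injective; inj₂-injective)
open import Data.Unit.Base using (⊤; tt)
open import Data.Vec.Base using (Vec; []; _∷_)
import Data.Vec.Base as Vec
import Data.Vec.Properties as Vec
open import Function.Base using (_∘_)
open import Function.Bundles using (_⇔_; mk⇔; Equivalence)
open import Relation.Binary.Construct.Closure.ReflexiveTransitive using (ε; _◅_)
open import Relation.Binary.PropositionalEquality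
  using (_≡_; _≢_; refl; sym; trans; cong; cong₂; subst; subst₂)
open import Relation.Nullary using (Dec; yes; no; ¬_; contradiction; recompute)
open import Relation.Nullary.Decidable using (⌊_⌋; ¬?; _×-dec_; decidable-stable; isYes≗does)
open Equivalence using (to; from)

-- A term language and its compilation

-- Neither the tape nor the dynamic program can afford to name clients: r² vertex names on a tape
-- would give a power of n whose exponent depends on r, and a table over sets of served clients
-- would be exponential in n. Colours replace both. They make services to different clients visibly
-- different, so vehicles interact only through the tape, and each vehicle can be routed on its own.
--
-- Depot clients need separate treatment because their number is not bounded by r: each may have a
-- stationary vehicle to itself. Only those served by a moving vehicle appear on the tape, and the
-- rest are counted.
--
-- Demands, weights and capacities may be huge compared with n and r. Hence they never bound a loop:
-- a table entry holds a load, and no table is indexed by loads.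
--
-- The machine only adds and subtracts, so products, quotients and digits are computed by counting,
-- in time polynomial in the numbers involved. A tape is such a number too. This is harmless because
-- the number of tapes is at most X = f(r) · n, and this one X bounds every loop count; a fixed
-- power of X then splits into a function of r and a power of n.

foldℕ : ∀ {A : Set} → ℕ → A → (ℕ → A → A) → A
foldℕ zero    z f = z
foldℕ (suc N) z f = f N (foldℕ N z f)

cond : ∀ {A : Set} → ℕ → A → A → A
cond zero    x y = y
cond (suc _) x y = x

-- A term with m variables. Loop counts are parameters, which are fixed
-- before a term runs. The term `dp p z f e` builds p successive arrays of
-- width `inp 0`, the first from z and each next one from f, and returns
-- entry e of the last; f sees the entry being filled, the round, and
-- (through `arr`) the previous array. The flag is true exactly inside z
-- and f.
data Tm : ℕ → Bool → Set where
  lit         : ∀ {m b} → ℕ → Tm m b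
  var         : ∀ {m b} → Fin m → Tm m b
  par         : ∀ {m b} → ℕ → Tm m b
  inp         : ∀ {m b} → Tm m b → Tm m b
  arr         : ∀ {m} → Tm m true → Tm m true
  _⊞_ _⊟_     : ∀ {m b} → Tm m b → Tm m b → Tm m b
  ite         : ∀ {m b} → Tm m b → Tm m b → Tm m b → Tm m b
  fold        : ∀ {m b} → ℕ → Tm m b → Tm (2 + m) b → Tm m b
  call        : ∀ {m b k} → Tm k b → (Fin k → Tm m b) → Tm m b
  dp          : ∀ {m} → ℕ → Tm (1 + m) true → Tm (2 + m) true → Tm m false → Tm m false

infixl 6 _⊞_ _⊟_

-- Arrays read 0 outside their width.
clip : ℕ → (ℕ → ℕ) → ℕ → ℕ
clip n A a = cond (n ∸ a) (A a) 0

module _ (I P : ℕ → ℕ) where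

  ⟦_⟧ : ∀ {m b} → Tm m b → (ℕ → ℕ) → Vec ℕ m → ℕ
  ⟦ lit k ⟧ A η = k
  ⟦ var x ⟧ A η = Vec.lookup η x
  ⟦ par p ⟧ A η = P p
  ⟦ inp e ⟧ A η = I (⟦ e ⟧ A η)
  ⟦ arr e ⟧ A η = clip (I 0) A (⟦ e ⟧ A η)
  ⟦ d ⊞ e ⟧ A η = ⟦ d ⟧ A η + ⟦ e ⟧ A η
  ⟦ d ⊟ e ⟧ A η = ⟦ d ⟧ A η ∸ ⟦ e ⟧ A η
  ⟦ ite c d e ⟧ A η = cond (⟦ c ⟧ A η) (⟦ d ⟧ A η) (⟦ e ⟧ A η)
  ⟦ fold p z f ⟧ A η = foldℕ (P p) (⟦ z ⟧ A η) (λ i x → ⟦ f ⟧ A (i ∷ x ∷ η))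
  ⟦ call f es ⟧ A η = ⟦ f ⟧ A (Vec.tabulate (λ x → ⟦ es x ⟧ A η))
  ⟦ dp p z f e ⟧ A η =
    clip (I 0) (foldℕ (P p) (λ a → ⟦ z ⟧ (λ _ → 0) (a ∷ η)) (λ t B a → ⟦ f ⟧ B (a ∷ t ∷ η)))
         (⟦ e ⟧ A η)

-- Compilation: bank 0 holds the input, bank 1 the parameters, bank 2 the
-- registers, and banks 3 and 4 the previous and the next array.

reg : ℕ → Expr
reg d = 2 ‼ const d

set : ℕ → Expr → Program
set d e = 2 ‼ const d ≔ e

For : Expr → ℕ → Program → Program
For c d P = set d (const 0) ⨾ While c ⊖ reg d Do (P ⨾ set d (reg d ⊕ const 1))

width : Expr
width = 0 ‼ const 0

extend : ∀ {m} → ℕ → (Fin m → ℕ) → Fin (suc m) → ℕ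
extend d ρ zero    = d
extend d ρ (suc x) = ρ x

readArray : ℕ → Program
readArray d = If width ⊖ reg d Then set d (3 ‼ reg d) Else set d (const 0)

-- Two passes are needed because every new entry may read all of the previous array; bank 3 has to
-- survive until the last entry of bank 4 is known.
fillArray : ℕ → Program → Program
fillArray d P =
  For width d (P ⨾ 4 ‼ reg d ≔ reg (suc d)) ⨾
  For width d (3 ‼ reg d ≔ 4 ‼ reg d)

-- The i-th argument is left in register d + i.
compArgs : ∀ k → ℕ → (Fin k → ℕ → Program) → Program
compArgs zero    d g = skip
compArgs (suc k) d g = g zero d ⨾ compArgs k (suc d) (λ x → g (suc x))

-- Stack discipline: the value ends up in register d, registers below d are live and stay untouched,
-- and those above d are scratch space. The map ρ tells in which live register a variable is kept.
comp : ∀ {m b} → ℕ → (Fin m → ℕ) → Tm m b → Program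
comp d ρ (lit k) = set d (const k)
comp d ρ (var x) = set d (reg (ρ x))
comp d ρ (par p) = set d (1 ‼ const p)
comp d ρ (inp e) = comp d ρ e ⨾ set d (0 ‼ reg d)
comp d ρ (arr e) = comp d ρ e ⨾ readArray d
comp d ρ (e ⊞ e′) = comp d ρ e ⨾ comp (suc d) ρ e′ ⨾ set d (reg d ⊕ reg (suc d))
comp d ρ (e ⊟ e′) = comp d ρ e ⨾ comp (suc d) ρ e′ ⨾ set d (reg d ⊖ reg (suc d))
comp d ρ (ite c e e′) = comp d ρ c ⨾ If reg d Then comp d ρ e Else comp d ρ e′
comp d ρ (fold p z f) =
  comp d ρ z ⨾
  For (1 ‼ const p) (1 + d)
    (comp (2 + d) (extend (1 + d) (extend d ρ)) f ⨾ set d (reg (2 + d)))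
comp d ρ (call {k = k} f es) =
  compArgs k d (λ x c → comp c ρ (es x)) ⨾ comp (k + d) (λ x → toℕ x + d) f ⨾ set d (reg (k + d))
comp d ρ (dp p z f e) =
  comp d ρ e ⨾
  -- Bank 3 may hold the result of an earlier `dp`, while the semantics lets z see the zero array.
  For width (1 + d) (3 ‼ reg (1 + d) ≔ const 0) ⨾
  fillArray (1 + d) (comp (2 + d) (extend (1 + d) ρ) z) ⨾
  For (1 ‼ const p) (1 + d)
    (fillArray (2 + d) (comp (3 + d) (extend (2 + d) (extend (1 + d) ρ)) f)) ⨾
  readArray d

-- Resetting the counter takes 3 steps, a test 6 and an increment 6; the last 6 belong to the
-- failing test. This presumes a loop bound of expression cost 2, which both `width` and a parameter
-- have.
forCost : ℕ → ℕ → ℕ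
forCost N c = 3 + (N * (12 + c) + 6)

fillCost : ℕ → ℕ → ℕ
fillCost n c = forCost n (c + 5) + forCost n 6

costArgs : ∀ k → (Fin k → ℕ) → ℕ
costArgs zero    g = 1
costArgs (suc k) g = g zero + costArgs k (λ x → g (suc x))

module _ (I P : ℕ → ℕ) where

  -- The bound may depend on the width and the parameters but not on computed values; hence both
  -- branches of `ite` are charged.
  cost : ∀ {m b} → Tm m b → ℕ

  cost (lit k) = 3
  cost (var x) = 4
  cost (par p) = 4
  cost (inp e) = cost e + 5
  cost (arr e) = cost e + 11
  cost (e ⊞ e′) = cost e + (cost e′ + 7)
  cost (e ⊟ e′) = cost e + (cost e′ + 7)
  cost (ite c e e′) = cost c + (3 + (cost e + cost e′))
  cost (fold p z f) = cost z + forCost (P p) (cost f + 4)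
  cost (call {k = k} f es) = costArgs k (λ x → cost (es x)) + (cost f + 4)
  cost (dp p z f e) =
    cost e + (forCost (I 0) 4 + (fillCost (I 0) (cost z) +
      (forCost (P p) (fillCost (I 0) (cost f)) + 11)))

-- Correctness of the compilation

update-same : ∀ σ b a m → update σ b a m b a ≡ m
update-same σ b a m with b ≟ b | a ≟ a
... | yes _ | yes _ = refl
... | yes _ | no ¬p = contradiction refl ¬p
... | no ¬p | _     = contradiction refl ¬p

update-addr : ∀ σ b {a a′} m → a′ ≢ a → update σ b a m b a′ ≡ σ b a′
update-addr σ b {a} {a′} m a′≢a with b ≟ b | a′ ≟ a
... | _     | yes p = contradiction p a′≢a
... | yes _ | no _  = refl
... | no _  | no _  = refl

-- A Hoare triple for total correctness with a step bound. Since Q may itself be a `Runs` statement,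
-- sequential composition is nesting.
Runs : Program → Store → ℕ → (Store → Set) → Set
Runs P σ c Q = ∃[ τ ] ∃[ t ] ⟨ P , σ ⟩⇓⟨ τ , t ⟩ × t ≤ c × Q τ

runs-weaken : ∀ {P σ c c′ Q R} → c ≤ c′ → (∀ {τ} → Q τ → R τ) → Runs P σ c Q → Runs P σ c′ R
runs-weaken c≤c′ Q⇒R (τ , t , run , t≤c , q) = τ , t , run , ≤-trans t≤c c≤c′ , Q⇒R q

runs-seq : ∀ {P P′ σ c c′ Q} → Runs P σ c (λ τ → Runs P′ τ c′ Q) → Runs (P ⨾ P′) σ (c + c′) Q
runs-seq (τ , t , run , t≤c , (τ′ , t′ , run′ , t′≤c′ , q)) =
  τ′ , t + t′ , seq⇓ run run′ , +-mono-≤ t≤c t′≤c′ , q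

runs-assign : ∀ {b a e σ} {Q : Store → Set} → Q (update σ b (eval σ a) (eval σ e)) →
              Runs (b ‼ a ≔ e) σ (1 + exprCost a + exprCost e) Q
runs-assign q = _ , _ , assign⇓ , ≤-refl , q

module _ {c : Expr} {d N : ℕ} {P : Program} {B : ℕ} (Inv : ℕ → Store → Set)
  (reads : ∀ {k σ} → Inv k σ → eval σ c ≡ N × σ 2 d ≡ k)
  (step : ∀ {k σ} → k < N → Inv k σ →
          Runs P σ B (λ τ → τ 2 d ≡ k × Inv (suc k) (update τ 2 d (suc k)))) where

  runs-while : ∀ j k {σ} → k + j ≡ N → Inv k σ →
    ∃[ τ ] ∃[ t ] ⟨ While c ⊖ reg d Do (P ⨾ set d (reg d ⊕ const 1)) , σ ⟩⇓⟨ τ , t ⟩ ×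
    t ≤ j * (10 + exprCost c + B) + (4 + exprCost c) × Inv N τ
  runs-while zero k {σ} k+0≡N inv with trans (sym (+-identityʳ k)) k+0≡N
  ... | refl = σ , _ ,
    whileFalse⇓ (trans (cong₂ _∸_ (proj₁ (reads inv)) (proj₂ (reads inv))) (n∸n≡0 k)) ,
    ≤-reflexive (cong (2 +_) (+-comm (exprCost c) 2)) , inv
  runs-while (suc j) k {σ} k+j≡N inv
    with step (m+1+n≤m⇒⊥ k+j≡N) inv
    where
    m+1+n≤m⇒⊥ : k + suc j ≡ N → k < N
    m+1+n≤m⇒⊥ eq = subst (k <_) eq (m<m+n k z<s)
  ... | τ , t , run , t≤B , (τd≡k , inv′)
    with runs-while j (suc k) (trans (sym (+-suc k j)) k+j≡N)
           (subst (λ v → Inv (suc k) (update τ 2 d v)) (sym (trans (cong (_+ 1) τd≡k) (+-comm k 1))) inv′)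
  ... | τ′ , t′ , run′ , t′≤ , inv″ =
    τ′ , _ , whileTrue⇓ (λ eq → m>n⇒m∸n≢0 (subst (k <_) k+j≡N (m<m+n k z<s))
                 (trans (sym (cong₂ _∸_ (proj₁ (reads inv)) (proj₂ (reads inv)))) eq))
               (seq⇓ run assign⇓) run′ ,
    bound , inv″
    where
    bound : 1 + (1 + exprCost c + 2) + (t + 6) + t′ ≤ suc j * (10 + exprCost c + B) + (4 + exprCost c)
    bound = begin
      1 + (1 + exprCost c + 2) + (t + 6) + t′
        ≤⟨ +-mono-≤ (+-monoʳ-≤ (1 + (1 + exprCost c + 2)) (+-monoˡ-≤ 6 t≤B)) t′≤ ⟩
      1 + (1 + exprCost c + 2) + (B + 6) + (j * (10 + exprCost c + B) + (4 + exprCost c))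
        ≡⟨ cong (_+ (j * (10 + exprCost c + B) + (4 + exprCost c))) (lemma (exprCost c) B) ⟩
      10 + exprCost c + B + (j * (10 + exprCost c + B) + (4 + exprCost c))
        ≡⟨ sym (+-assoc (10 + exprCost c + B) (j * (10 + exprCost c + B)) (4 + exprCost c)) ⟩
      suc j * (10 + exprCost c + B) + (4 + exprCost c) ∎
      where
      open ≤-Reasoning
      lemma : ∀ x y → 1 + (1 + x + 2) + (y + 6) ≡ 10 + x + y
      lemma = solve-∀

  runs-for : ∀ {σ} → exprCost c ≡ 2 → Inv 0 (update σ 2 d 0) →
             Runs (For c d P) σ (forCost N B) (Inv N)
  runs-for {σ} c≡2 inv =
    runs-seq (runs-assign (runs-weaken (≤-reflexive (cong (λ x → N * (10 + x + B) + (4 + x)) c≡2)) (λ q → q)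
      (runs-while N 0 refl inv)))

-- There is only one pair of array banks. A term with flag true runs while an array is being read or
-- filled and must spare both banks; a term with flag false may contain a `dp` and promises nothing
-- about them.
record Keeps (d : ℕ) (b : Bool) (σ τ : Store) : Set where
  field
    keeps-inp : ∀ a → τ 0 a ≡ σ 0 a
    keeps-par : ∀ a → τ 1 a ≡ σ 1 a
    keeps-reg : ∀ {j} → j < d → τ 2 j ≡ σ 2 j
    keeps-arr : T b → ∀ a → τ 3 a ≡ σ 3 a × τ 4 a ≡ σ 4 a
open Keeps

keeps-refl : ∀ {d b σ} → Keeps d b σ σ
keeps-refl = record { keeps-inp = λ _ → refl ; keeps-par = λ _ → refl
                    ; keeps-reg = λ _ → refl ; keeps-arr = λ _ _ → refl , refl }

keeps-trans : ∀ {d d′ b b′ σ τ υ} → d ≤ d′ → (T b → T b′) →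
              Keeps d b σ τ → Keeps d′ b′ τ υ → Keeps d b σ υ
keeps-trans d≤d′ b⇒b′ k k′ = record
  { keeps-inp = λ a → trans (keeps-inp k′ a) (keeps-inp k a)
  ; keeps-par = λ a → trans (keeps-par k′ a) (keeps-par k a)
  ; keeps-reg = λ j<d → trans (keeps-reg k′ (≤-trans j<d d≤d′)) (keeps-reg k j<d)
  ; keeps-arr = λ tb a → trans (proj₁ (keeps-arr k′ (b⇒b′ tb) a)) (proj₁ (keeps-arr k tb a))
                       , trans (proj₂ (keeps-arr k′ (b⇒b′ tb) a)) (proj₂ (keeps-arr k tb a)) }

keeps-set : ∀ {d b σ τ j v} → d ≤ j → Keeps d b σ τ → Keeps d b σ (update τ 2 j v)
keeps-set {τ = τ} {j} {v} d≤j k = record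
  { keeps-inp = keeps-inp k ; keeps-par = keeps-par k
  ; keeps-reg = λ i<d → trans (update-addr τ 2 v (<⇒≢ (≤-trans i<d d≤j))) (keeps-reg k i<d)
  ; keeps-arr = keeps-arr k }

keeps-arr3 : ∀ {d σ τ a v} → Keeps d false σ τ → Keeps d false σ (update τ 3 a v)
keeps-arr3 k = record { keeps-inp = keeps-inp k ; keeps-par = keeps-par k
                      ; keeps-reg = keeps-reg k ; keeps-arr = λ () }

keeps-arr4 : ∀ {d σ τ a v} → Keeps d false σ τ → Keeps d false σ (update τ 4 a v)
keeps-arr4 k = record { keeps-inp = keeps-inp k ; keeps-par = keeps-par k
                      ; keeps-reg = keeps-reg k ; keeps-arr = λ () }

upTo-update : ∀ σ b k v (f : ℕ → ℕ) → v ≡ f k → (∀ a → a < k → σ b a ≡ f a) →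
              ∀ a → a < suc k → update σ b k v b a ≡ f a
upTo-update σ b k v f v≡ H a a<1+k = go (a ≟ k)
  where
  go : Dec (a ≡ k) → update σ b k v b a ≡ f a
  go (yes refl) = trans (update-same σ b k v) v≡
  go (no a≢k)   = trans (update-addr σ b v a≢k) (H a (≤∧≢⇒< (s≤s⁻¹ a<1+k) a≢k))

module _ (I P : ℕ → ℕ) where

  record Models {m} (b : Bool) (d : ℕ) (ρ : Fin m → ℕ) (A : ℕ → ℕ) (η : Vec ℕ m)
                (σ : Store) : Set where
    field
      input  : ∀ a → σ 0 a ≡ I a
      params : ∀ a → σ 1 a ≡ P a
      array  : T b → ∀ a → a < I 0 → σ 3 a ≡ A a
      bound  : ∀ x → ρ x < d
      vars   : ∀ x → σ 2 (ρ x) ≡ Vec.lookup η x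
  open Models

  models-keep : ∀ {m b d e A ρ η σ τ} → Models {m} b d ρ A η σ → d ≤ e →
                Keeps d b σ τ → Models b e ρ A η τ
  models-keep M d≤e k = record
    { input  = λ a → trans (keeps-inp k a) (input M a)
    ; params = λ a → trans (keeps-par k a) (params M a)
    ; array  = λ tb a a<n → trans (proj₁ (keeps-arr k tb a)) (array M tb a a<n)
    ; bound  = λ x → ≤-trans (bound M x) d≤e
    ; vars   = λ x → trans (keeps-reg k (bound M x)) (vars M x) }

  models-extend : ∀ {m b d e ρ A η σ v} → Models {m} b d ρ A η σ → d ≤ e → σ 2 e ≡ v →
                  Models b (suc e) (extend e ρ) A (v ∷ η) σ
  models-extend M d≤e eq = record
    { input = input M ; params = params M ; array = array M
    ; bound = λ { zero → ≤-refl ; (suc x) → ≤-trans (bound M x) (m≤n⇒m≤1+n d≤e) }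
    ; vars  = λ { zero → eq ; (suc x) → vars M x } }

  Computes : ∀ (b : Bool) (d : ℕ) (σ : Store) (v : ℕ) → Store → Set
  Computes b d σ v τ = τ 2 d ≡ v × Keeps d b σ τ

  runs-set : ∀ {b d σ₀ σ v} e → Keeps d b σ₀ σ → eval σ e ≡ v →
             Runs (set d e) σ (2 + exprCost e) (Computes b d σ₀ v)
  runs-set {d = d} {σ = σ} e k refl = runs-assign
    (update-same σ 2 d _ , keeps-set ≤-refl k)

  runs-readArray : ∀ {b d σ₀ σ A a} → Keeps d b σ₀ σ → σ 0 0 ≡ I 0 → σ 2 d ≡ a →
                   (∀ a → a < I 0 → σ 3 a ≡ A a) →
                   Runs (readArray d) σ 11 (Computes b d σ₀ (clip (I 0) A a))
  runs-readArray {d = d} {σ = σ} {A} {a} k n≡ a≡ arr≡ with I 0 ∸ a in eq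
  ... | zero = let τ , t , run , t≤ , q = runs-set (const 0) k refl in
    τ , _ , ifFalse⇓ (trans (cong₂ _∸_ n≡ a≡) eq) run , +-mono-≤ (≤-refl {6}) (≤-trans t≤ (m≤m+n 3 2)) , q
  ... | suc _ = let τ , t , run , t≤ , q = runs-set (3 ‼ reg d) k
                                             (trans (cong (σ 3) a≡) (arr≡ a (m<n a eq))) in
    τ , _ , ifTrue⇓ (λ z → 1+n≢0 (trans (sym eq) (trans (sym (cong₂ _∸_ n≡ a≡)) z))) run
      , +-mono-≤ (≤-refl {6}) t≤ , q
    where
    m<n : ∀ {n k} a → n ∸ a ≡ suc k → a < n
    m<n {suc n} zero    _ = z<s
    m<n {suc n} (suc a) e = s<s (m<n a e)

  Correct : ∀ {m b} → Tm m b → Set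
  Correct {m} {b} e = ∀ {d ρ A η σ} → Models b d ρ A η σ →
    Runs (comp d ρ e) σ (cost I P e) (Computes b d σ (⟦_⟧ I P e A η))

  correct-binary : ∀ {m b} {e e′ : Tm m b} (op : Expr → Expr → Expr) (f : ℕ → ℕ → ℕ) →
    (∀ σ x y → eval σ (op x y) ≡ f (eval σ x) (eval σ y)) →
    (∀ x y → exprCost (op x y) ≡ 1 + exprCost x + exprCost y) →
    Correct e → Correct e′ → ∀ {d ρ A η σ} → Models b d ρ A η σ →
    Runs (comp d ρ e ⨾ comp (suc d) ρ e′ ⨾ set d (op (reg d) (reg (suc d)))) σ
         (cost I P e + (cost I P e′ + 7))
         (Computes b d σ (f (⟦_⟧ I P e A η) (⟦_⟧ I P e′ A η)))
  correct-binary op f ev co he he′ {d} M =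
    runs-seq (runs-weaken ≤-refl (λ { {τ} (v , k) →
      runs-seq (runs-weaken ≤-refl (λ { {τ′} (v′ , k′) →
        runs-weaken (≤-reflexive (cong (2 +_) (co (reg d) (reg (suc d))))) (λ q → q)
          (runs-set (op (reg d) (reg (suc d)))
            (keeps-trans (n≤1+n d) (λ t → t) k k′)
            (trans (ev τ′ (reg d) (reg (suc d))) (cong₂ f (trans (keeps-reg k′ (n<1+n d)) v) v′))) })
      (he′ (models-keep M (n≤1+n d) k))) })
    (he M))

  correct-args : ∀ {m b} k {es : Fin k → Tm m b} → (∀ x → Correct (es x)) →
    ∀ {d ρ A η σ} → Models b d ρ A η σ →
    Runs (compArgs k d (λ x c → comp c ρ (es x))) σ (costArgs k (λ x → cost I P (es x)))
         (λ τ → (∀ x → τ 2 (toℕ x + d) ≡ ⟦_⟧ I P (es x) A η) × Keeps d b σ τ)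
  correct-args zero    hs M = _ , _ , skip⇓ , ≤-refl , (λ ()) , keeps-refl
  correct-args (suc k) hs {d} M =
    runs-seq (runs-weaken ≤-refl (λ { {τ} (v , kp) →
      runs-weaken ≤-refl (λ { {τ′} (vs , kp′) →
        (λ { zero    → trans (keeps-reg kp′ (n<1+n d)) v
           ; (suc x) → trans (cong (τ′ 2) (sym (+-suc (toℕ x) d))) (vs x) })
        , keeps-trans (n≤1+n d) (λ t → t) kp kp′ })
      (correct-args k (λ x → hs (suc x)) (models-keep M (n≤1+n d) kp)) })
    (hs zero M))

  correct-fold : ∀ {m b} p {z : Tm m b} {f : Tm (2 + m) b} → Correct z → Correct f → Correct (fold p z f)
  correct-fold {m} {b} p {z} {f} hz hf {d} {ρ} {A} {η} {σ₀} M =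
    runs-seq (runs-weaken ≤-refl (λ { {σ} (v , k) →
      runs-weaken ≤-refl (λ { (_ , v′ , k′) → v′ , k′ })
        (runs-for Inv (λ { {σ = τ} (i≡ , _ , kp) → trans (keeps-par kp p) (params M p) , i≡ })
          step refl
          ( update-same σ 2 (suc d) 0
          , trans (update-addr σ 2 0 (<⇒≢ (n<1+n d))) v
          , keeps-set (n≤1+n d) k)) })
    (hz M))
    where
    val : ℕ → ℕ
    val k = foldℕ k (⟦_⟧ I P z A η) (λ i x → ⟦_⟧ I P f A (i ∷ x ∷ η))
    Inv : ℕ → Store → Set
    Inv k σ = σ 2 (suc d) ≡ k × σ 2 d ≡ val k × Keeps d b σ₀ σ
    step : ∀ {k σ} → k < P p → Inv k σ →
           Runs (comp (2 + d) (extend (1 + d) (extend d ρ)) f ⨾ set d (reg (2 + d))) σ (cost I P f + 4)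
             (λ τ → τ 2 (suc d) ≡ k × Inv (suc k) (update τ 2 (suc d) (suc k)))
    step {k} {σ} _ (i≡ , x≡ , kp) =
      runs-seq (runs-weaken ≤-refl (λ { {τ} (v , kp′) →
        runs-assign
          ( trans (update-addr τ 2 (τ 2 (2 + d)) (λ e → 1+n≢n e))
              (trans (keeps-reg kp′ (n<1+n (suc d))) i≡)
          , update-same (update τ 2 d (τ 2 (2 + d))) 2 (suc d) (suc k)
          , trans (update-addr (update τ 2 d (τ 2 (2 + d))) 2 (suc k) (<⇒≢ (n<1+n d)))
              (trans (update-same τ 2 d (τ 2 (2 + d))) v)
          , keeps-set (n≤1+n d) (keeps-set ≤-refl
              (keeps-trans (m≤n+m d 2) (λ t → t) kp kp′))) })
      (hf (models-extend (models-extend (models-keep M ≤-refl kp) ≤-refl x≡) ≤-refl i≡)))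

  -- The term g has flag true, so computing one entry disturbs neither the old array nor the new
  -- entries collected so far.
  fillArray-correct : ∀ {m} {g : Tm (1 + m) true} → Correct g →
    ∀ {q ρ A} {η : Vec ℕ m} {σ} → Models true q ρ A η σ →
    Runs (fillArray q (comp (suc q) (extend q ρ) g)) σ (fillCost (I 0) (cost I P g))
      (λ τ → (∀ a → a < I 0 → τ 3 a ≡ ⟦_⟧ I P g A (a ∷ η)) × Keeps q false σ τ)
  fillArray-correct {m} {g} hg {q} {ρ} {A} {η} {σ₀} M =
    runs-seq (runs-weaken ≤-refl (λ { {σ₁} (_ , next₁ , _ , k₁) →
      runs-weaken ≤-refl (λ { (_ , prev , _ , k₂) → prev , k₂ })
        (runs-for Copied (λ { (a≡ , _ , _ , k) → trans (keeps-inp k 0) (input M 0) , a≡ })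
          copy refl
          (update-same σ₁ 2 q 0 , (λ _ ()) , next₁ , keeps-set ≤-refl k₁)) })
    (runs-for Filled (λ { (a≡ , _ , _ , k) → trans (keeps-inp k 0) (input M 0) , a≡ })
      fill refl
      (update-same σ₀ 2 q 0 , (λ _ ()) , (λ _ → refl) , keeps-set ≤-refl keeps-refl)))
    where
    new : ℕ → ℕ
    new a = ⟦_⟧ I P g A (a ∷ η)

    Filled : ℕ → Store → Set
    Filled k σ = σ 2 q ≡ k × (∀ a → a < k → σ 4 a ≡ new a) ×
                 (∀ a → σ 3 a ≡ σ₀ 3 a) × Keeps q false σ₀ σ

    fill : ∀ {k σ} → k < I 0 → Filled k σ →
      Runs (comp (suc q) (extend q ρ) g ⨾ 4 ‼ reg q ≔ reg (suc q)) σ (cost I P g + 5)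
        (λ τ → τ 2 q ≡ k × Filled (suc k) (update τ 2 q (suc k)))
    fill {k} {σ} _ (k≡ , next , prev , kp) =
      runs-seq (runs-weaken ≤-refl (λ { {τ} (v , kp′) →
        runs-assign
          ( trans (keeps-reg kp′ (n<1+n q)) k≡
          , update-same τ 2 q (suc k)
          , subst (λ c → ∀ a → a < suc k → update τ 4 c (τ 2 (suc q)) 4 a ≡ new a)
              (sym (trans (keeps-reg kp′ (n<1+n q)) k≡))
              (upTo-update τ 4 k (τ 2 (suc q)) new v
                (λ a a<k → trans (proj₂ (keeps-arr kp′ tt a)) (next a a<k)))
          , (λ a → trans (proj₁ (keeps-arr kp′ tt a)) (prev a))
          , keeps-set ≤-refl (keeps-arr4 (keeps-trans (n≤1+n q) (λ ()) kp kp′))) })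
      (hg (models-extend M′ ≤-refl k≡)))
      where
      -- `models-keep` would require both array banks to be kept, but bank 4 is just being filled;
      -- that bank 3 is intact is part of the loop invariant.
      M′ : Models true q ρ A η σ
      M′ = record
        { input  = λ a → trans (keeps-inp kp a) (input M a)
        ; params = λ a → trans (keeps-par kp a) (params M a)
        ; array  = λ tb a a<n → trans (prev a) (array M tb a a<n)
        ; bound  = bound M
        ; vars   = λ x → trans (keeps-reg kp (bound M x)) (vars M x) }

    Copied : ℕ → Store → Set
    Copied k σ = σ 2 q ≡ k × (∀ a → a < k → σ 3 a ≡ new a) ×
                 (∀ a → a < I 0 → σ 4 a ≡ new a) × Keeps q false σ₀ σ

    copy : ∀ {k σ} → k < I 0 → Copied k σ →
      Runs (3 ‼ reg q ≔ 4 ‼ reg q) σ 6 (λ τ → τ 2 q ≡ k × Copied (suc k) (update τ 2 q (suc k)))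
    copy {k} {σ} k<n (k≡ , prev , next , kp) = runs-assign
      ( k≡ , update-same (update σ 3 (σ 2 q) (σ 4 (σ 2 q))) 2 q (suc k)
      , subst (λ c → ∀ a → a < suc k → update σ 3 c (σ 4 c) 3 a ≡ new a) (sym k≡)
          (upTo-update σ 3 k (σ 4 k) new (next k k<n) prev)
      , next , keeps-set ≤-refl (keeps-arr3 kp))

  correct-dp : ∀ {m} p {z : Tm (1 + m) true} {f : Tm (2 + m) true} {e : Tm m false} →
    Correct z → Correct f → Correct e → Correct (dp p z f e)
  correct-dp {m} p {z} {f} {e} hz hf he {d} {ρ} {A} {η} {σ₀} M =
    runs-seq (runs-weaken ≤-refl (λ { {σ₁} (v₁ , k₁) →
    runs-seq (runs-weaken ≤-refl (λ { {σ₂} (_ , v₂ , zero₂ , k₂) →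
    runs-seq (runs-weaken ≤-refl (λ { {σ₃} (arr₃ , k₃) →
    runs-seq (runs-weaken ≤-refl (λ { {σ₄} (_ , v₄ , arr₄ , k₄) →
    runs-readArray k₄ (trans (keeps-inp k₄ 0) (input M 0)) v₄ arr₄ })
    (runs-for Rounds (λ { (t≡ , _ , _ , k) → trans (keeps-par k p) (params M p) , t≡ }) next refl
      ( update-same σ₃ 2 (suc d) 0
      , trans (update-addr σ₃ 2 0 (<⇒≢ (n<1+n d))) (trans (keeps-reg k₃ (n<1+n d)) v₂)
      , arr₃ , keeps-set (n≤1+n d) (keeps-trans (n≤1+n d) (λ ()) k₂ k₃)))) })
    (fillArray-correct hz (withArray (n≤1+n d) (λ _ → 0) zero₂ k₂))) })
    (runs-for Zeroed (λ { (a≡ , _ , _ , k) → trans (keeps-inp k 0) (input M 0) , a≡ }) clear refl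
      ( update-same σ₁ 2 (suc d) 0
      , trans (update-addr σ₁ 2 0 (<⇒≢ (n<1+n d))) v₁
      , (λ _ ()) , keeps-set (n≤1+n d) k₁))) })
    (he M))
    where
    idx : ℕ
    idx = ⟦_⟧ I P e A η
    arrays : ℕ → ℕ → ℕ
    arrays k = foldℕ k (λ a → ⟦_⟧ I P z (λ _ → 0) (a ∷ η)) (λ t B a → ⟦_⟧ I P f B (a ∷ t ∷ η))

    withArray : ∀ {c σ} → d ≤ c → (B : ℕ → ℕ) → (∀ a → a < I 0 → σ 3 a ≡ B a) →
                Keeps d false σ₀ σ → Models true c ρ B η σ
    withArray d≤c B arr≡ k = record
      { input  = λ a → trans (keeps-inp k a) (input M a)
      ; params = λ a → trans (keeps-par k a) (params M a)
      ; array  = λ _ → arr≡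
      ; bound  = λ x → ≤-trans (bound M x) d≤c
      ; vars   = λ x → trans (keeps-reg k (bound M x)) (vars M x) }

    Zeroed : ℕ → Store → Set
    Zeroed k σ = σ 2 (suc d) ≡ k × σ 2 d ≡ idx × (∀ a → a < k → σ 3 a ≡ 0) × Keeps d false σ₀ σ
    clear : ∀ {k σ} → k < I 0 → Zeroed k σ → Runs (3 ‼ reg (suc d) ≔ const 0) σ 4
        (λ τ → τ 2 (suc d) ≡ k × Zeroed (suc k) (update τ 2 (suc d) (suc k)))
    clear {k} {σ} _ (k≡ , x≡ , zs , kp) = runs-assign
      ( k≡ , update-same (update σ 3 (σ 2 (suc d)) 0) 2 (suc d) (suc k)
      , trans (update-addr (update σ 3 (σ 2 (suc d)) 0) 2 (suc k) (<⇒≢ (n<1+n d))) x≡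
      , subst (λ c → ∀ a → a < suc k → update σ 3 c 0 3 a ≡ 0) (sym k≡)
          (upTo-update σ 3 k 0 (λ _ → 0) refl zs)
      , keeps-set (n≤1+n d) (keeps-arr3 kp))

    Rounds : ℕ → Store → Set
    Rounds k σ = σ 2 (suc d) ≡ k × σ 2 d ≡ idx × (∀ a → a < I 0 → σ 3 a ≡ arrays k a) ×
                 Keeps d false σ₀ σ
    next : ∀ {k σ} → k < P p → Rounds k σ →
      Runs (fillArray (2 + d) (comp (3 + d) (extend (2 + d) (extend (1 + d) ρ)) f)) σ
        (fillCost (I 0) (cost I P f))
        (λ τ → τ 2 (suc d) ≡ k × Rounds (suc k) (update τ 2 (suc d) (suc k)))
    next {k} {σ} _ (k≡ , x≡ , arr≡ , kp) =
      runs-weaken ≤-refl (λ { {τ} (arr′ , kp′) →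
        trans (keeps-reg kp′ (n<1+n (suc d))) k≡
        , update-same τ 2 (suc d) (suc k)
        , trans (update-addr τ 2 (suc k) (<⇒≢ (n<1+n d))) (trans (keeps-reg kp′ (m≤n+m (suc d) 1)) x≡)
        , arr′
        , keeps-set (n≤1+n d) (keeps-trans (m≤n+m d 2) (λ ()) kp kp′) })
      (fillArray-correct hf (models-extend (withArray (n≤1+n d) (arrays k) arr≡ kp) ≤-refl k≡))

  correct : ∀ {m b} (e : Tm m b) → Correct e
  correct (lit k) M = runs-set (const k) keeps-refl refl
  correct (var x) {ρ = ρ} M = runs-set (reg (ρ x)) keeps-refl (vars M x)
  correct (par p) M = runs-set (1 ‼ const p) keeps-refl (params M p)
  correct (inp e) {d} M = runs-seq (runs-weaken ≤-refl (λ { {τ} (v , k) →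
    runs-set (0 ‼ reg d) k (trans (cong (τ 0) v) (trans (keeps-inp k _) (input M _))) })
    (correct e M))
  correct (arr e) {d} M = runs-seq (runs-weaken ≤-refl (λ { {τ} (v , k) →
    runs-readArray k (trans (keeps-inp k 0) (input M 0)) v
      (λ a a<n → trans (proj₁ (keeps-arr k tt a)) (array M tt a a<n)) })
    (correct e M))
  correct (e ⊞ e′) M = correct-binary {e = e} {e′} _⊕_ _+_ (λ _ _ _ → refl) (λ _ _ → refl) (correct e) (correct e′) M
  correct (e ⊟ e′) M = correct-binary {e = e} {e′} _⊖_ _∸_ (λ _ _ _ → refl) (λ _ _ → refl) (correct e) (correct e′) M
  correct (ite c e e′) {d} {ρ} {A} {η} {σ₀} M = runs-seq (runs-weaken ≤-refl (λ { {τ} (v , k) →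
      branch v k }) (correct c M))
    where
    branch : ∀ {σ v} → σ 2 d ≡ v → Keeps d _ σ₀ σ →
      Runs (If reg d Then comp d ρ e Else comp d ρ e′) σ (3 + (cost I P e + cost I P e′))
        (Computes _ d σ₀ (cond v (⟦_⟧ I P e A η) (⟦_⟧ I P e′ A η)))
    branch {v = zero} v≡ k with correct e′ (models-keep M ≤-refl k)
    ... | τ , t , run , t≤ , (x , k′) = τ , _ , ifFalse⇓ v≡ run ,
      +-monoʳ-≤ 3 (≤-trans t≤ (m≤n+m _ (cost I P e))) , (x , keeps-trans ≤-refl (λ t → t) k k′)
    branch {v = suc _} v≡ k with correct e (models-keep M ≤-refl k)
    ... | τ , t , run , t≤ , (x , k′) = τ , _ , ifTrue⇓ (λ z → 1+n≢0 (trans (sym v≡) z)) run ,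
      +-monoʳ-≤ 3 (≤-trans t≤ (m≤m+n _ (cost I P e′))) , (x , keeps-trans ≤-refl (λ t → t) k k′)
  correct (fold p z f) M = correct-fold p {z} {f} (correct z) (correct f) M
  correct (call {k = k} f es) {d} M = runs-seq (runs-weaken ≤-refl (λ { {σ₁} (vs , k₁) →
    runs-seq (runs-weaken ≤-refl (λ { (v , k₂) →
      runs-set (reg (k + d)) (keeps-trans (m≤n+m d k) (λ t → t) k₁ k₂) v })
    (correct f (record
      { input  = λ a → trans (keeps-inp k₁ a) (input M a)
      ; params = λ a → trans (keeps-par k₁ a) (params M a)
      ; array  = λ tb a a<n → trans (proj₁ (keeps-arr k₁ tb a)) (array M tb a a<n)
      ; bound  = λ x → +-monoˡ-< d (Fin.toℕ<n x)
      ; vars   = λ x → trans (vs x) (sym (Vec.lookup∘tabulate _ x)) }))) })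
    (correct-args k (λ x → correct (es x)) M))
  correct (dp p z f e) M = correct-dp p {z} {f} {e} (correct z) (correct f) (correct e) M

-- Running time

-- The degree is fixed before the input, the parameters and X, so it is a constant of the program
-- text. The condition 2 ≤ X allows constants and sums to be absorbed into powers of X.
PolyBounded : ((ℕ → ℕ) → (ℕ → ℕ) → ℕ) → Set
PolyBounded c = ∃[ D ] ∀ I P X → 2 ≤ X → I 0 ≤ X → (∀ p → P p ≤ X) → c I P ≤ X ^ D

n<2^n : ∀ n → n < 2 ^ n
n<2^n zero    = z<s
n<2^n (suc n) = begin-strict
  suc n          <⟨ s<s (n<2^n n) ⟩
  suc (2 ^ n)    ≤⟨ +-monoˡ-≤ (2 ^ n) (m^n>0 2 n) ⟩
  2 ^ n + 2 ^ n  ≡⟨ cong (2 ^ n +_) (sym (+-identityʳ (2 ^ n))) ⟩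
  2 ^ suc n      ∎
  where open ≤-Reasoning

poly-const : ∀ k → PolyBounded (λ _ _ → k)
poly-const k = k , λ I P X 2≤X _ _ → ≤-trans (<⇒≤ (n<2^n k)) (^-monoˡ-≤ k 2≤X)

poly-* : ∀ {c d} → PolyBounded c → PolyBounded d → PolyBounded (λ I P → c I P * d I P)
poly-* (D , hc) (E , hd) = D + E , λ I P X x i p →
  ≤-trans (*-mono-≤ (hc I P X x i p) (hd I P X x i p)) (≤-reflexive (sym (^-distribˡ-+-* X D E)))

+-≤-^ : ∀ {X a b} D E → 2 ≤ X → a ≤ X ^ D → b ≤ X ^ E → a + b ≤ X ^ suc (D + E)
+-≤-^ {X@(suc _)} {a} {b} D E 2≤X a≤ b≤ = begin
  a + b                        ≤⟨ +-mono-≤ a≤ b≤ ⟩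
  X ^ D + X ^ E                ≤⟨ +-mono-≤ (^-monoʳ-≤ X (m≤m+n D E)) (^-monoʳ-≤ X (m≤n+m E D)) ⟩
  X ^ (D + E) + X ^ (D + E)    ≡⟨ cong (X ^ (D + E) +_) (sym (+-identityʳ _)) ⟩
  2 * X ^ (D + E)              ≤⟨ *-monoˡ-≤ (X ^ (D + E)) 2≤X ⟩
  X * X ^ (D + E)              ∎
  where open ≤-Reasoning

poly-+ : ∀ {c d} → PolyBounded c → PolyBounded d → PolyBounded (λ I P → c I P + d I P)
poly-+ (D , hc) (E , hd) = suc (D + E) , λ I P X x i p → +-≤-^ D E x (hc I P X x i p) (hd I P X x i p)

poly-width : PolyBounded (λ I _ → I 0)
poly-width = 1 , λ I P X _ i _ → ≤-trans i (≤-reflexive (sym (^-identityʳ X)))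

poly-par : ∀ p → PolyBounded (λ _ P → P p)
poly-par p = 1 , λ I P X _ _ h → ≤-trans (h p) (≤-reflexive (sym (^-identityʳ X)))

poly-for : ∀ {N c} → PolyBounded N → PolyBounded c → PolyBounded (λ I P → forCost (N I P) (c I P))
poly-for hN hc = poly-+ (poly-const 3) (poly-+ (poly-* hN (poly-+ (poly-const 12) hc)) (poly-const 6))

poly-fill : ∀ {c} → PolyBounded c → PolyBounded (λ I P → fillCost (I 0) (c I P))
poly-fill hc = poly-+ (poly-for poly-width (poly-+ hc (poly-const 5)))
                      (poly-for poly-width (poly-const 6))

poly-args : ∀ k (g : Fin k → (ℕ → ℕ) → (ℕ → ℕ) → ℕ) → (∀ x → PolyBounded (g x)) →
            PolyBounded (λ I P → costArgs k (λ x → g x I P))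
poly-args zero    g h = poly-const 1
poly-args (suc k) g h = poly-+ (h zero) (poly-args k (λ x → g (suc x)) (λ x → h (suc x)))

cost-poly : ∀ {m b} (e : Tm m b) → PolyBounded (λ I P → cost I P e)
cost-poly (lit k) = poly-const 3
cost-poly (var x) = poly-const 4
cost-poly (par p) = poly-const 4
cost-poly (inp e) = poly-+ (cost-poly e) (poly-const 5)
cost-poly (arr e) = poly-+ (cost-poly e) (poly-const 11)
cost-poly (e ⊞ e′) = poly-+ (cost-poly e) (poly-+ (cost-poly e′) (poly-const 7))
cost-poly (e ⊟ e′) = poly-+ (cost-poly e) (poly-+ (cost-poly e′) (poly-const 7))
cost-poly (ite c e e′) =
  poly-+ (cost-poly c) (poly-+ (poly-const 3) (poly-+ (cost-poly e) (cost-poly e′)))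
cost-poly (fold p z f) =
  poly-+ (cost-poly z) (poly-for (poly-par p) (poly-+ (cost-poly f) (poly-const 4)))
cost-poly (call {k = k} f es) =
  poly-+ (poly-args k (λ x I P → cost I P (es x)) (λ x → cost-poly (es x)))
         (poly-+ (cost-poly f) (poly-const 4))
cost-poly (dp p z f e) =
  poly-+ (cost-poly e) (poly-+ (poly-for poly-width (poly-const 4))
    (poly-+ (poly-fill (cost-poly z))
      (poly-+ (poly-for (poly-par p) (poly-fill (cost-poly f))) (poly-const 11))))

-- A straight-line program: each entry assigns a closed term to a parameter.
Script : Set
Script = List (ℕ × Tm 0 false)

assignPar : (ℕ → ℕ) → ℕ → ℕ → (ℕ → ℕ)
assignPar P p v q = if q ≡ᵇ p then v else P q

noArray : ℕ → ℕ
noArray _ = 0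

runScript : (I P : ℕ → ℕ) → Script → (ℕ → ℕ)
runScript I P []             = P
runScript I P ((p , e) ∷ es) = runScript I (assignPar P p (⟦_⟧ I P e noArray [])) es

compileScript : Script → Program
compileScript []             = skip
compileScript ((p , e) ∷ es) = comp 0 (λ ()) e ⨾ 1 ‼ const p ≔ reg 0 ⨾ compileScript es

scriptCost : (I P : ℕ → ℕ) → Script → ℕ
scriptCost I P []             = 1
scriptCost I P ((p , e) ∷ es) =
  cost I P e + (4 + scriptCost I (assignPar P p (⟦_⟧ I P e noArray [])) es)

if-cong : ∀ {A : Set} c {x x′ y y′ : A} → x ≡ x′ → y ≡ y′ →
          (if c then x else y) ≡ (if c then x′ else y′)
if-cong true  p q = p
if-cong false p q = q

runs-script : ∀ I P es {σ} → (∀ a → σ 0 a ≡ I a) → (∀ a → σ 1 a ≡ P a) →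
  Runs (compileScript es) σ (scriptCost I P es) (λ τ → ∀ a → τ 1 a ≡ runScript I P es a)
runs-script I P []             hI hP = _ , _ , skip⇓ , ≤-refl , hP
runs-script I P ((p , e) ∷ es) hI hP =
  runs-seq (runs-weaken ≤-refl (λ { {τ} (v , k) →
    runs-seq (runs-assign (runs-script I _ es
      (λ a → trans (Keeps.keeps-inp k a) (hI a))
      (λ a → trans
        -- After `isYes≗does` the test of `update` computes to `a ≡ᵇ p`, the test of `assignPar`.
        (cong (λ c → if c then τ 2 0 else τ 1 a) (isYes≗does ((1 ≟ 1) ×-dec (a ≟ p))))
        (if-cong (a ≡ᵇ p) v (trans (Keeps.keeps-par k a) (hP a)))))) })
  (correct I P e {A = noArray} (record { input = hI ; params = hP ; array = λ () ; bound = λ () ; vars = λ () })))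
-- A parameter, once assigned, becomes a loop count of later terms; the polynomial bound propagates
-- only if each assigned value stays below the same X.
ValuesBounded : (I P : ℕ → ℕ) (X : ℕ) → Script → Set
ValuesBounded I P X []             = ⊤
ValuesBounded I P X ((p , e) ∷ es) =
  ⟦_⟧ I P e noArray [] ≤ X × ValuesBounded I (assignPar P p (⟦_⟧ I P e noArray [])) X es

script-poly : ∀ es → ∃[ D ] ∀ I P X → 2 ≤ X → I 0 ≤ X → (∀ p → P p ≤ X) →
              ValuesBounded I P X es → scriptCost I P es ≤ X ^ D
script-poly []             = 0 , λ _ _ _ _ _ _ _ → ≤-refl
script-poly ((p , e) ∷ es) with cost-poly e | script-poly es
... | D , hD | E , hE = suc (D + suc (4 + E)) , λ I P X x i h (v , vs) →
  +-≤-^ D (suc (4 + E)) x (hD I P X x i h)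
    (+-≤-^ 4 E x (≤-trans (m≤m+n 4 12) (^-monoˡ-≤ 4 x))
      (hE I _ X x i (bounded {P = P} {p} v h) vs))
  where
  bounded : ∀ {P p v X} → v ≤ X → (∀ q → P q ≤ X) → ∀ q → assignPar P p v q ≤ X
  bounded {p = p} v h q with q ≡ᵇ p
  ... | true  = v
  ... | false = h q

-- Sums over lists

S : ∀ {A : Set} → List A → (A → ℕ) → ℕ
S []       f = 0
S (x ∷ xs) f = f x + S xs f

S-++ : ∀ {A : Set} (xs ys : List A) f → S (xs ++ ys) f ≡ S xs f + S ys f
S-++ []       ys f = refl
S-++ (x ∷ xs) ys f = trans (cong (f x +_) (S-++ xs ys f)) (sym (+-assoc (f x) _ _))

S-map : ∀ {A B : Set} (h : A → B) xs f → S (map h xs) f ≡ S xs (f ∘ h)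
S-map h []       f = refl
S-map h (x ∷ xs) f = cong (f (h x) +_) (S-map h xs f)

S-mono : ∀ {A : Set} (xs : List A) {f g} → (∀ x → f x ≤ g x) → S xs f ≤ S xs g
S-mono []       h = z≤n
S-mono (x ∷ xs) h = +-mono-≤ (h x) (S-mono xs h)

S-cong : ∀ {A : Set} (xs : List A) {f g} → (∀ x → f x ≡ g x) → S xs f ≡ S xs g
S-cong []       h = refl
S-cong (x ∷ xs) h = cong₂ _+_ (h x) (S-cong xs h)

S-× : ∀ {A B : Set} (xs : List A) (ys : List B) f →
      S (cartesianProduct xs ys) f ≡ S xs (λ x → S ys (λ y → f (x , y)))
S-× []       ys f = refl
S-× (x ∷ xs) ys f = trans (S-++ (map (x ,_) ys) _ f) (cong₂ _+_ (S-map (x ,_) ys f) (S-× xs ys f))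

S-∈ : ∀ {A : Set} {xs : List A} {x} f → x ∈ₗ xs → f x ≤ S xs f
S-∈ f (here refl) = m≤m+n _ _
S-∈ f (there x∈)  = ≤-trans (S-∈ f x∈) (m≤n+m _ _)

S-filter : ∀ {A : Set} {P : A → Set} (P? : ∀ x → Dec (P x)) xs f → S (filter P? xs) f ≤ S xs f
S-filter P? []       f = z≤n
S-filter P? (x ∷ xs) f with P? x
... | yes _ = +-monoʳ-≤ (f x) (S-filter P? xs f)
... | no  _ = ≤-trans (S-filter P? xs f) (m≤n+m _ _)

ind : ∀ {P : Set} → Dec P → ℕ
ind (yes _) = 1
ind (no _)  = 0

length-filter-S : ∀ {A : Set} {P : A → Set} (P? : ∀ x → Dec (P x)) xs →
                  length (filter P? xs) ≡ S xs (ind ∘ P?)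
length-filter-S P? []       = refl
length-filter-S P? (x ∷ xs) with P? x
... | yes _ = cong suc (length-filter-S P? xs)
... | no  _ = length-filter-S P? xs

S-tabulate : ∀ {A : Set} {n} (h : Fin n → A) f → S (tabulate h) f ≡ ∑ (f ∘ h)
S-tabulate {n = zero}  h f = refl
S-tabulate {n = suc n} h f = cong (f (h zero) +_) (S-tabulate (h ∘ suc) f)

∑≡S : ∀ {n} (f : Fin n → ℕ) → ∑ f ≡ S (allFin n) f
∑≡S f = sym (S-tabulate (λ x → x) f)

∑-lookup : ∀ {A : Set} (xs : List A) f → ∑ (λ k → f (lookup xs k)) ≡ S xs f
∑-lookup []       f = refl
∑-lookup (x ∷ xs) f = cong (f x +_) (∑-lookup xs f)

∑-cong : ∀ {n} {f g : Fin n → ℕ} → (∀ x → f x ≡ g x) → ∑ f ≡ ∑ g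
∑-cong {n} {f} {g} h = trans (∑≡S f) (trans (S-cong (allFin n) h) (sym (∑≡S g)))

∑-≤ : ∀ {n} (f : Fin n → ℕ) x → f x ≤ ∑ f
∑-≤ f x = subst (f x ≤_) (sym (∑≡S f)) (S-∈ f (∈-allFin x))

∑≡0 : ∀ {n} (f : Fin n → ℕ) → (∀ x → f x ≡ 0) → ∑ f ≡ 0
∑≡0 {zero}  f h = refl
∑≡0 {suc n} f h = cong₂ _+_ (h zero) (∑≡0 (f ∘ suc) (h ∘ suc))

-- All comparisons of counts, loads and weights between tapes and routings are instances: entries
-- with nonzero f are matched injectively with entries of at least the same g. The partner of the
-- head is cut out of ys, and injectivity keeps the partners of the tail away from it.
S-inject : ∀ {A B : Set} (R : A → B → Set) {xs : List A} (ys : List B) {f g} → Unique xs →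
  (∀ {x} → x ∈ₗ xs → f x ≢ 0 → ∃[ y ] y ∈ₗ ys × R x y × f x ≤ g y) →
  (∀ {x x′ y} → R x y → R x′ y → x ≡ x′) →
  S xs f ≤ S ys g
S-inject R {[]}     ys         _           H inj = z≤n
S-inject R {x ∷ xs} ys {f} {g} (x∉ ∷ uniq) H inj with f x ≟ 0
... | yes fx≡0 = subst (λ v → v + S xs f ≤ S ys g) (sym fx≡0)
                   (S-inject R ys uniq (λ x∈ → H (there x∈)) inj)
... | no fx≢0 with H (here refl) fx≢0
... | y , y∈ys , Rxy , fx≤gy with ∈-∃++ y∈ys
... | ys₁ , ys₂ , refl = begin
  f x + S xs f                ≤⟨ +-mono-≤ fx≤gy (S-inject R (ys₁ ++ ys₂) uniq H′ inj) ⟩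
  g y + S (ys₁ ++ ys₂) g      ≡⟨ cong (g y +_) (S-++ ys₁ ys₂ g) ⟩
  g y + (S ys₁ g + S ys₂ g)   ≡⟨ sym (+-assoc (g y) _ _) ⟩
  g y + S ys₁ g + S ys₂ g     ≡⟨ cong (_+ S ys₂ g) (+-comm (g y) _) ⟩
  S ys₁ g + g y + S ys₂ g     ≡⟨ +-assoc (S ys₁ g) _ _ ⟩
  S ys₁ g + S (y ∷ ys₂) g     ≡⟨ sym (S-++ ys₁ (y ∷ ys₂) g) ⟩
  S (ys₁ ++ y ∷ ys₂) g        ∎
  where
  open ≤-Reasoning
  H′ : ∀ {x′} → x′ ∈ₗ xs → f x′ ≢ 0 → ∃[ y′ ] y′ ∈ₗ ys₁ ++ ys₂ × R x′ y′ × f x′ ≤ g y′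
  H′ x′∈ fx′≢0 with H (there x′∈) fx′≢0
  ... | y′ , y′∈ , Rx′y′ , le with ∈-++⁻ ys₁ y′∈
  ...   | inj₁ in₁          = y′ , ∈-++⁺ˡ in₁ , Rx′y′ , le
  ...   | inj₂ (here refl)  = contradiction (inj Rxy Rx′y′) (All.lookup x∉ x′∈)
  ...   | inj₂ (there in₂)  = y′ , ∈-++⁺ʳ ys₁ in₂ , Rx′y′ , le

cond-true : ∀ {A : Set} {c} {x y : A} → c ≢ 0 → cond c x y ≡ x
cond-true {c = zero}  h = contradiction refl h
cond-true {c = suc _} h = refl

-- The equality test in the shape to which the term `eqT` evaluates, so that the two agree by
-- computation.
δ : ℕ → ℕ → ℕ
δ a b = cond (a ∸ b) 0 (cond (b ∸ a) 0 1)

δ-≢0 : ∀ a b → δ a b ≢ 0 → a ≡ b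
δ-≢0 a b h with a ∸ b in p | b ∸ a in q
... | zero  | zero  = ≤-antisym (m∸n≡0⇒m≤n p) (m∸n≡0⇒m≤n q)
... | zero  | suc _ = contradiction refl h
... | suc _ | _     = contradiction refl h

δ-refl : ∀ a → δ a a ≡ 1
δ-refl a rewrite n∸n≡0 a = refl

δ≤1 : ∀ a b → δ a b ≤ 1
δ≤1 a b with a ∸ b | b ∸ a
... | zero  | zero  = ≤-refl
... | zero  | suc _ = z≤n
... | suc _ | _     = z≤n

orZero-yes : ∀ {P : Set} (d : Dec P) (f : .P → ℕ) (p : P) → orZero d f ≡ f p
orZero-yes (yes _) f p = refl
orZero-yes (no ¬p) f p = contradiction p ¬p

orZero-≢0 : ∀ {P : Set} (d : Dec P) (f : .P → ℕ) → orZero d f ≢ 0 → P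
orZero-≢0 (yes p) f h = p
orZero-≢0 (no _)  f h = contradiction refl h

bit-yes : ∀ {P : Set} (d : Dec P) → P → bit ⌊ d ⌋ ≡ 1
bit-yes (yes _) p = refl
bit-yes (no ¬p) p = contradiction p ¬p

bit-no : ∀ {P : Set} (d : Dec P) → ¬ P → bit ⌊ d ⌋ ≡ 0
bit-no (yes p) ¬p = contradiction p ¬p
bit-no (no _)  ¬p = refl

cond-≢0 : ∀ c {x} → cond c x 0 ≢ 0 → c ≢ 0
cond-≢0 zero    h = h
cond-≢0 (suc _) h = λ ()

pairs : ∀ r → List (Fin r × Fin r)
pairs r = cartesianProduct (allFin r) (allFin r)

pairs-unique : ∀ r → Unique (pairs r)
pairs-unique r = Unique.cartesianProduct⁺ (Unique.allFin⁺ r) (Unique.allFin⁺ r)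

S-pairs : ∀ r (f : Fin r → Fin r → ℕ) → S (pairs r) (λ { (i , t) → f i t }) ≡ ∑ (λ i → ∑ (f i))
S-pairs r f = trans (S-× (allFin r) (allFin r) _)
  (trans (S-cong (allFin r) (λ i → sym (∑≡S (f i)))) (sym (∑≡S (λ i → ∑ (f i)))))

S-⊎ : ∀ {A B : Set} (xs : List A) (ys : List B) f →
      S (map inj₁ xs ++ map inj₂ ys) f ≡ S xs (f ∘ inj₁) + S ys (f ∘ inj₂)
S-⊎ xs ys f = trans (S-++ (map inj₁ xs) _ f) (cong₂ _+_ (S-map inj₁ xs f) (S-map inj₂ ys f))

⊎-unique : ∀ {A B : Set} {xs : List A} {ys : List B} → Unique xs → Unique ys →
           Unique (map inj₁ xs ++ map inj₂ ys)
⊎-unique {A} {B} {xs} {ys} u v = Unique.++⁺ (Unique.map⁺ inj₁-injective u) (Unique.map⁺ inj₂-injective v) disjoint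
  where
  disjoint : ∀ {x : A ⊎ B} → ¬ (x ∈ₗ map inj₁ xs × x ∈ₗ map inj₂ ys)
  disjoint (p , q) with ∈-map⁻ inj₁ p | ∈-map⁻ inj₂ q
  ... | _ , _ , refl | _ , _ , ()

-- Vehicles and tapes

module Spec {n} (I : LoadGasCVRP n) (r : ℕ) where
  open LoadGasCVRP I

  dem cli dep nondepotClient depotClient : Fin n → ℕ
  dem v = orZero (v ∈? clients) (demand v)
  cli v = bit ⌊ v ∈? clients ⌋
  dep v = bit ⌊ v ∈? depots ⌋
  nondepotClient v = cond (cli v) (cond (dep v) 0 1) 0
  depotClient v = cond (cli v) (dep v) 0

  -- Weight 0 means staying where one is.
  Step : ℕ → Fin n → Fin n → Set
  Step w u v = (w ≡ 0 × u ≡ v) ⊎ (w ≢ 0 × Σ (Adj u v) λ e → weight u v e ≡ w)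

  Serve : (col : Fin n → ℕ) (ty c : ℕ) → Fin n → Set
  Serve col ty c v = ty ≢ 0 → cli v ≢ 0 × col v ≡ c × ty ≡ suc (dep v)

  -- Services happen after a step only. Nothing is lost at time 0, because a closed walk comes back
  -- to its start. Short walks are padded to r steps by steps of weight 0.
  record Route (w ty c : Fin r → ℕ) (col : Fin n → ℕ) : Set where
    field
      at      : ℕ → Fin n
      start   : at 0 ∈ depots
      closed  : at r ≡ at 0
      steps   : ∀ t → Step (w t) (at (toℕ t)) (at (suc (toℕ t)))
      serves  : ∀ t → Serve col (ty t) (c t) (at (suc (toℕ t)))
      load≤   : ∑ (λ t → cond (ty t) (dem (at (suc (toℕ t)))) 0) ≤ loadCapacity

  -- Vehicle i makes r steps, the t-th of weight w i t. If ty i t is not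
  -- 0, it then serves a client of colour c i t, which is a depot exactly
  -- when ty i t is 2. The depots that are not served in this way are left
  -- to stationary vehicles.
  record Good (w ty c : Fin r → Fin r → ℕ) (col : Fin n → ℕ) : Set where
    field
      weight≤   : ∑ (λ i → ∑ (w i)) ≤ r
      gas≤      : ∀ i → ∑ (w i) ≤ gasCapacity
      distinct  : ∀ i t j s → ty i t ≢ 0 → ty j s ≢ 0 → c i t ≡ c j s → i ≡ j × t ≡ s
      route     : ∀ i → Route (w i) (ty i) (c i) col
      nondepots : ∑ nondepotClient ≤ ∑ (λ i → ∑ (λ t → δ (ty i t) 1))
      fleet≤    : ∑ (λ i → cond (∑ (ty i)) 1 0) + ∑ depotClient ≤ fleet + ∑ (λ i → ∑ (λ t → δ (ty i t) 2))
      demands   : ∀ v → dem v ≤ loadCapacity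

  cli-yes : ∀ {v} → v ∈ clients → cli v ≡ 1
  cli-yes {v} = bit-yes (v ∈? clients)

  consStep : ∀ {w u v z} → Step w u v → Walk v z → Walk u z
  consStep (inj₁ (_ , refl))  p = p
  consStep (inj₂ (_ , e , _)) p = e ◅ p

  walkWeight-consStep : ∀ {w u v z} (s : Step w u v) (p : Walk v z) →
                        walkWeight (consStep s p) ≡ w + walkWeight p
  walkWeight-consStep (inj₁ (refl , refl))   p = refl
  walkWeight-consStep (inj₂ (_ , e , refl))  p = refl

  vertices-consStep : ∀ {w u v z x} (s : Step w u v) (p : Walk v z) →
                      x ∈ₗ vertices p → x ∈ₗ vertices (consStep s p)
  vertices-consStep (inj₁ (_ , refl))  p x∈ = x∈
  vertices-consStep (inj₂ (_ , e , _)) p x∈ = there x∈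

  start∈vertices : ∀ {u v} (p : Walk u v) → u ∈ₗ vertices p
  start∈vertices ε       = here refl
  start∈vertices (_ ◅ _) = here refl

  stepsWalk : ∀ N (w : Fin N → ℕ) (p : ℕ → Fin n) →
    (∀ t → Step (w t) (p (toℕ t)) (p (suc (toℕ t)))) →
    Σ (Walk (p 0) (p N)) λ q → walkWeight q ≡ ∑ w ×
      (∀ t → p (suc (toℕ {N} t)) ∈ₗ vertices q)
  stepsWalk zero    w p h = ε , refl , λ ()
  stepsWalk (suc N) w p h with stepsWalk N (w ∘ suc) (p ∘ suc) (h ∘ suc)
  ... | q , weight≡ , vs = consStep (h zero) q ,
    trans (walkWeight-consStep (h zero) q) (cong (w zero +_) weight≡) ,
    λ { zero    → vertices-consStep (h zero) q (start∈vertices q)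
      ; (suc t) → vertices-consStep (h zero) q (vs t) }

  closeWalk : ∀ {u v} {Q : Fin n → Set} {m : ℕ} → v ≡ u →
    (Σ (Walk u v) λ q → walkWeight q ≡ m × (∀ {x} → Q x → x ∈ₗ vertices q)) →
    Σ (Walk u u) λ q → walkWeight q ≡ m × (∀ {x} → Q x → x ∈ₗ vertices q)
  closeWalk refl q = q

-- From tapes to routings

module Soundness {n} (I : LoadGasCVRP n) (r : ℕ) {w ty c : Fin r → Fin r → ℕ} {col : Fin n → ℕ}
  (good : Spec.Good I r w ty c col) where
  open LoadGasCVRP I
  open Spec I r
  open Good good
  module R (i : Fin r) = Route {w i} {ty i} {c i} {col} (route i)

  target : Fin r → Fin r → Fin n
  target i t = R.at i (suc (toℕ t))

  Served : Fin n → Fin r × Fin r → Set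
  Served v (i , t) = ty i t ≢ 0 × target i t ≡ v

  served? : ∀ v → Dec (∃[ i ] ∃[ t ] Served v (i , t))
  served? v = Fin.any? λ i → Fin.any? λ t → ¬? (ty i t ≟ 0) ×-dec (target i t Fin.≟ v)

  colour : ∀ {v i t} → Served v (i , t) → c i t ≡ col v
  colour {i = i} {t} (ty≢0 , refl) = sym (proj₁ (proj₂ (R.serves i t ty≢0)))

  served-unique : ∀ {v x y} → Served v x → Served v y → x ≡ y
  served-unique p@(ty≢0 , _) q@(ty′≢0 , _)
    with distinct _ _ _ _ ty≢0 ty′≢0 (trans (colour p) (sym (colour q)))
  ... | refl , refl = refl

  served-functional : ∀ {v v′ x} → Served v x → Served v′ x → v ≡ v′
  served-functional (_ , refl) (_ , refl) = refl

  -- Pigeonhole: the services of type 1 go to distinct clients outside the depots. An unserved one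
  -- would be a further such client, so there would be more of them than the field `nondepots`
  -- admits.
  nondepot-served : ∀ {v} → v ∈ clients → ¬ (∃[ i ] ∃[ t ] Served v (i , t)) → v ∈ depots
  nondepot-served {v} v∈C unserved with v ∈? depots
  ... | yes v∈D = v∈D
  ... | no  v∉D = contradiction contra (<⇒≱ ≤-refl)
    where
    xs : List ((Fin r × Fin r) ⊎ ⊤)
    xs = map inj₁ (pairs r) ++ map inj₂ [ tt ]
    f : (Fin r × Fin r) ⊎ ⊤ → ℕ
    f (inj₁ (i , t)) = δ (ty i t) 1
    f (inj₂ tt)      = 1
    M : (Fin r × Fin r) ⊎ ⊤ → Fin n → Set
    M (inj₁ x)  u = Served u x
    M (inj₂ tt) u = u ≡ v
    match : ∀ {x} → x ∈ₗ xs → f x ≢ 0 → ∃[ u ] u ∈ₗ allFin n × M x u × f x ≤ nondepotClient u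
    match {inj₁ (i , t)} _ h = target i t , ∈-allFin _ , (ty≢0 , refl) , le
      where
      ty≡1 = δ-≢0 (ty i t) 1 h
      ty≢0 : ty i t ≢ 0
      ty≢0 e = contradiction (trans (sym e) ty≡1) λ ()
      sv = R.serves i t ty≢0
      le : δ (ty i t) 1 ≤ nondepotClient (target i t)
      le rewrite suc-injective (trans (sym (proj₂ (proj₂ sv))) ty≡1) | cond-true {x = 1} {0} (proj₁ sv) = δ≤1 (ty i t) 1
    match {inj₂ tt} _ _ = v , ∈-allFin _ , refl ,
      ≤-reflexive (sym (trans (cond-true (λ e → contradiction (trans (sym (cli-yes v∈C)) e) λ ()))
                              (cong (λ d → cond d 0 1) (bit-no (v ∈? depots) v∉D))))
    inj : ∀ {x x′ u} → M x u → M x′ u → x ≡ x′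
    inj {inj₁ _} {inj₁ _} p q = cong inj₁ (served-unique p q)
    inj {inj₁ _} {inj₂ _} p refl = contradiction (_ , _ , p) unserved
    inj {inj₂ _} {inj₁ _} refl p = contradiction (_ , _ , p) unserved
    inj {inj₂ _} {inj₂ _} _ _ = refl
    N = ∑ (λ i → ∑ (λ t → δ (ty i t) 1))
    contra : suc N ≤ N
    contra = begin
      suc N                             ≡⟨ +-comm 1 N ⟩
      N + 1                             ≡⟨ cong (_+ 1) (sym (S-pairs r (λ i t → δ (ty i t) 1))) ⟩
      S (pairs r) (λ { (i , t) → δ (ty i t) 1 }) + 1 ≡⟨ sym (S-⊎ (pairs r) [ tt ] f) ⟩
      S xs f                            ≤⟨ S-inject M (allFin n) (⊎-unique (pairs-unique r) ([] ∷ [])) match inj ⟩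
      S (allFin n) nondepotClient       ≡⟨ sym (∑≡S nondepotClient) ⟩
      ∑ nondepotClient                  ≤⟨ nondepots ⟩
      N                                 ∎
      where open ≤-Reasoning

  -- Vehicle i of the tape, or a stationary vehicle at v.
  Vehicle : Set
  Vehicle = Fin r ⊎ Fin n

  -- Tape vehicles that serve nobody are dropped: `fleet≤` does not count them, and dropping a tour
  -- cannot increase the total weight.
  Used : Vehicle → Set
  Used (inj₁ i) = ∑ (ty i) ≢ 0
  Used (inj₂ v) = v ∈ clients × v ∈ depots × ¬ (∃[ i ] ∃[ t ] Served v (i , t))

  used? : ∀ x → Dec (Used x)
  used? (inj₁ i) = ¬? (∑ (ty i) ≟ 0)
  used? (inj₂ v) = (v ∈? clients) ×-dec (v ∈? depots) ×-dec ¬? (served? v)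

  candidates used : List Vehicle
  candidates = map inj₁ (allFin r) ++ map inj₂ (allFin n)
  used = filter used? candidates

  stop : Vehicle → Fin n
  stop (inj₁ i) = R.at i 0
  stop (inj₂ v) = v

  Visited : Vehicle → Fin n → Set
  Visited (inj₁ i) v = ∃[ t ] target i t ≡ v
  Visited (inj₂ u) v = u ≡ v

  tourWeight : Vehicle → ℕ
  tourWeight (inj₁ i) = ∑ (w i)
  tourWeight (inj₂ v) = 0

  tour : ∀ x → Σ (Walk (stop x) (stop x)) λ q → walkWeight q ≡ tourWeight x ×
         (∀ {v} → Visited x v → v ∈ₗ vertices q)
  tour (inj₁ i) with stepsWalk r (w i) (R.at i) (R.steps i)
  ... | q , weight≡ , vs = closeWalk (R.closed i) (q , weight≡ , λ { (t , refl) → vs t })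
  tour (inj₂ v) = ε , refl , λ { refl → here refl }

  used-stop : ∀ x → Used x → stop x ∈ depots
  used-stop (inj₁ i) _             = R.start i
  used-stop (inj₂ v) (_ , v∈D , _) = v∈D

  owner : Fin n → Vehicle
  owner v with served? v
  ... | yes (i , _) = inj₁ i
  ... | no  _       = inj₂ v

  owner-used : ∀ {v} → v ∈ clients → Used (owner v)
  owner-used {v} v∈C with served? v
  ... | yes (i , t , ty≢0 , _) = λ e → ty≢0 (n≤0⇒n≡0 (subst (ty i t ≤_) e (∑-≤ (ty i) t)))
  ... | no unserved = v∈C , nondepot-served v∈C unserved , unserved

  owner-visits : ∀ v → Visited (owner v) v
  owner-visits v with served? v
  ... | yes (i , t , _ , eq) = t , eq
  ... | no _ = refl

  owner-tape : ∀ {v i} → owner v ≡ inj₁ i → ∃[ t ] Served v (i , t)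
  owner-tape {v} eq with served? v
  owner-tape refl | yes (i , t , s) = t , s

  owner-stationary : ∀ {v u} → owner v ≡ inj₂ u → v ≡ u
  owner-stationary {v} eq with served? v
  owner-stationary refl | no _ = refl

  owner∈used : ∀ {v} → v ∈ clients → owner v ∈ₗ used
  owner∈used {v} v∈C = ∈-filter⁺ used? (∈-candidates (owner v)) (owner-used v∈C)
    where
    ∈-candidates : ∀ x → x ∈ₗ candidates
    ∈-candidates (inj₁ i) = ∈-++⁺ˡ (∈-map⁺ inj₁ (∈-allFin i))
    ∈-candidates (inj₂ v) = ∈-++⁺ʳ (map inj₁ (allFin r)) (∈-map⁺ inj₂ (∈-allFin v))

  assignment : ∀ v → .(v ∈ clients) → Fin (length used)
  assignment v v∈C = index (owner∈used (recompute (v ∈? clients) v∈C))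

  assignment-owner : ∀ v .(v∈C : v ∈ clients) → owner v ≡ lookup used (assignment v v∈C)
  assignment-owner v v∈C = lookup-index (owner∈used (recompute (v ∈? clients) v∈C))

  -- The depot clients left to stationary vehicles and the targets of the N services of type 2 are
  -- distinct depot clients. Adding N to both sides therefore turns the former into at most
  -- `∑ depotClient`, and `fleet≤` can be stated without a truncated difference.
  used≤fleet : length used ≤ fleet
  used≤fleet = +-cancelʳ-≤ N (length used) fleet (begin
    length used + N       ≡⟨ cong (_+ N) (length-filter-S used? candidates) ⟩
    S candidates U + N    ≡⟨ cong (_+ N) (S-⊎ (allFin r) (allFin n) U) ⟩
    S (allFin r) (U ∘ inj₁) + W + N
                          ≡⟨ +-assoc _ W N ⟩
    S (allFin r) (U ∘ inj₁) + (W + N)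
                          ≤⟨ +-mono-≤ (S-mono (allFin r) moving) stationary ⟩
    S (allFin r) (λ i → cond (∑ (ty i)) 1 0) + ∑ depotClient
                          ≡⟨ cong (_+ ∑ depotClient) (sym (∑≡S (λ i → cond (∑ (ty i)) 1 0))) ⟩
    ∑ (λ i → cond (∑ (ty i)) 1 0) + ∑ depotClient
                          ≤⟨ fleet≤ ⟩
    fleet + N             ∎)
    where
    open ≤-Reasoning
    N = ∑ (λ i → ∑ (λ t → δ (ty i t) 2))
    U : Vehicle → ℕ
    U x = ind (used? x)
    W = S (allFin n) (U ∘ inj₂)
    moving : ∀ i → U (inj₁ i) ≤ cond (∑ (ty i)) 1 0
    moving i with ∑ (ty i)
    ... | zero  = z≤n
    ... | suc _ = ≤-refl
    f : Fin n ⊎ (Fin r × Fin r) → ℕ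
    f (inj₁ v)       = U (inj₂ v)
    f (inj₂ (i , t)) = δ (ty i t) 2
    M : Fin n ⊎ (Fin r × Fin r) → Fin n → Set
    M (inj₁ v) u = v ≡ u × ¬ (∃[ i ] ∃[ t ] Served u (i , t))
    M (inj₂ x) u = Served u x
    xs = map inj₁ (allFin n) ++ map inj₂ (pairs r)
    match : ∀ {x} → x ∈ₗ xs → f x ≢ 0 → ∃[ u ] u ∈ₗ allFin n × M x u × f x ≤ depotClient u
    match {inj₁ v} _ h with used? (inj₂ v)
    ... | no _ = contradiction refl h
    ... | yes (v∈C , v∈D , unserved) = v , ∈-allFin v , (refl , unserved) , ≤-reflexive (sym
      (trans (cong (λ x → cond x (dep v) 0) (cli-yes v∈C)) (bit-yes (v ∈? depots) v∈D)))
    match {inj₂ (i , t)} _ h = target i t , ∈-allFin _ , (ty≢0 , refl) , le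
      where
      ty≡2 = δ-≢0 (ty i t) 2 h
      ty≢0 : ty i t ≢ 0
      ty≢0 e = contradiction (trans (sym e) ty≡2) λ ()
      sv = R.serves i t ty≢0
      le : δ (ty i t) 2 ≤ depotClient (target i t)
      le rewrite suc-injective (trans (sym (proj₂ (proj₂ sv))) ty≡2) | cond-true {x = 1} {0} (proj₁ sv) = δ≤1 (ty i t) 2
    inj : ∀ {x x′ u} → M x u → M x′ u → x ≡ x′
    inj {inj₁ _} {inj₁ _} (refl , _) (refl , _) = refl
    inj {inj₁ _} {inj₂ _} (_ , unserved) p = contradiction (_ , _ , p) unserved
    inj {inj₂ _} {inj₁ _} p (_ , unserved) = contradiction (_ , _ , p) unserved
    inj {inj₂ _} {inj₂ _} p q = cong inj₂ (served-unique p q)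
    stationary : W + N ≤ ∑ depotClient
    stationary = begin
      W + N                   ≡⟨ cong (W +_) (sym (S-pairs r (λ i t → δ (ty i t) 2))) ⟩
      W + S (pairs r) (λ { (i , t) → δ (ty i t) 2 }) ≡⟨ sym (S-⊎ (allFin n) (pairs r) f) ⟩
      S xs f                  ≤⟨ S-inject M (allFin n) (⊎-unique (Unique.allFin⁺ n) (pairs-unique r)) match inj ⟩
      S (allFin n) depotClient ≡⟨ sym (∑≡S depotClient) ⟩
      ∑ depotClient           ∎

  module _ (k : Fin (length used)) where

    carried : Fin n → ℕ
    carried v = orZero (v ∈? clients) λ v∈C → orZero (assignment v v∈C Fin.≟ k) λ _ → demand v v∈C

    carried-owner : ∀ v → carried v ≢ 0 → owner v ≡ lookup used k
    carried-owner v h with orZero-≢0 (v ∈? clients) _ h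
    ... | v∈C with orZero-≢0 (assignment v v∈C Fin.≟ k) _ (λ e → h (trans (orZero-yes (v ∈? clients) _ v∈C) e))
    ... | refl = assignment-owner v v∈C

    carried≤dem : ∀ v → carried v ≤ dem v
    carried≤dem v with v ∈? clients
    ... | no _ = z≤n
    ... | yes v∈C with index (owner∈used v∈C) Fin.≟ k
    ...   | yes _ = ≤-refl
    ...   | no _  = z≤n

    -- Each client of a tape vehicle occupies a step of its own, so its demand is counted in
    -- `load≤`. A stationary vehicle carries at most the client it stands on, which is what the
    -- field `demands` is for.
    carried≤capacity : ∀ x → lookup used k ≡ x → ∑ carried ≤ loadCapacity
    carried≤capacity (inj₁ i) eq = begin
      ∑ carried              ≡⟨ ∑≡S carried ⟩
      S (allFin n) carried   ≤⟨ S-inject (λ v t → Served v (i , t)) (allFin r) (Unique.allFin⁺ n) match served-functional ⟩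
      S (allFin r) g         ≡⟨ sym (∑≡S g) ⟩
      ∑ g                    ≤⟨ R.load≤ i ⟩
      loadCapacity           ∎
      where
      open ≤-Reasoning
      g : Fin r → ℕ
      g t = cond (ty i t) (dem (target i t)) 0
      match : ∀ {v} → v ∈ₗ allFin n → carried v ≢ 0 → ∃[ t ] t ∈ₗ allFin r × Served v (i , t) × carried v ≤ g t
      match {v} _ h with owner-tape (trans (carried-owner v h) eq)
      ... | t , s@(ty≢0 , refl) = t , ∈-allFin t , s , ≤-trans (carried≤dem v) (≤-reflexive (sym (cond-true ty≢0)))
    carried≤capacity (inj₂ u) eq = begin
      ∑ carried              ≡⟨ ∑≡S carried ⟩
      S (allFin n) carried   ≤⟨ S-inject _≡_ [ u ] (Unique.allFin⁺ n) match (λ { refl refl → refl }) ⟩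
      dem u + 0              ≡⟨ +-identityʳ (dem u) ⟩
      dem u                  ≤⟨ demands u ⟩
      loadCapacity           ∎
      where
      open ≤-Reasoning
      match : ∀ {v} → v ∈ₗ allFin n → carried v ≢ 0 → ∃[ y ] y ∈ₗ [ u ] × v ≡ y × carried v ≤ dem y
      match {v} _ h with owner-stationary (trans (carried-owner v h) eq)
      ... | refl = v , here refl , refl , carried≤dem v

  routing : Routing loadCVRP
  routing = record
    { vehicles       = length used
    ; vehicles≤fleet = used≤fleet
    ; start          = λ k → stop (lookup used k)
    ; start∈depots   = λ k → used-stop (lookup used k) (All.lookup (all-filter used? candidates) (∈-lookup k))
    ; walk           = λ k → proj₁ (tour (lookup used k))
    ; assign         = assignment
    ; visits         = λ v v∈C → subst (λ x → v ∈ₗ vertices (proj₁ (tour x))) (assignment-owner v v∈C)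
                                   (proj₂ (proj₂ (tour (owner v))) (owner-visits v))
    ; load≤capacity  = λ k → carried≤capacity k (lookup used k) refl }

  gasRouting : GasRouting I
  gasRouting = record
    { routing = routing
    ; gas≤capacity = λ k → ≤-trans (≤-reflexive (proj₁ (proj₂ (tour (lookup used k))))) (cheap (lookup used k)) }
    where
    cheap : ∀ x → tourWeight x ≤ gasCapacity
    cheap (inj₁ i) = gas≤ i
    cheap (inj₂ v) = z≤n

  sound : LoadGasCVRP-Yes I r
  sound = gasRouting , (begin
    ∑ (λ k → walkWeight (proj₁ (tour (lookup used k)))) ≡⟨ ∑-cong (λ k → proj₁ (proj₂ (tour (lookup used k)))) ⟩
    ∑ (λ k → tourWeight (lookup used k))                ≡⟨ ∑-lookup used tourWeight ⟩
    S used tourWeight                                   ≤⟨ S-filter used? candidates tourWeight ⟩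
    S candidates tourWeight                             ≡⟨ S-⊎ (allFin r) (allFin n) tourWeight ⟩
    S (allFin r) (λ i → ∑ (w i)) + S (allFin n) (λ _ → 0)
                                                        ≡⟨ cong₂ _+_ (sym (∑≡S (λ i → ∑ (w i))))
                                                             (trans (sym (∑≡S {n} _)) (∑≡0 {n} _ (λ _ → refl))) ⟩
    ∑ (λ i → ∑ (w i)) + 0                               ≡⟨ +-identityʳ _ ⟩
    ∑ (λ i → ∑ (w i))                                   ≤⟨ weight≤ ⟩
    r                                                   ∎)
    where open ≤-Reasoning

-- From routings to tapes

nth : ∀ {A : Set} → List A → ℕ → Maybe A
nth []       _       = nothing
nth (x ∷ xs) zero    = just x
nth (x ∷ xs) (suc k) = nth xs k

nth-∈ : ∀ {A : Set} (xs : List A) k {x} → nth xs k ≡ just x → x ∈ₗ xs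
nth-∈ (x ∷ xs) zero    refl = here refl
nth-∈ (x ∷ xs) (suc k) eq   = there (nth-∈ xs k eq)

nth-injective : ∀ {A : Set} {xs : List A} → Unique xs → ∀ j k {x} →
                nth xs j ≡ just x → nth xs k ≡ just x → j ≡ k
nth-injective (_ ∷ u) zero    zero    p    q    = refl
nth-injective (x∉ ∷ u) zero   (suc k) refl q    = contradiction refl (All.lookup x∉ (nth-∈ _ k q))
nth-injective (x∉ ∷ u) (suc j) zero   p    refl = contradiction refl (All.lookup x∉ (nth-∈ _ j p))
nth-injective (_ ∷ u) (suc j) (suc k) p    q    = cong suc (nth-injective u j k p q)

∈-nth : ∀ {A : Set} {xs : List A} {x} → x ∈ₗ xs → ∃[ k ] k < length xs × nth xs k ≡ just x
∈-nth (here refl) = 0 , z<s , refl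
∈-nth (there x∈) with ∈-nth x∈
... | k , k< , eq = suc k , s<s k< , eq

module Walks {n} (I : LoadGasCVRP n) (r : ℕ) (nonzero : LoadGasCVRP.NoZeroWeightEdges I) where
  open LoadGasCVRP I
  open Spec I r

  hops : ∀ {u v} → Walk u v → ℕ
  hops ε       = 0
  hops (_ ◅ p) = suc (hops p)

  -- A finished walk stays at its end.
  position : ∀ {u v} → Walk u v → ℕ → Fin n
  position {u} ε       _       = u
  position {u} (_ ◅ p) zero    = u
  position     (_ ◅ p) (suc t) = position p t

  hopWeight : ∀ {u v} → Walk u v → ℕ → ℕ
  hopWeight ε       _       = 0
  hopWeight (_◅_ {i = u} {j = v} e p) zero = weight u v e
  hopWeight (_ ◅ p) (suc t) = hopWeight p t

  position-0 : ∀ {u v} (p : Walk u v) → position p 0 ≡ u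
  position-0 ε       = refl
  position-0 (_ ◅ _) = refl

  position-end : ∀ {u v} (p : Walk u v) {N} → hops p ≤ N → position p N ≡ v
  position-end ε       _        = refl
  position-end (_ ◅ p) (s≤s le) = position-end p le

  position-step : ∀ {u v} (p : Walk u v) t → Step (hopWeight p t) (position p t) (position p (suc t))
  position-step ε       t       = inj₁ (refl , refl)
  position-step (e ◅ p) zero    = inj₂ (nonzero _ _ e , subst (λ x → Step′ x) (sym (position-0 p)) (e , refl))
    where
    Step′ : Fin n → Set
    Step′ x = Σ (Adj _ x) λ e′ → weight _ x e′ ≡ weight _ _ e
  position-step (_ ◅ p) (suc t) = position-step p t

  ∑-hopWeight : ∀ N {u v} (p : Walk u v) → ∑ {N} (λ t → hopWeight p (toℕ t)) ≤ walkWeight p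
  ∑-hopWeight N       ε       = ≤-reflexive (∑≡0 {N} (λ _ → 0) (λ _ → refl))
  ∑-hopWeight zero    (_ ◅ p) = z≤n
  ∑-hopWeight (suc N) (_◅_ {i = u} {j = v} e p) = +-monoʳ-≤ (weight u v e) (∑-hopWeight N p)

  hops≤weight : ∀ {u v} (p : Walk u v) → hops p ≤ walkWeight p
  hops≤weight ε       = z≤n
  hops≤weight (_◅_ {i = u} {j = v} e p) = +-mono-≤ (n≢0⇒n>0 (nonzero u v e)) (hops≤weight p)

  vertices-position : ∀ {u v x} (p : Walk u v) → x ∈ₗ vertices p → ∃[ t ] t ≤ hops p × position p t ≡ x
  vertices-position ε       (here refl) = 0 , z≤n , refl
  vertices-position (_ ◅ p) (here refl) = 0 , z≤n , refl
  vertices-position (_ ◅ p) (there x∈) with vertices-position p x∈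
  ... | t , t≤ , eq = suc t , s≤s t≤ , eq

  weightless-vertex : ∀ {u v x} (p : Walk u v) → walkWeight p ≡ 0 → x ∈ₗ vertices p → x ≡ u
  weightless-vertex ε       _  (here refl) = refl
  weightless-vertex (_◅_ {i = u} {j = v} e p) eq _ = contradiction (m+n≡0⇒m≡0 (weight u v e) eq) (nonzero u v e)

  -- Every vertex of a closed moving walk is the end of some step: the start is reached again by the
  -- last hop, whose index is below r because each hop weighs at least 1.
  closed-position : ∀ {u x} (p : Walk u u) → walkWeight p ≢ 0 → walkWeight p ≤ r → x ∈ₗ vertices p →
                    Σ (Fin r) λ t → position p (suc (toℕ t)) ≡ x
  closed-position ε ≢0 _ _ = contradiction refl ≢0
  closed-position p@(_ ◅ q) ≢0 ≤r x∈ with vertices-position p x∈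
  ... | zero , _ , refl =
    fromℕ< (≤-trans (hops≤weight p) ≤r) ,
    trans (cong (λ s → position p (suc s)) (Fin.toℕ-fromℕ< (≤-trans (hops≤weight p) ≤r))) (position-end p ≤-refl)
  ... | suc t , t≤ , refl =
    fromℕ< t<r , cong (λ s → position p (suc s)) (Fin.toℕ-fromℕ< t<r)
    where
    t<r : t < r
    t<r = ≤-trans t≤ (≤-trans (hops≤weight p) ≤r)

module Completeness {n} (I : LoadGasCVRP n) (r : ℕ) (nonzero : LoadGasCVRP.NoZeroWeightEdges I)
  (R : GasRouting I) (cheap : GasRouting.routingWeight R ≤ r) where
  open LoadGasCVRP I
  open Spec I r
  open Walks I r nonzero
  open GasRouting R

  walkCost : Fin vehicles → ℕ
  walkCost j = walkWeight (walk j)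

  Moving : Fin vehicles → Set
  Moving j = walkCost j ≢ 0

  moving? : ∀ j → Dec (Moving j)
  moving? j = ¬? (walkCost j ≟ 0)

  moving : List (Fin vehicles)
  moving = filter moving? (allFin vehicles)

  moving-unique : Unique moving
  moving-unique = Unique.filter⁺ moving? (Unique.allFin⁺ vehicles)

  walkCost≤r : ∀ j → walkCost j ≤ r
  walkCost≤r j = ≤-trans (∑-≤ walkCost j) cheap

  length-moving≤r : length moving ≤ r
  length-moving≤r = begin
    length moving                          ≡⟨ length-filter-S moving? (allFin vehicles) ⟩
    S (allFin vehicles) (λ j → ind (moving? j)) ≤⟨ S-mono (allFin vehicles) le ⟩
    S (allFin vehicles) walkCost               ≡⟨ sym (∑≡S walkCost) ⟩
    ∑ walkCost                                 ≤⟨ cheap ⟩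
    r                                      ∎
    where
    open ≤-Reasoning hiding (start)
    le : ∀ j → ind (moving? j) ≤ walkCost j
    le j with walkCost j
    ... | zero  = z≤n
    ... | suc _ = s≤s z≤n

  vehicle : Fin r → Maybe (Fin vehicles)
  vehicle i = nth moving (toℕ i)

  vehicle-moving : ∀ {i j} → vehicle i ≡ just j → Moving j
  vehicle-moving {i} eq = proj₂ (∈-filter⁻ moving? {xs = allFin vehicles} (nth-∈ moving (toℕ i) eq))

  vehicle-injective : ∀ {i i′ j} → vehicle i ≡ just j → vehicle i′ ≡ just j → i ≡ i′
  vehicle-injective {i} {i′} p q = Fin.toℕ-injective (nth-injective moving-unique (toℕ i) (toℕ i′) p q)

  vehicle-of : ∀ j → Moving j → ∃[ i ] vehicle i ≡ just j
  vehicle-of j m with ∈-nth (∈-filter⁺ moving? (∈-allFin j) m)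
  ... | k , k< , eq = fromℕ< k<r , trans (cong (nth moving) (Fin.toℕ-fromℕ< k<r)) eq
    where
    k<r : k < r
    k<r = ≤-trans k< length-moving≤r

  at : Maybe (Fin vehicles) → ℕ → Fin n
  at (just j) t = position (walk j) t
  at nothing  t = proj₁ depots-nonempty

  stepWeight : Maybe (Fin vehicles) → ℕ → ℕ
  stepWeight (just j) t = hopWeight (walk j) t
  stepWeight nothing  t = 0

  w : Fin r → Fin r → ℕ
  w i t = stepWeight (vehicle i) (toℕ t)

  target : Fin r → Fin r → Fin n
  target i t = at (vehicle i) (suc (toℕ t))

  -- A walk may pass a client several times, and clients of other vehicles as well. One visit per
  -- client is singled out, on the walk of its own vehicle, and the tape serves the client there and
  -- nowhere else.
  locate : Fin n → Maybe (Fin r × Fin r)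
  locate v with v ∈? clients
  ... | no _ = nothing
  ... | yes v∈C with moving? (assign v v∈C)
  ...   | no _  = nothing
  ...   | yes m = just (proj₁ (vehicle-of _ m) ,
                        proj₁ (closed-position (walk (assign v v∈C)) m (walkCost≤r _) (visits v v∈C)))

  locate-just : ∀ v {i t} → locate v ≡ just (i , t) →
                Σ (v ∈ clients) λ v∈C → vehicle i ≡ just (assign v v∈C) × target i t ≡ v
  locate-just v eq with v ∈? clients
  locate-just v () | no _
  ... | yes v∈C with moving? (assign v v∈C)
  locate-just v () | yes _ | no _
  locate-just v refl | yes v∈C | yes m =
    v∈C , proj₂ (vehicle-of _ m) ,
    trans (cong (λ x → at x (suc (toℕ (proj₁ t)))) (proj₂ (vehicle-of _ m))) (proj₂ t)
    where t = closed-position (walk (assign v v∈C)) m (walkCost≤r (assign v v∈C)) (visits v v∈C)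

  locate-nothing : ∀ v → locate v ≡ nothing → ∀ (v∈C : v ∈ clients) → walkCost (assign v v∈C) ≡ 0
  locate-nothing v eq v∈C with v ∈? clients
  ... | no v∉C = contradiction v∈C v∉C
  ... | yes v∈C′ with walkCost (assign v v∈C′) ≟ 0
  ...   | yes c≡0 = c≡0
  locate-nothing v () v∈C | yes _ | no _

  serveType : ∀ {P : Set} → Dec P → Fin n → ℕ
  serveType (yes _) v = suc (dep v)
  serveType (no _)  v = 0

  located? : ∀ v x → Dec (locate v ≡ just x)
  located? v x = Maybe.≡-dec (Product.≡-dec Fin._≟_ Fin._≟_) (locate v) (just x)

  ty : Fin r → Fin r → ℕ
  ty i t = serveType (located? (target i t) (i , t)) (target i t)

  ty-≢0 : ∀ i t → ty i t ≢ 0 → locate (target i t) ≡ just (i , t)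
  ty-≢0 i t h with located? (target i t) (i , t)
  ... | yes eq = eq
  ... | no _   = contradiction refl h

  ty-located : ∀ {v i t} → locate v ≡ just (i , t) → ty i t ≡ suc (dep v)
  ty-located {v} {i} {t} eq with locate-just v eq
  ... | _ , _ , refl with located? (target i t) (i , t)
  ...   | yes _ = refl
  ...   | no ¬p = contradiction eq ¬p

  dep≤1 : ∀ v → dep v ≤ 1
  dep≤1 v with v ∈? depots
  ... | yes _ = ≤-refl
  ... | no _  = z≤n

  ty≤2 : ∀ i t → ty i t ≤ 2
  ty≤2 i t with located? (target i t) (i , t)
  ... | yes _ = s≤s (dep≤1 _)
  ... | no _  = z≤n

  nondepotClient-≢0 : ∀ v → nondepotClient v ≢ 0 → v ∈ clients × v ∉ depots × nondepotClient v ≤ 1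
  nondepotClient-≢0 v h with v ∈? clients | v ∈? depots
  ... | no _    | _       = contradiction refl h
  ... | yes _   | yes _   = contradiction refl h
  ... | yes v∈C | no  v∉D = v∈C , v∉D , ≤-refl

  depotClient-≢0 : ∀ v → depotClient v ≢ 0 → v ∈ clients × v ∈ depots × depotClient v ≤ 1
  depotClient-≢0 v h with v ∈? clients | v ∈? depots
  ... | no _    | _       = contradiction refl h
  ... | yes _   | no _    = contradiction refl h
  ... | yes v∈C | yes v∈D = v∈C , v∈D , ≤-refl

  ∑w≤walkCost : ∀ {i j} → vehicle i ≡ just j → ∑ (w i) ≤ walkCost j
  ∑w≤walkCost {i} {j} eq rewrite eq = ∑-hopWeight r (walk j)

  ∑w≡0 : ∀ {i} → vehicle i ≡ nothing → ∑ (w i) ≡ 0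
  ∑w≡0 {i} eq rewrite eq = ∑≡0 {r} (λ _ → 0) (λ _ → refl)

  w≤r : ∀ i t → w i t ≤ r
  w≤r i t with vehicle i in eq
  ... | nothing = z≤n
  ... | just j  = ≤-trans (∑-≤ {r} (λ s → hopWeight (walk j) (toℕ s)) t)
                    (≤-trans (∑-hopWeight r (walk j)) (walkCost≤r j))

  carried : Fin vehicles → Fin n → ℕ
  carried j v = orZero (v ∈? clients) λ v∈C → orZero (assign v v∈C Fin.≟ j) λ _ → demand v v∈C

  carried-dem : ∀ {j v} (v∈C : v ∈ clients) → assign v v∈C ≡ j → carried j v ≡ dem v
  carried-dem {j} {v} v∈C eq = trans (orZero-yes (v ∈? clients) _ v∈C)
    (trans (orZero-yes (assign v v∈C Fin.≟ j) _ eq) (sym (orZero-yes (v ∈? clients) _ v∈C)))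

  dem≤capacity : ∀ v → dem v ≤ loadCapacity
  dem≤capacity v with dem v ≟ 0
  ... | yes eq = subst (_≤ loadCapacity) (sym eq) z≤n
  ... | no h   = begin
    dem v                        ≡⟨ sym (carried-dem v∈C refl) ⟩
    carried (assign v v∈C) v     ≤⟨ ∑-≤ (carried (assign v v∈C)) v ⟩
    load (assign v v∈C)          ≤⟨ load≤capacity (assign v v∈C) ⟩
    loadCapacity                 ∎
    where
    open ≤-Reasoning hiding (start)
    v∈C = orZero-≢0 (v ∈? clients) _ h

  unlocated-start : ∀ {v} → locate v ≡ nothing → (v∈C : v ∈ clients) → v ≡ start (assign v v∈C)
  unlocated-start {v} eq v∈C = weightless-vertex (walk (assign v v∈C)) (locate-nothing v eq v∈C) (visits v v∈C)

  -- The colouring has to be injective only on the at most r² vertices at which steps of the tape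
  -- end; this is why r² bit positions suffice, however many vertices there are.
  module _ (col : Fin n → ℕ)
    (col-injective : ∀ i t j s → col (target i t) ≡ col (target j s) → target i t ≡ target j s) where

    c : Fin r → Fin r → ℕ
    c i t = col (target i t)

    locate-functional : ∀ {v v′ x} → locate v ≡ just x → locate v′ ≡ just x → v ≡ v′
    locate-functional {v} {v′} p q with locate-just v p | locate-just v′ q
    ... | _ , _ , refl | _ , _ , refl = refl

    served-vehicle : ∀ {i t} → ty i t ≢ 0 → ∃[ j ] vehicle i ≡ just j
    served-vehicle {i} {t} h = _ , proj₁ (proj₂ (locate-just (target i t) (ty-≢0 i t h)))

    -- A client has only one slot, so different serving steps are charged to different clients in
    -- the load of vehicle j.
    load-i : ∀ i m → vehicle i ≡ m → ∑ (λ t → cond (ty i t) (dem (target i t)) 0) ≤ loadCapacity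
    load-i i nothing eq = ≤-trans (≤-reflexive (∑≡0 _ (λ t → idle t (ty i t ≟ 0)))) z≤n
      where
      idle : ∀ t → Dec (ty i t ≡ 0) → cond (ty i t) (dem (target i t)) 0 ≡ 0
      idle t (yes e) = cong (λ x → cond x (dem (target i t)) 0) e
      idle t (no h) with trans (sym eq) (proj₂ (served-vehicle h))
      ... | ()
    load-i i (just j) eq = begin
      ∑ f                        ≡⟨ ∑≡S f ⟩
      S (allFin r) f             ≤⟨ S-inject (λ t v → locate v ≡ just (i , t)) (allFin n) (Unique.allFin⁺ r)
                                      match (λ {t} {t′} {v} → inj {t} {t′} {v}) ⟩
      S (allFin n) (carried j)   ≡⟨ sym (∑≡S (carried j)) ⟩
      load j                     ≤⟨ load≤capacity j ⟩
      loadCapacity               ∎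
      where
      open ≤-Reasoning hiding (start)
      f : Fin r → ℕ
      f t = cond (ty i t) (dem (target i t)) 0
      match : ∀ {t} → t ∈ₗ allFin r → f t ≢ 0 →
              ∃[ v ] v ∈ₗ allFin n × locate v ≡ just (i , t) × f t ≤ carried j v
      match {t} _ h with locate-just (target i t) loc
        where loc = ty-≢0 i t (cond-≢0 (ty i t) h)
      ... | v∈C , veh , _ = target i t , ∈-allFin _ , ty-≢0 i t (cond-≢0 (ty i t) h) ,
        ≤-reflexive (trans (cond-true (cond-≢0 (ty i t) h))
          (sym (carried-dem v∈C (Maybe.just-injective (trans (sym veh) eq)))))
      inj : ∀ {t t′ v} → locate v ≡ just (i , t) → locate v ≡ just (i , t′) → t ≡ t′
      inj {v = v} p q = cong proj₂ (Maybe.just-injective (trans (sym p) q))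

    route : ∀ i → Route (w i) (ty i) (c i) col
    route i = record
      { at     = at (vehicle i)
      ; start  = at-start (vehicle i)
      ; closed = at-closed (vehicle i)
      ; steps  = λ t → at-step (vehicle i) (toℕ t)
      ; serves = λ t h → let loc = ty-≢0 i t h in
          (λ e → contradiction (trans (sym (cli-yes (proj₁ (locate-just (target i t) loc)))) e) λ ()) ,
          refl , ty-located {target i t} loc
      ; load≤  = load-i i (vehicle i) refl }
      where
      at-start : ∀ m → at m 0 ∈ depots
      at-start (just j) = subst (_∈ depots) (sym (position-0 (walk j))) (start∈depots j)
      at-start nothing  = proj₂ depots-nonempty
      at-closed : ∀ m → at m r ≡ at m 0
      at-closed (just j) = trans (position-end (walk j) (≤-trans (hops≤weight (walk j)) (walkCost≤r j)))
                                 (sym (position-0 (walk j)))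
      at-closed nothing  = refl
      at-step : ∀ m t → Step (stepWeight m t) (at m t) (at m (suc t))
      at-step (just j) t = position-step (walk j) t
      at-step nothing  t = inj₁ (refl , refl)

    total≤r : ∑ (λ i → ∑ (w i)) ≤ r
    total≤r = begin
      ∑ (λ i → ∑ (w i))              ≡⟨ ∑≡S (λ i → ∑ (w i)) ⟩
      S (allFin r) (λ i → ∑ (w i))   ≤⟨ S-inject (λ i j → vehicle i ≡ just j) (allFin vehicles) (Unique.allFin⁺ r)
                                          (λ {i} _ h → match i (vehicle i) refl h) vehicle-injective ⟩
      S (allFin vehicles) walkCost       ≡⟨ sym (∑≡S walkCost) ⟩
      ∑ walkCost                         ≤⟨ cheap ⟩
      r                              ∎
      where
      open ≤-Reasoning hiding (start)
      match : ∀ i m → vehicle i ≡ m → ∑ (w i) ≢ 0 →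
              ∃[ j ] j ∈ₗ allFin vehicles × vehicle i ≡ just j × ∑ (w i) ≤ walkCost j
      match i nothing  eq h = contradiction (∑w≡0 eq) h
      match i (just j) eq h = j , ∈-allFin j , eq , ∑w≤walkCost eq

    -- An unlocated client belongs to a weightless walk, which consists of its start alone; such a
    -- client is a depot. All the others have slots, and distinct ones.
    nondepots-served : ∑ nondepotClient ≤ ∑ (λ i → ∑ (λ t → δ (ty i t) 1))
    nondepots-served = begin
      ∑ nondepotClient              ≡⟨ ∑≡S nondepotClient ⟩
      S (allFin n) nondepotClient   ≤⟨ S-inject (λ v x → locate v ≡ just x) (pairs r) (Unique.allFin⁺ n)
                                         (λ {v} _ h → match v (locate v) refl h) (λ {v} {v′} → locate-functional {v} {v′}) ⟩
      S (pairs r) (λ { (i , t) → δ (ty i t) 1 }) ≡⟨ S-pairs r (λ i t → δ (ty i t) 1) ⟩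
      ∑ (λ i → ∑ (λ t → δ (ty i t) 1)) ∎
      where
      open ≤-Reasoning hiding (start)
      match : ∀ v m → locate v ≡ m → nondepotClient v ≢ 0 →
              ∃[ x ] x ∈ₗ pairs r × locate v ≡ just x × nondepotClient v ≤ δ (ty (proj₁ x) (proj₂ x)) 1
      match v nothing eq h with nondepotClient-≢0 v h
      ... | v∈C , v∉D , _ =
        contradiction (subst (_∈ depots) (sym (unlocated-start {v} eq v∈C)) (start∈depots _)) v∉D
      match v (just (i , t)) eq h with nondepotClient-≢0 v h
      ... | _ , v∉D , ≤1 = (i , t) , ∈-cartesianProduct⁺ (∈-allFin i) (∈-allFin t) , eq , ≤-trans ≤1
        (≤-reflexive (sym (cong (λ x → δ x 1) (trans (ty-located {v} eq) (cong suc (bit-no (v ∈? depots) v∉D))))))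

    -- A serving tape vehicle is matched with the moving vehicle it copies. A depot client is
    -- matched with its service of type 2, or else with the weightless vehicle assigned to it. That
    -- vehicle stands on the client, hence determines it, and differs from all moving ones.
    used≤fleet : ∑ (λ i → cond (∑ (ty i)) 1 0) + ∑ depotClient ≤
                 fleet + ∑ (λ i → ∑ (λ t → δ (ty i t) 2))
    used≤fleet = begin
      ∑ U + ∑ depotClient                         ≡⟨ cong₂ _+_ (∑≡S U) (∑≡S depotClient) ⟩
      S (allFin r) U + S (allFin n) depotClient   ≡⟨ sym (S-⊎ (allFin r) (allFin n) f) ⟩
      S xs f                                      ≤⟨ S-inject M ys (⊎-unique (Unique.allFin⁺ r) (Unique.allFin⁺ n))
                                                       match (λ {x} {x′} → inj {x} {x′}) ⟩
      S ys g                                      ≡⟨ S-⊎ (allFin vehicles) (pairs r) g ⟩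
      S (allFin vehicles) (λ _ → 1) + S (pairs r) (λ { (i , t) → δ (ty i t) 2 })
                                                  ≡⟨ cong₂ _+_ (ones (allFin vehicles)) (S-pairs r (λ i t → δ (ty i t) 2)) ⟩
      length (allFin vehicles) + N                ≡⟨ cong (_+ N) (length-tabulate (λ x → x)) ⟩
      vehicles + N                                ≤⟨ +-monoˡ-≤ N vehicles≤fleet ⟩
      fleet + N                                   ∎
      where
      open ≤-Reasoning hiding (start)
      N = ∑ (λ i → ∑ (λ t → δ (ty i t) 2))
      U : Fin r → ℕ
      U i = cond (∑ (ty i)) 1 0
      ones : ∀ {A : Set} (ys : List A) → S ys (λ _ → 1) ≡ length ys
      ones []       = refl
      ones (_ ∷ ys) = cong suc (ones ys)
      xs : List (Fin r ⊎ Fin n)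
      xs = map inj₁ (allFin r) ++ map inj₂ (allFin n)
      ys : List (Fin vehicles ⊎ (Fin r × Fin r))
      ys = map inj₁ (allFin vehicles) ++ map inj₂ (pairs r)
      f : Fin r ⊎ Fin n → ℕ
      f (inj₁ i) = U i
      f (inj₂ v) = depotClient v
      g : Fin vehicles ⊎ (Fin r × Fin r) → ℕ
      g (inj₁ j)       = 1
      g (inj₂ (i , t)) = δ (ty i t) 2
      M : Fin r ⊎ Fin n → Fin vehicles ⊎ (Fin r × Fin r) → Set
      M (inj₁ i) (inj₁ j) = vehicle i ≡ just j
      M (inj₁ i) (inj₂ x) = ⊥
      M (inj₂ v) (inj₁ j) = v ≡ start j × walkCost j ≡ 0
      M (inj₂ v) (inj₂ x) = locate v ≡ just x
      inj : ∀ {x x′ y} → M x y → M x′ y → x ≡ x′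
      inj {inj₁ _} {inj₁ _} {inj₁ _} p q = cong inj₁ (vehicle-injective p q)
      inj {inj₁ _} {inj₂ _} {inj₁ _} p (_ , z) = contradiction z (vehicle-moving p)
      inj {inj₂ _} {inj₁ _} {inj₁ _} (_ , z) p = contradiction z (vehicle-moving p)
      inj {inj₂ _} {inj₂ _} {inj₁ _} (refl , _) (refl , _) = refl
      inj {inj₂ v} {inj₂ v′} {inj₂ _} p q = cong inj₂ (locate-functional {v} {v′} p q)
      ∈-ys₁ : ∀ j → inj₁ j ∈ₗ ys
      ∈-ys₁ j = ∈-++⁺ˡ (∈-map⁺ inj₁ (∈-allFin j))
      ∈-ys₂ : ∀ i t → inj₂ (i , t) ∈ₗ ys
      ∈-ys₂ i t = ∈-++⁺ʳ (map inj₁ (allFin vehicles)) (∈-map⁺ inj₂ (∈-cartesianProduct⁺ (∈-allFin i) (∈-allFin t)))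
      match-i : ∀ i m → vehicle i ≡ m → U i ≢ 0 → ∃[ y ] y ∈ₗ ys × M (inj₁ i) y × U i ≤ g y
      match-i i (just j) eq h = inj₁ j , ∈-ys₁ j , eq , U≤1 (∑ (ty i))
        where
        U≤1 : ∀ x → cond x 1 0 ≤ 1
        U≤1 zero    = z≤n
        U≤1 (suc _) = ≤-refl
      match-i i nothing eq h = contradiction (∑≡0 (ty i) idle) (cond-≢0 (∑ (ty i)) h)
        where
        idle : ∀ t → ty i t ≡ 0
        idle t with ty i t ≟ 0
        ... | yes e = e
        ... | no h′ with trans (sym eq) (proj₂ (served-vehicle h′))
        ...   | ()
      match-v : ∀ v m → locate v ≡ m → depotClient v ≢ 0 → ∃[ y ] y ∈ₗ ys × M (inj₂ v) y × depotClient v ≤ g y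
      match-v v nothing eq h with depotClient-≢0 v h
      ... | v∈C , _ , ≤1 =
        inj₁ (assign v v∈C) , ∈-ys₁ _ , (unlocated-start {v} eq v∈C , locate-nothing v eq v∈C) , ≤1
      match-v v (just (i , t)) eq h with depotClient-≢0 v h
      ... | _ , v∈D , ≤1 = inj₂ (i , t) , ∈-ys₂ i t , eq , ≤-trans ≤1
        (≤-reflexive (sym (cong (λ x → δ x 2) (trans (ty-located {v} eq) (cong suc (bit-yes (v ∈? depots) v∈D))))))
      match : ∀ {x} → x ∈ₗ xs → f x ≢ 0 → ∃[ y ] y ∈ₗ ys × M x y × f x ≤ g y
      match {inj₁ i} _ h = match-i i (vehicle i) refl h
      match {inj₂ v} _ h = match-v v (locate v) refl h

    complete : Good w ty c col
    complete = record
      { weight≤   = total≤r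
      ; gas≤      = λ i → gas (vehicle i) refl
      ; distinct  = λ i t j s h h′ eq → split (Maybe.just-injective
          (trans (sym (ty-≢0 i t h)) (trans (cong locate (col-injective i t j s eq)) (ty-≢0 j s h′))))
      ; route     = route
      ; nondepots = nondepots-served
      ; fleet≤    = used≤fleet
      ; demands   = dem≤capacity }
      where
      gas : ∀ {i} m → vehicle i ≡ m → ∑ (w i) ≤ gasCapacity
      gas nothing  eq = subst (_≤ gasCapacity) (sym (∑w≡0 eq)) z≤n
      gas (just j) eq = ≤-trans (∑w≤walkCost eq) (gas≤capacity j)
      split : ∀ {i t j s : Fin r} → (i , t) ≡ (j , s) → i ≡ j × t ≡ s
      split refl = refl , refl

-- Digits, bits and colours

foldℕ-cong : ∀ {A : Set} N {z z′ : A} {f g : ℕ → A → A} → z ≡ z′ →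
             (∀ {i} a → i < N → f i a ≡ g i a) → foldℕ N z f ≡ foldℕ N z′ g
foldℕ-cong zero    z≡ h = z≡
foldℕ-cong (suc N) {f = f} z≡ h =
  trans (cong (f N) (foldℕ-cong N z≡ (λ a i<N → h a (m<n⇒m<1+n i<N)))) (h _ (n<1+n N))

foldℕ-* : ∀ N x → foldℕ N 0 (λ _ a → a + x) ≡ N * x
foldℕ-* zero    x = refl
foldℕ-* (suc N) x = trans (+-comm _ x) (cong (x +_) (foldℕ-* N x))

foldℕ-^ : ∀ N b → foldℕ N 1 (λ _ a → b * a) ≡ b ^ N
foldℕ-^ zero    b = refl
foldℕ-^ (suc N) b = cong (b *_) (foldℕ-^ N b)

foldℕ-guard-≤ : ∀ N {j} (y : ℕ) f → N ≤ j →
                foldℕ N y (λ i a → cond (j ∸ i) (f a) a) ≡ foldℕ N y (λ _ → f)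
foldℕ-guard-≤ N y f N≤j = foldℕ-cong N refl (λ a i<N → cond-true (m>n⇒m∸n≢0 (≤-trans i<N N≤j)))

-- Loop counts are parameters, so a computed number j of rounds is realised by N rounds of which
-- those from j onwards change nothing.
foldℕ-guard : ∀ N {j} (y : ℕ) f → j ≤ N →
              foldℕ N y (λ i a → cond (j ∸ i) (f a) a) ≡ foldℕ j y (λ _ → f)
foldℕ-guard N {j} y f j≤N with m≤n⇒m<n∨m≡n j≤N
... | inj₂ refl = foldℕ-guard-≤ N y f ≤-refl
foldℕ-guard (suc N) {j} y f _ | inj₁ j<1+N =
  trans (cong (λ x → cond x (f prev) prev) (m≤n⇒m∸n≡0 {j} {N} (s≤s⁻¹ j<1+N))) (foldℕ-guard N y f (s≤s⁻¹ j<1+N))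
  where prev = foldℕ N y (λ i a → cond (j ∸ i) (f a) a)

-- Division by counting the positive multiples of b up to y, among the first N; it is exact if the
-- quotient is at most N.
quot : ℕ → ℕ → ℕ → ℕ
quot N b y = foldℕ N 0 (λ i a → a + cond (b * (i + 1) ∸ y) 0 1)

rem : ℕ → ℕ → ℕ → ℕ
rem N b y = y ∸ b * quot N b y

digit : (N b K y j : ℕ) → ℕ
digit N b K y j = rem N b (foldℕ K y (λ i a → cond (j ∸ i) (quot N b a) a))

encode : (b K : ℕ) → (ℕ → ℕ) → ℕ
encode b zero    g = 0
encode b (suc K) g = g 0 + b * encode b K (g ∘ suc)

encode-< : ∀ b K g → (∀ j → g j < b) → encode b K g < b ^ K
encode-< b zero    g h = z<s
encode-< b (suc K) g h = begin-strict
  g 0 + b * encode b K (g ∘ suc)   <⟨ +-monoˡ-< _ (h 0) ⟩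
  b + b * encode b K (g ∘ suc)     ≡⟨ sym (*-suc b _) ⟩
  b * suc (encode b K (g ∘ suc))   ≤⟨ *-monoʳ-≤ b (encode-< b K (g ∘ suc) (h ∘ suc)) ⟩
  b * b ^ K                        ∎
  where open ≤-Reasoning

encode-cong : ∀ b K {g h} → (∀ {j} → j < K → g j ≡ h j) → encode b K g ≡ encode b K h
encode-cong b zero    H = refl
encode-cong b (suc K) H = cong₂ (λ x y → x + b * y) (H z<s) (encode-cong b K (H ∘ s<s))

encode-surjective : ∀ b .{{_ : NonZero b}} K v → v < b ^ K → ∃[ g ] (∀ j → g j < b) × v ≡ encode b K g
encode-surjective b zero    zero v< = (λ _ → 0) , (λ _ → >-nonZero⁻¹ b) , refl
encode-surjective b zero    (suc v) (s<s ())
encode-surjective b (suc K) v v<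
  with encode-surjective b K (v / b) (m<n*o⇒m/o<n (subst (v <_) (*-comm b (b ^ K)) v<))
... | g , g< , eq = (λ { zero → v % b ; (suc j) → g j }) ,
  (λ { zero → m%n<n v b ; (suc j) → g< j }) ,
  trans (m≡m%n+[m/n]*n v b) (cong (v % b +_) (trans (*-comm (v / b) b) (cong (b *_) eq)))

module _ (N b : ℕ) where

  quot-step : ∀ M {d q} → d < b → M ≤ q →
    foldℕ M 0 (λ i a → a + cond (b * (i + 1) ∸ (d + b * q)) 0 1) ≡ M
  quot-step zero    d<b M≤q = refl
  quot-step (suc M) {d} {q} d<b M<q = trans (cong₂ _+_ (quot-step M d<b (<⇒≤ M<q))
    (cong (λ x → cond x 0 1) (m≤n⇒m∸n≡0 (≤-trans (*-monoʳ-≤ b (≤-trans (≤-reflexive (+-comm M 1)) M<q)) (m≤n+m _ d)))))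
    (+-comm M 1)

  quot-+ : ∀ M {d q} → d < b → q ≤ M →
    foldℕ M 0 (λ i a → a + cond (b * (i + 1) ∸ (d + b * q)) 0 1) ≡ q
  quot-+ M {d} {q} d<b q≤M with m≤n⇒m<n∨m≡n q≤M
  ... | inj₂ refl = quot-step M d<b ≤-refl
  quot-+ (suc M) {d} {q} d<b _ | inj₁ q<1+M =
    trans (cong₂ _+_ (quot-+ M d<b (s≤s⁻¹ q<1+M)) (cond-true (m>n⇒m∸n≢0 over))) (+-identityʳ q)
    where
    open ≤-Reasoning
    over : d + b * q < b * (M + 1)
    over = begin-strict
      d + b * q      <⟨ +-monoˡ-< (b * q) d<b ⟩
      b + b * q      ≡⟨ sym (*-suc b q) ⟩
      b * suc q      ≤⟨ *-monoʳ-≤ b (≤-trans q<1+M (≤-reflexive (+-comm 1 M))) ⟩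
      b * (M + 1)    ∎

  q≤d+bq : ∀ {d} q → d < b → q ≤ d + b * q
  q≤d+bq {d} q d<b = ≤-trans (m≤n*m q b {{>-nonZero (≤-trans z<s d<b)}}) (m≤n+m _ d)

  quot-encode : ∀ {d q} → d < b → d + b * q ≤ N → quot N b (d + b * q) ≡ q
  quot-encode {d} {q} d<b ≤N = quot-+ N d<b (≤-trans (q≤d+bq q d<b) ≤N)

  rem-encode : ∀ {d q} → d < b → d + b * q ≤ N → rem N b (d + b * q) ≡ d
  rem-encode {d} {q} d<b ≤N = trans (cong (λ x → d + b * q ∸ b * x) (quot-encode d<b ≤N)) (m+n∸n≡m d (b * q))

  encode-tail-≤ : ∀ K g → (∀ j → g j < b) → encode b (suc K) g ≤ N → encode b K (g ∘ suc) ≤ N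
  encode-tail-≤ K g h ≤N = ≤-trans (q≤d+bq (encode b K (g ∘ suc)) (h 0)) ≤N

  -- Every division drops the lowest digit. The second component is carried along because the next
  -- division is exact only below N.
  quots-encode : ∀ j K g → (∀ i → g i < b) → encode b (j + K) g ≤ N →
    foldℕ j (encode b (j + K) g) (λ _ → quot N b) ≡ encode b K (λ i → g (j + i))
    × encode b K (λ i → g (j + i)) ≤ N
  quots-encode zero    K g h ≤N = refl , ≤N
  quots-encode (suc j) K g h ≤N
    with quots-encode j (suc K) g h (subst (λ x → encode b x g ≤ N) (sym (+-suc j K)) ≤N)
  ... | eq , ≤N′ =
    trans (cong (λ x → quot N b (foldℕ j (encode b x g) (λ _ → quot N b))) (sym (+-suc j K)))
      (trans (cong (quot N b) eq) (trans (quot-encode (h (j + 0)) ≤N′) shift)) ,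
    subst (_≤ N) shift (encode-tail-≤ K (λ i → g (j + i)) (λ i → h (j + i)) ≤N′)
    where
    shift = encode-cong b K (λ {i} _ → cong g (+-suc j i))

  digit-encode : ∀ K g → (∀ j → g j < b) → encode b K g ≤ N → ∀ {j} → j < K →
                 digit N b K (encode b K g) j ≡ g j
  digit-encode K g h ≤N {j} j<K with m≤n⇒∃[o]m+o≡n j<K
  ... | o , refl = trans
      (cong (rem N b) (trans (foldℕ-guard (suc (j + o)) _ _ (≤-trans (m≤m+n j o) (n≤1+n _)))
        (trans (cong (λ x → foldℕ j (encode b x g) (λ _ → quot N b)) (sym (+-suc j o))) (proj₁ qs))))
      (trans (rem-encode (h (j + 0)) (proj₂ qs)) (cong g (+-identityʳ j)))
    where
    qs = quots-encode j (suc o) g h (subst (λ x → encode b x g ≤ N) (sym (+-suc j o)) ≤N)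

-- The number with binary digits at the positions h 0, ..., h (M - 1) of `bits`, the first of them
-- being the most significant.
colour : (bits : ℕ → ℕ) (h : ℕ → ℕ) (M : ℕ) → ℕ
colour bits h M = foldℕ M 0 (λ p a → (a + a) + bits (h p))

colour-< : ∀ bits h M → (∀ {p} → p < M → bits (h p) ≤ 1) → colour bits h M < 2 ^ M
colour-< bits h zero    H = z<s
colour-< bits h (suc M) H = begin-strict
  c + c + bits (h M)     <⟨ s≤s (+-monoʳ-≤ (c + c) (H (n<1+n M))) ⟩
  suc (c + c + 1)        ≡⟨ cong suc (+-assoc c c 1) ⟩
  suc c + (c + 1)        ≡⟨ cong (suc c +_) (+-comm c 1) ⟩
  suc c + suc c          ≤⟨ +-mono-≤ ih ih ⟩
  2 ^ M + 2 ^ M          ≡⟨ cong (2 ^ M +_) (sym (+-identityʳ _)) ⟩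
  2 ^ suc M              ∎
  where
  open ≤-Reasoning
  c = colour bits h M
  ih = colour-< bits h M (H ∘ m<n⇒m<1+n)

double-injective : ∀ a b {x y} → x ≤ 1 → y ≤ 1 → a + a + x ≡ b + b + y → a ≡ b × x ≡ y
double-injective zero    zero    x≤ y≤ eq = refl , eq
double-injective zero    (suc b) {x} {y} x≤ y≤ eq = contradiction
  (≤-trans (≤-reflexive (cong suc (cong (_+ y) (sym (+-suc b b))))) (≤-trans (≤-reflexive (sym eq)) x≤)) λ { (s≤s ()) }
double-injective (suc a) zero    {x} {y} x≤ y≤ eq = contradiction
  (≤-trans (≤-reflexive (cong suc (cong (_+ x) (sym (+-suc a a))))) (≤-trans (≤-reflexive eq) y≤)) λ { (s≤s ()) }
double-injective (suc a) (suc b) {x} {y} x≤ y≤ eq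
  with double-injective a b x≤ y≤ (suc-injective (trans (cong (_+ x) (sym (+-suc a a)))
         (trans (suc-injective eq) (cong (_+ y) (+-suc b b)))))
... | refl , x≡y = refl , x≡y

override : (ℕ → ℕ) → ℕ → ℕ → ℕ → ℕ
override h m q p with p ≟ m
... | yes _ = q
... | no  _ = h p

override-same : ∀ h m q → override h m q m ≡ q
override-same h m q with m ≟ m
... | yes _ = refl
... | no ¬p = contradiction refl ¬p

override-< : ∀ h {m q p} → p < m → override h m q p ≡ h p
override-< h {m} {q} {p} p<m with p ≟ m
... | yes refl = contradiction p<m (<-irrefl refl)
... | no _     = refl

-- k numbers are told apart by fewer than k of their bits: a new number
-- agrees on the bits chosen so far with at most one of the old ones.
module _ {V : Set} (_≟V_ : (x y : V) → Dec (x ≡ y)) (bits : V → ℕ → ℕ) (L : ℕ)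
  (bits≤1 : ∀ v {q} → q ≤ L → bits v q ≤ 1)
  (separate : ∀ x y → x ≢ y → ∃[ q ] q ≤ L × bits x q ≢ bits y q) where

  colours-separate : (xs : List V) → ∃[ h ] (∀ p → h p ≤ L) ×
    (∀ {x y} → x ∈ₗ xs → y ∈ₗ xs → colour (bits x) h (length xs) ≡ colour (bits y) h (length xs) → x ≡ y)
  colours-separate [] = (λ _ → 0) , (λ _ → z≤n) , λ ()
  colours-separate (x ∷ xs) with colours-separate xs
  ... | h , h≤ , inj = go (any? (λ y → ¬? (x ≟V y) ×-dec (col x ≟ col y)) xs)
    where
    M = length xs
    col : V → ℕ
    col v = colour (bits v) h M

    module _ (q : ℕ) (q≤L : q ≤ L) where
      h′ : ℕ → ℕ
      h′ = override h M q
      h′≤ : ∀ p → h′ p ≤ L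
      h′≤ p with p ≟ M
      ... | yes _ = q≤L
      ... | no _  = h≤ p
      col′≡ : ∀ v → colour (bits v) h′ (suc M) ≡ col v + col v + bits v q
      col′≡ v = cong₂ (λ c b → c + c + b)
        (foldℕ-cong M refl (λ a p<M → cong (λ k → a + a + bits v k) (override-< h p<M)))
        (cong (bits v) (override-same h M q))
      split : ∀ {y z} → colour (bits y) h′ (suc M) ≡ colour (bits z) h′ (suc M) → col y ≡ col z × bits y q ≡ bits z q
      split {y} {z} eq = double-injective (col y) (col z) (bits≤1 y q≤L) (bits≤1 z q≤L)
        (trans (sym (col′≡ y)) (trans eq (col′≡ z)))

      addPosition : (∀ {z} → z ∈ₗ xs → col x ≡ col z → bits x q ≡ bits z q → x ≡ z) →
        ∃[ h ] (∀ p → h p ≤ L) × (∀ {y z} → y ∈ₗ x ∷ xs → z ∈ₗ x ∷ xs →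
          colour (bits y) h (suc M) ≡ colour (bits z) h (suc M) → y ≡ z)
      addPosition new = h′ , h′≤ , inj′
        where
        inj′ : ∀ {y z} → y ∈ₗ x ∷ xs → z ∈ₗ x ∷ xs →
          colour (bits y) h′ (suc M) ≡ colour (bits z) h′ (suc M) → y ≡ z
        inj′ (here refl) (here refl) _  = refl
        inj′ (here refl) (there z∈) eq = new z∈ (proj₁ (split eq)) (proj₂ (split eq))
        inj′ (there y∈) (here refl) eq = sym (new y∈ (sym (proj₁ (split eq))) (sym (proj₂ (split eq))))
        inj′ (there y∈) (there z∈)  eq = inj y∈ z∈ (proj₁ (split eq))

    go : Dec (Any (λ y → x ≢ y × col x ≡ col y) xs) →
      ∃[ h ] (∀ p → h p ≤ L) × (∀ {y z} → y ∈ₗ x ∷ xs → z ∈ₗ x ∷ xs →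
        colour (bits y) h (suc M) ≡ colour (bits z) h (suc M) → y ≡ z)
    -- The colour of x is already new, so any position will do; one is added all the same, to keep
    -- as many positions as list entries.
    go (no none) = addPosition 0 z≤n λ {z} z∈ eq _ → decidable-stable (x ≟V z)
      λ x≢z → none (lose z∈ (x≢z , eq))
    go (yes some) with find some
    ... | y , y∈ , x≢y , cx≡cy with separate x y x≢y
    ...   | q , q≤L , bx≢by = addPosition q q≤L λ z∈ cx≡cz bx≡bz →
      contradiction (trans bx≡bz (cong (λ v → bits v q) (inj z∈ y∈ (trans (sym cx≡cz) cx≡cy)))) bx≢by

digit-< : ∀ N b .{{_ : NonZero b}} K {v j} → v < b ^ K → v ≤ N → j < K → digit N b K v j < b
digit-< N b K {v} {j} v< v≤N j<K with encode-surjective b K v v<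
... | g , g< , refl = subst (_< b) (sym (digit-encode N b K g g< v≤N j<K)) (g< j)

digits-separate : ∀ N b .{{_ : NonZero b}} K {v w} → v < b ^ K → w < b ^ K → v ≤ N → w ≤ N → v ≢ w →
                  ∃[ q ] q < K × digit N b K v q ≢ digit N b K w q
digits-separate N b K {v} {w} v< w< v≤N w≤N v≢w
  with encode-surjective b K v v< | encode-surjective b K w w<
... | g , g< , refl | h , h< , refl
  with Fin.¬∀⟶∃¬ K (λ q → g (toℕ q) ≡ h (toℕ q)) (λ q → g (toℕ q) ≟ h (toℕ q))
         (λ all → v≢w (encode-cong b K (λ j<K →
           subst (λ j → g j ≡ h j) (Fin.toℕ-fromℕ< j<K) (all (fromℕ< j<K)))))
... | q , gq≢hq = toℕ q , Fin.toℕ<n q , λ eq → gq≢hq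
  (trans (sym (digit-encode N b K g g< v≤N (Fin.toℕ<n q)))
         (trans eq (digit-encode N b K h h< w≤N (Fin.toℕ<n q))))

-- Reading the input

cells-++ : ∀ xs ys a → cells (xs ++ ys) (length xs + a) ≡ cells ys a
cells-++ []       ys a = refl
cells-++ (x ∷ xs) ys a = cells-++ xs ys a

cells-tabulate : ∀ {n} (f : Fin n → ℕ) ys v → cells (tabulate f ++ ys) (toℕ v) ≡ f v
cells-tabulate f ys zero    = refl
cells-tabulate f ys (suc v) = cells-tabulate (f ∘ suc) ys v

cells-past-tabulate : ∀ {n} (f : Fin n → ℕ) ys a → cells (tabulate f ++ ys) (n + a) ≡ cells ys a
cells-past-tabulate {zero}  f ys a = refl
cells-past-tabulate {suc n} f ys a = cells-past-tabulate (f ∘ suc) ys a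

cells-rows : ∀ {m n} (f : Fin m → Fin n → ℕ) ys u v →
             cells (concat (tabulate (λ u → tabulate (f u))) ++ ys) (n * toℕ u + toℕ v) ≡ f u v
cells-rows {suc m} {n} f ys zero v = trans
  (cong₂ cells (++-assoc (tabulate (f zero)) _ ys) (cong (_+ toℕ v) (*-zeroʳ n)))
  (cells-tabulate (f zero) _ v)
cells-rows {suc m} {n} f ys (suc u) v = trans
  (cong₂ cells (++-assoc (tabulate (f zero)) _ ys)
    (trans (cong (_+ toℕ v) (*-suc n (toℕ u))) (+-assoc n (n * toℕ u) (toℕ v))))
  (trans (cells-past-tabulate (f zero) _ (n * toℕ u + toℕ v)) (cells-rows (f ∘ suc) ys u v))

cells-past-rows : ∀ {m n} (f : Fin m → Fin n → ℕ) ys a →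
                  cells (concat (tabulate (λ u → tabulate (f u))) ++ ys) (m * n + a) ≡ cells ys a
cells-past-rows {zero}      f ys a = refl
cells-past-rows {suc m} {n} f ys a = trans
  (cong₂ cells (++-assoc (tabulate (f zero)) _ ys) (+-assoc n (m * n) a))
  (trans (cells-past-tabulate (f zero) _ (m * n + a)) (cells-past-rows (f ∘ suc) ys a))

-- The tables of the instance start at cell `off`, and cell `ga` holds the
-- gas capacity.
record Encodes (off ga : ℕ) (J : ℕ → ℕ) {n} (I : LoadGasCVRP n) (r : ℕ) : Set where
  open LoadGasCVRP I
  open Spec I r
  field
    size     : J 0 ≡ n
    budget   : J 1 ≡ r
    vans     : J 2 ≡ fleet
    capacity : J 3 ≡ loadCapacity
    gas      : J ga ≡ gasCapacity
    depotAt  : ∀ v → J (off + toℕ v) ≡ dep v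
    clientAt : ∀ v → J (off + (n + toℕ v)) ≡ cli v
    demandAt : ∀ v → J (off + (n + (n + toℕ v))) ≡ dem v
    edgeAt   : ∀ u v → J (off + (n + (n + (n + (n * toℕ u + toℕ v))))) ≡ bit (adjacent u v)
    weightAt : ∀ u v → J (off + (n + (n + (n + (n * n + (n * toℕ u + toℕ v)))))) ≡
                       orZero (T? (adjacent u v)) (weight u v)

module _ {n} (I : LoadCVRP n) (g r : ℕ) where
  withGas : LoadGasCVRP n
  withGas = record { loadCVRP = I ; gasCapacity = g }

  module _ (J : ℕ → ℕ) (off : ℕ) (reads : ∀ a → J (off + a) ≡ cells (encodeBody I) a) where
    open LoadCVRP I
    open Spec withGas r

    private
      W = matrix I (λ u v → orZero (T? (adjacent u v)) (weight u v))
      E = matrix I (λ u v → bit (adjacent u v))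
      d = tabulate dem
      c = tabulate cli

    body-depot : ∀ v → J (off + toℕ v) ≡ dep v
    body-depot v = trans (reads _) (cells-tabulate dep _ v)

    body-client : ∀ v → J (off + (n + toℕ v)) ≡ cli v
    body-client v = trans (reads _) (trans (cells-past-tabulate dep _ _) (cells-tabulate cli _ v))

    body-demand : ∀ v → J (off + (n + (n + toℕ v))) ≡ dem v
    body-demand v = trans (reads _) (trans (cells-past-tabulate dep _ _)
      (trans (cells-past-tabulate cli _ _) (cells-tabulate dem _ v)))

    body-matrices : ∀ a → J (off + (n + (n + (n + a)))) ≡ cells (E ++ W) a
    body-matrices a = trans (reads _) (trans (cells-past-tabulate dep _ _)
      (trans (cells-past-tabulate cli _ _) (cells-past-tabulate dem _ a)))

    body-edge : ∀ u v → J (off + (n + (n + (n + (n * toℕ u + toℕ v))))) ≡ bit (adjacent u v)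
    body-edge u v = trans (body-matrices _) (cells-rows _ W u v)

    body-weight : ∀ u v → J (off + (n + (n + (n + (n * n + (n * toℕ u + toℕ v)))))) ≡
                          orZero (T? (adjacent u v)) (weight u v)
    body-weight u v = trans (body-matrices _) (trans (cells-past-rows (λ u v → bit (adjacent u v)) W _)
      (trans (cong (λ xs → cells xs (n * toℕ u + toℕ v)) (sym (++-identityʳ W))) (cells-rows _ [] u v)))

encodes-gas : ∀ {n} (I : LoadGasCVRP n) r → Encodes 5 4 (cells (encodeLoadGasCVRP I r)) I r
encodes-gas I r = record
  { size = refl ; budget = refl ; vans = refl ; capacity = refl ; gas = refl
  ; depotAt = body-depot L g r mem 5 reads ; clientAt = body-client L g r mem 5 reads
  ; demandAt = body-demand L g r mem 5 reads ; edgeAt = body-edge L g r mem 5 reads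
  ; weightAt = body-weight L g r mem 5 reads }
  where
  mem = cells (encodeLoadGasCVRP I r)
  L = LoadGasCVRP.loadCVRP I
  g = LoadGasCVRP.gasCapacity I
  reads : ∀ a → cells (encodeLoadGasCVRP I r) (5 + a) ≡ cells (encodeBody L) a
  reads a = refl

-- Without a gas capacity, the bound r on the total weight serves as one.
encodes-load : ∀ {n} (I : LoadCVRP n) r → Encodes 4 1 (cells (encodeLoadCVRP I r)) (withGas I r r) r
encodes-load I r = record
  { size = refl ; budget = refl ; vans = refl ; capacity = refl ; gas = refl
  ; depotAt = body-depot I r r mem 4 reads ; clientAt = body-client I r r mem 4 reads
  ; demandAt = body-demand I r r mem 4 reads ; edgeAt = body-edge I r r mem 4 reads
  ; weightAt = body-weight I r r mem 4 reads }
  where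
  mem = cells (encodeLoadCVRP I r)
  reads : ∀ a → cells (encodeLoadCVRP I r) (4 + a) ≡ cells (encodeBody I) a
  reads a = refl

-- The algorithm

v0 : ∀ {m b} → Tm (1 + m) b
v0 = var zero
v1 : ∀ {m b} → Tm (2 + m) b
v1 = var (suc zero)
v2 : ∀ {m b} → Tm (3 + m) b
v2 = var (suc (suc zero))
v3 : ∀ {m b} → Tm (4 + m) b
v3 = var (suc (suc (suc zero)))
v4 : ∀ {m b} → Tm (5 + m) b
v4 = var (suc (suc (suc (suc zero))))

infixl 9 _$$_
_$$_ : ∀ {m b k} → Tm k b → Vec (Tm m b) k → Tm m b
f $$ es = call f (Vec.lookup es)

-- Parameters: 1 the order n, 2 the budget r, 3 r², 4 the number of digits
-- of a tape, 5 the constant 2, 6 one more than ⌈log₂ n⌉, 8 the base of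
-- the tapes, and 9 the number of tapes; 7 is a factor of 8, and 0 the
-- output.

-- One factor must be a parameter, since it counts the additions. In the body of a `fold`, v0 is the
-- counter and v1 the accumulator, and outer variables are shifted by two.
mulT : ∀ {b} → ℕ → Tm 1 b
mulT p = fold p (lit 0) (v1 ⊞ v2)

quotT remT : ∀ {b} → ℕ → ℕ → Tm 1 b
quotT N p = fold N (lit 0) (v1 ⊞ ite (mulT p $$ (v0 ⊞ lit 1 ∷ []) ⊟ v2) (lit 0) (lit 1))
remT N p = v0 ⊟ mulT p $$ (quotT N p $$ (v0 ∷ []) ∷ [])

digitT : ∀ {b} → ℕ → ℕ → ℕ → Tm 2 b
digitT N p K = remT N p $$ (fold K v0 (ite (v3 ⊟ v0) (quotT N p $$ (v1 ∷ [])) v1) ∷ [])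

eqT leT : ∀ {b} → Tm 2 b
eqT = ite (v0 ⊟ v1) (lit 0) (ite (v1 ⊟ v0) (lit 0) (lit 1))
leT = ite (v0 ⊟ v1) (lit 0) (lit 1)

-- Digit (q , i , t) of tape x is the weight, the type, or the colour of
-- step t of vehicle i for q = 1, 2, 3; for q = 0 the digits are the bit
-- positions that define the colours.
tapeT : ∀ {b} → ℕ → Tm 3 b
tapeT q = digitT 9 8 4 $$ (v2 ∷ lit 1 ⊞ (mulT 3 $$ (lit q ∷ []) ⊞ (mulT 2 $$ (v0 ∷ []) ⊞ v1)) ∷ [])

-- The outer digit reads a vertex number in base 2, with n bounding its quotients. The inner one
-- fetches the bit position from the first r² entries of the tape, the group q = 0.
colT : ∀ {b} → Tm 2 b
colT = fold 3 (lit 0) ((v1 ⊞ v1) ⊞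
  digitT 1 5 6 $$ (v2 ∷ digitT 9 8 4 $$ (v3 ∷ lit 1 ⊞ v0 ∷ []) ∷ []))

-- One more than the capacity acts as infinity: loads above the capacity need not be told apart, and
-- adding demands never brings them back below.
capT infT : ∀ {m b} → Tm m b
capT = inp (lit 3)
infT = lit 1 ⊞ capT

rowT : ∀ {b} → ℕ → Tm 2 b
rowT q = fold 2 (lit 0) (v1 ⊞ tapeT q $$ (v2 ∷ v0 ∷ v3 ∷ []))

totalT countT : ∀ {b} → ℕ → Tm 1 b
totalT q = fold 2 (lit 0) (v1 ⊞ rowT q $$ (v0 ∷ v2 ∷ []))
countT k = fold 2 (lit 0) (v1 ⊞
  fold 2 (lit 0) (v1 ⊞ eqT $$ (tapeT 2 $$ (v2 ∷ v0 ∷ v4 ∷ []) ∷ lit k ∷ [])))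

usedT : ∀ {b} → Tm 1 b
usedT = fold 2 (lit 0) (v1 ⊞ ite (rowT 2 $$ (v0 ∷ v2 ∷ [])) (lit 1) (lit 0))

v5 : ∀ {m b} → Tm (6 + m) b
v5 = var (suc (suc (suc (suc (suc zero)))))

apartT : ∀ {b} → Tm 5 b
apartT = ite (tapeT 2 $$ (v0 ∷ v1 ∷ v4 ∷ [])) (ite (tapeT 2 $$ (v2 ∷ v3 ∷ v4 ∷ []))
  (ite (eqT $$ (tapeT 3 $$ (v0 ∷ v1 ∷ v4 ∷ []) ∷ tapeT 3 $$ (v2 ∷ v3 ∷ v4 ∷ []) ∷ []))
    (ite (eqT $$ (v0 ∷ v2 ∷ [])) (eqT $$ (v1 ∷ v3 ∷ [])) (lit 0)) (lit 1)) (lit 1)) (lit 1)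

apart₁T : ∀ {b} → Tm 4 b
apart₁T = fold 2 (lit 1) (ite (apartT $$ (v2 ∷ v3 ∷ v4 ∷ v0 ∷ v5 ∷ [])) v1 (lit 0))
apart₂T : ∀ {b} → Tm 3 b
apart₂T = fold 2 (lit 1) (ite (apart₁T $$ (v2 ∷ v3 ∷ v0 ∷ v4 ∷ [])) v1 (lit 0))
apart₃T : ∀ {b} → Tm 2 b
apart₃T = fold 2 (lit 1) (ite (apart₂T $$ (v2 ∷ v0 ∷ v3 ∷ [])) v1 (lit 0))
distinctT : ∀ {b} → Tm 1 b
distinctT = fold 2 (lit 1) (ite (apart₃T $$ (v0 ∷ v2 ∷ [])) v1 (lit 0))

module Terms (off ga : ℕ) where

  depT cliT demT : ∀ {b} → Tm 1 b
  depT = inp (lit off ⊞ v0)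
  cliT = inp (lit off ⊞ (par 1 ⊞ v0))
  demT = inp (lit off ⊞ (par 1 ⊞ (par 1 ⊞ v0)))

  adjT wgtT : ∀ {b} → Tm 2 b
  adjT = inp (lit off ⊞ (par 1 ⊞ (par 1 ⊞ (par 1 ⊞ (mulT 1 $$ (v0 ∷ []) ⊞ v1)))))
  wgtT = inp (lit off ⊞ (par 1 ⊞ (par 1 ⊞ (par 1 ⊞
           (mulT 1 $$ (par 1 ∷ []) ⊞ (mulT 1 $$ (v0 ∷ []) ⊞ v1))))))

  initT : ∀ {b} → Tm 2 b
  initT = ite (eqT $$ (v0 ∷ v1 ∷ [])) (ite (depT $$ (v0 ∷ [])) (lit 0) infT) infT

  -- The least load with which vertex v0 is reached by a step of weight v1.
  moveT : Tm 2 true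
  moveT = ite v1
    (fold 1 infT (ite (ite (adjT $$ (v0 ∷ v2 ∷ [])) (eqT $$ (wgtT $$ (v0 ∷ v2 ∷ []) ∷ v3 ∷ [])) (lit 0))
                      (ite (v1 ⊟ arr v0) (arr v0) v1) v1))
    (arr v0)

  -- The variables are the vertex, the weight, type and colour that the tape gives for the step, and
  -- the colour of the vertex itself.
  serveT : Tm 5 true
  serveT = ite v2
    (ite (cliT $$ (v0 ∷ [])) (ite (eqT $$ (v4 ∷ v3 ∷ [])) (ite (eqT $$ (v2 ∷ lit 1 ⊞ depT $$ (v0 ∷ []) ∷ []))
      (moveT $$ (v0 ∷ v1 ∷ []) ⊞ demT $$ (v0 ∷ [])) infT) infT) infT)
    (moveT $$ (v0 ∷ v1 ∷ []))

  stepT : Tm 4 true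
  stepT = serveT $$ (v0 ∷ tapeT 1 $$ (v2 ∷ v1 ∷ v3 ∷ []) ∷ tapeT 2 $$ (v2 ∷ v1 ∷ v3 ∷ []) ∷
                     tapeT 3 $$ (v2 ∷ v1 ∷ v3 ∷ []) ∷ colT $$ (v0 ∷ v3 ∷ []) ∷ [])

  -- The variables are the start, the vehicle and the tape. Reading the final array at the start
  -- itself forces the walk to be closed, which is why each start has its own dynamic program.
  loadT : Tm 3 false
  loadT = dp 2 (initT $$ (v0 ∷ v1 ∷ [])) (stepT $$ (v0 ∷ v1 ∷ v3 ∷ v4 ∷ [])) v0

  routeT : Tm 2 false
  routeT = fold 1 (lit 0) (v1 ⊞ leT $$ (loadT $$ (v0 ∷ v2 ∷ v3 ∷ []) ∷ capT ∷ []))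

  nondepotsT depotsT demandsT : ∀ {b} → Tm 0 b
  nondepotsT = fold 1 (lit 0) (v1 ⊞ ite (cliT $$ (v0 ∷ [])) (ite (depT $$ (v0 ∷ [])) (lit 0) (lit 1)) (lit 0))
  depotsT = fold 1 (lit 0) (v1 ⊞ ite (cliT $$ (v0 ∷ [])) (depT $$ (v0 ∷ [])) (lit 0))
  demandsT = fold 1 (lit 1) (ite (leT $$ (demT $$ (v0 ∷ []) ∷ capT ∷ [])) v1 (lit 0))

  gasT : ∀ {b} → Tm 1 b
  gasT = fold 2 (lit 1) (ite (leT $$ (rowT 1 $$ (v0 ∷ v2 ∷ []) ∷ inp (lit ga) ∷ [])) v1 (lit 0))

  routesT acceptT : Tm 1 false
  routesT = fold 2 (lit 1) (ite (routeT $$ (v0 ∷ v2 ∷ [])) v1 (lit 0))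
  acceptT =
    ite (leT $$ (totalT 1 $$ (v0 ∷ []) ∷ par 2 ∷ []))
    (ite (gasT $$ (v0 ∷ []))
    (ite (distinctT $$ (v0 ∷ []))
    (ite (routesT $$ (v0 ∷ []))
    (ite (leT $$ (nondepotsT $$ [] ∷ countT 1 $$ (v0 ∷ []) ∷ []))
    (ite (leT $$ (usedT $$ (v0 ∷ []) ⊞ depotsT $$ [] ∷ inp (lit 2) ⊞ countT 2 $$ (v0 ∷ []) ∷ []))
    (demandsT $$ []) (lit 0)) (lit 0)) (lit 0)) (lit 0)) (lit 0)) (lit 0)

  setup : Script
  setup =
    (1 , inp (lit 0)) ∷
    (2 , inp (lit 1)) ∷
    (3 , mulT 2 $$ (par 2 ∷ [])) ∷
    (4 , lit 2 ⊞ ((par 3 ⊞ par 3) ⊞ (par 3 ⊞ par 3))) ∷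
    (5 , lit 2) ∷
    -- The inner loop computes 2 ^ e by guarded doubling, and the outer one raises e as long as 2 ^
    -- e < n. The added 1 leaves a bit position even for n = 1.
    (6 , lit 1 ⊞ fold 1 (lit 0) (ite (par 1 ⊟ fold 1 (lit 1) (ite (v3 ⊟ v0) (v1 ⊞ v1) v1)) (v1 ⊞ lit 1) v1)) ∷
    (7 , fold 4 (lit 1) (v1 ⊞ v1)) ∷
    -- The base must exceed the bit positions, bounded by the logarithm, as well as weights, types
    -- and colours, all below 2 ^ `digits r`. A product exceeds both, and its powers factor into a
    -- part from n and a part from r.
    (8 , mulT 6 $$ (par 7 ∷ [])) ∷
    (9 , fold 4 (lit 1) (mulT 8 $$ (v1 ∷ []))) ∷
    []

  someAcceptedT resultT : Tm 0 false
  someAcceptedT = fold 9 (lit 0) (v1 ⊞ acceptT $$ (v0 ∷ []))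
  resultT = ite someAcceptedT (lit 1) (lit 0)

  script : Script
  script = setup ++ (0 , resultT) ∷ []

-- What the terms compute

fold-∑ : ∀ {N r} → N ≡ r → ∀ (f : ℕ → ℕ) → foldℕ N 0 (λ i a → a + f i) ≡ ∑ {r} (f ∘ toℕ)
fold-∑ {zero}  refl f = refl
fold-∑ {suc N} refl f = trans (last N f) (cong (f 0 +_) (fold-∑ {N} refl (f ∘ suc)))
  where
  last : ∀ N f → foldℕ (suc N) 0 (λ i a → a + f i) ≡ f 0 + foldℕ N 0 (λ i a → a + f (suc i))
  last zero    f = sym (+-identityʳ (f 0))
  last (suc N) f = trans (cong (_+ f (suc N)) (last N f)) (+-assoc (f 0) _ _)

fold-all : ∀ {N r} → N ≡ r → ∀ (f : ℕ → ℕ) →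
           foldℕ N 1 (λ i a → cond (f i) a 0) ≢ 0 ⇔ (∀ (i : Fin r) → f (toℕ i) ≢ 0)
fold-all {N} refl f = mk⇔ (λ h i → forth N h (Fin.toℕ<n i))
  (λ h → back N (λ {i} i<N → subst (λ j → f j ≢ 0) (Fin.toℕ-fromℕ< i<N) (h (fromℕ< i<N))))
  where
  forth : ∀ N → foldℕ N 1 (λ i a → cond (f i) a 0) ≢ 0 → ∀ {i} → i < N → f i ≢ 0
  forth (suc N) h {i} i<1+N with f N in eq
  ... | zero  = contradiction refl h
  ... | suc _ with m≤n⇒m<n∨m≡n (s≤s⁻¹ i<1+N)
  ...   | inj₁ i<N  = forth N h i<N
  ...   | inj₂ refl = λ e → contradiction (trans (sym eq) e) λ ()
  back : ∀ N → (∀ {i} → i < N → f i ≢ 0) → foldℕ N 1 (λ i a → cond (f i) a 0) ≢ 0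
  back zero    h = λ ()
  back (suc N) h = subst (_≢ 0) (sym (cond-true (h (n<1+n N)))) (back N (h ∘ m<n⇒m<1+n))

fold-any : ∀ {N r} → N ≡ r → ∀ (f : ℕ → ℕ) →
           foldℕ N 0 (λ i a → a + f i) ≢ 0 ⇔ (∃[ i ] f (toℕ {r} i) ≢ 0)
fold-any {N} {r} N≡r f = mk⇔ forth back
  where
  forth : foldℕ N 0 (λ i a → a + f i) ≢ 0 → ∃[ i ] f (toℕ {r} i) ≢ 0
  forth h with Fin.any? (λ (i : Fin r) → ¬? (f (toℕ i) ≟ 0))
  ... | yes p = p
  ... | no ¬p = contradiction (trans (fold-∑ N≡r f)
    (∑≡0 {r} _ (λ i → decidable-stable (f (toℕ i) ≟ 0) (λ h → ¬p (i , h))))) h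
  back : ∃[ i ] f (toℕ {r} i) ≢ 0 → foldℕ N 0 (λ i a → a + f i) ≢ 0
  back (i , h) e = h (n≤0⇒n≡0 (subst (f (toℕ i) ≤_) (trans (sym (fold-∑ N≡r f)) e) (∑-≤ (f ∘ toℕ) i)))

le-⇔ : ∀ a b → cond (a ∸ b) 0 1 ≢ 0 ⇔ a ≤ b
le-⇔ a b = mk⇔ forth (λ a≤b → subst (λ x → cond x 0 1 ≢ 0) (sym (m≤n⇒m∸n≡0 a≤b)) λ ())
  where
  forth : cond (a ∸ b) 0 1 ≢ 0 → a ≤ b
  forth h with a ∸ b in eq
  ... | zero  = m∸n≡0⇒m≤n eq
  ... | suc _ = contradiction refl h

and-⇔ : ∀ a {b} → cond a b 0 ≢ 0 ⇔ (a ≢ 0 × b ≢ 0)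
and-⇔ zero    = mk⇔ (λ h → contradiction refl h) (λ h → contradiction refl (proj₁ h))
and-⇔ (suc _) = mk⇔ (λ h → (λ ()) , h) proj₂

δ-⇔ : ∀ a b → δ a b ≢ 0 ⇔ a ≡ b
δ-⇔ a b = mk⇔ (δ-≢0 a b) (λ { refl e → contradiction (trans (sym (δ-refl a)) e) λ () })

-- The minimum is described by the thresholds x that it meets. Restricted to thresholds within the
-- capacity, this form says all that is needed of a table in which larger loads are not exact.
fold-min : ∀ N d (e b : ℕ → ℕ) x →
  foldℕ N d (λ u a → cond (e u) (cond (a ∸ b u) (b u) a) a) ≤ x ⇔
  (d ≤ x ⊎ ∃[ u ] u < N × e u ≢ 0 × b u ≤ x)
fold-min zero    d e b x = mk⇔ inj₁ λ { (inj₁ d≤x) → d≤x ; (inj₂ (_ , () , _)) }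
fold-min (suc N) d e b x = mk⇔ forth back
  where
  m : ℕ
  m = foldℕ N d (λ u a → cond (e u) (cond (a ∸ b u) (b u) a) a)
  ih = fold-min N d e b x
  widen : (d ≤ x ⊎ ∃[ u ] u < N × e u ≢ 0 × b u ≤ x) → (d ≤ x ⊎ ∃[ u ] u < suc N × e u ≢ 0 × b u ≤ x)
  widen (inj₁ p) = inj₁ p
  widen (inj₂ (u , u< , q)) = inj₂ (u , m<n⇒m<1+n u< , q)
  forth : cond (e N) (cond (m ∸ b N) (b N) m) m ≤ x → (d ≤ x ⊎ ∃[ u ] u < suc N × e u ≢ 0 × b u ≤ x)
  forth le with e N in eq
  ... | zero  = widen (to ih le)
  ... | suc _ with m ∸ b N
  ...   | zero  = widen (to ih le)
  ...   | suc _ = inj₂ (N , n<1+n N , (λ z → contradiction (trans (sym eq) z) λ ()) , le)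
  min≤ : ∀ a b → cond (a ∸ b) b a ≤ a × cond (a ∸ b) b a ≤ b
  min≤ a b with a ∸ b in eq
  ... | zero  = ≤-refl , m∸n≡0⇒m≤n eq
  ... | suc _ = <⇒≤ (≰⇒> λ a≤b → contradiction (trans (sym eq) (m≤n⇒m∸n≡0 a≤b)) λ ()) , ≤-refl
  old : m ≤ x → cond (e N) (cond (m ∸ b N) (b N) m) m ≤ x
  old le with e N
  ... | zero  = le
  ... | suc _ = ≤-trans (proj₁ (min≤ m (b N))) le
  new : e N ≢ 0 → b N ≤ x → cond (e N) (cond (m ∸ b N) (b N) m) m ≤ x
  new h le with e N
  ... | zero  = contradiction refl h
  ... | suc _ = ≤-trans (proj₂ (min≤ m (b N))) le
  back : (d ≤ x ⊎ ∃[ u ] u < suc N × e u ≢ 0 × b u ≤ x) → cond (e N) (cond (m ∸ b N) (b N) m) m ≤ x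
  back (inj₁ p) = old (from ih (inj₁ p))
  back (inj₂ (u , u<1+N , q)) with m≤n⇒m<n∨m≡n (s≤s⁻¹ u<1+N)
  ... | inj₁ u<N  = old (from ih (inj₂ (u , u<N , q)))
  ... | inj₂ refl = new (proj₁ q) (proj₂ q)

module Arithmetic (J P : ℕ → ℕ) where

  mul-sem : ∀ {b} p A x → ⟦_⟧ J P {b = b} (mulT p) A (x ∷ []) ≡ P p * x
  mul-sem p A x = foldℕ-* (P p) x

  quot-sem : ∀ {b} N p A y → ⟦_⟧ J P {b = b} (quotT N p) A (y ∷ []) ≡ quot (P N) (P p) y
  quot-sem {b} N p A y = foldℕ-cong (P N) refl
    (λ {i} a _ → cong (λ x → a + cond (x ∸ y) 0 1) (mul-sem {b} p A (i + 1)))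

  rem-sem : ∀ {b} N p A y → ⟦_⟧ J P {b = b} (remT N p) A (y ∷ []) ≡ rem (P N) (P p) y
  rem-sem {b} N p A y = cong (y ∸_) (trans (mul-sem {b} p A _) (cong (P p *_) (quot-sem {b} N p A y)))

  digit-sem : ∀ {b} N p K A y j → ⟦_⟧ J P {b = b} (digitT N p K) A (y ∷ j ∷ []) ≡ digit (P N) (P p) (P K) y j
  digit-sem {b} N p K A y j = trans (rem-sem {b} N p A _) (cong (rem (P N) (P p))
    (foldℕ-cong (P K) refl (λ {i} a _ → cong (λ x → cond (j ∸ i) x a) (quot-sem {b} N p A a))))

module Meaning {off ga : ℕ} {J P : ℕ → ℕ} {n} {I : LoadGasCVRP n} {r} (enc : Encodes off ga J I r)
  (P1 : P 1 ≡ n) (P2 : P 2 ≡ r) (P3 : P 3 ≡ r * r) where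
  open LoadGasCVRP I
  open Spec I r
  open Encodes enc
  open Terms off ga
  open Arithmetic J P

  sem : ∀ {m b} → Tm m b → (ℕ → ℕ) → Vec ℕ m → ℕ
  sem = ⟦_⟧ J P

  tape : ℕ → ℕ → ℕ → ℕ → ℕ
  tape x q i t = digit (P 9) (P 8) (P 4) x (1 + (r * r * q + (r * i + t)))

  hash : ℕ → ℕ → ℕ
  hash x p = digit (P 9) (P 8) (P 4) x (1 + p)

  bits : ℕ → ℕ → ℕ
  bits = digit (P 1) (P 5) (P 6)

  col : ℕ → ℕ → ℕ
  col x v = colour (bits v) (hash x) (r * r)

  tape-sem : ∀ {b} q A i t x → sem {b = b} (tapeT q) A (i ∷ t ∷ x ∷ []) ≡ tape x q i t
  tape-sem {b} q A i t x = trans (digit-sem {b} 9 8 4 A x _) (cong (λ y → digit (P 9) (P 8) (P 4) x (1 + y))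
    (cong₂ _+_ (trans (mul-sem {b} 3 A q) (cong (_* q) P3)) (cong (_+ t) (trans (mul-sem {b} 2 A i) (cong (_* i) P2)))))

  col-sem : ∀ {b} A v x → sem {b = b} colT A (v ∷ x ∷ []) ≡ col x v
  col-sem {b} A v x rewrite sym P3 = foldℕ-cong (P 3) refl
    (λ {p} a _ → cong (a + a +_) (trans (digit-sem {b} 1 5 6 A v _) (cong (bits v) (digit-sem {b} 9 8 4 A x (1 + p)))))

  wF tyF cF : ℕ → Fin r → Fin r → ℕ
  wF x i t = tape x 1 (toℕ i) (toℕ t)
  tyF x i t = tape x 2 (toℕ i) (toℕ t)
  cF x i t = tape x 3 (toℕ i) (toℕ t)

  row-sem : ∀ {b} q A (i : ℕ) x → sem {b = b} (rowT q) A (i ∷ x ∷ []) ≡ ∑ (λ t → tape x q i (toℕ {r} t))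
  row-sem {b} q A i x = trans (fold-∑ P2 _) (∑-cong {r} (λ t → tape-sem {b} q A i (toℕ t) x))

  total-sem : ∀ {b} A x → sem {b = b} (totalT 1) A (x ∷ []) ≡ ∑ (λ i → ∑ (wF x i))
  total-sem {b} A x = trans (fold-∑ P2 _) (∑-cong {r} (λ i → row-sem {b} 1 A (toℕ i) x))

  count-sem : ∀ {b} k A x → sem {b = b} (countT k) A (x ∷ []) ≡ ∑ (λ i → ∑ (λ t → δ (tyF x i t) k))
  count-sem {b} k A x = trans (fold-∑ P2 _) (∑-cong {r} (λ i → trans (fold-∑ P2 _)
    (∑-cong {r} (λ t → cong (λ y → δ y k) (tape-sem {b} 2 A (toℕ i) (toℕ t) x)))))

  used-sem : ∀ {b} A x → sem {b = b} usedT A (x ∷ []) ≡ ∑ (λ i → cond (∑ (tyF x i)) 1 0)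
  used-sem {b} A x = trans (fold-∑ P2 _) (∑-cong {r} (λ i → cong (λ y → cond y 1 0) (row-sem {b} 2 A (toℕ i) x)))

  dep-sem : ∀ {b} A v → sem {b = b} depT A (toℕ v ∷ []) ≡ dep v
  dep-sem A v = depotAt v

  cli-sem : ∀ {b} A v → sem {b = b} cliT A (toℕ v ∷ []) ≡ cli v
  cli-sem A v = trans (cong (λ m → J (off + (m + toℕ v))) P1) (clientAt v)

  dem-sem : ∀ {b} A v → sem {b = b} demT A (toℕ v ∷ []) ≡ dem v
  dem-sem A v = trans (cong (λ m → J (off + (m + (m + toℕ v)))) P1) (demandAt v)

  adj-sem : ∀ {b} A u v → sem {b = b} adjT A (toℕ u ∷ toℕ v ∷ []) ≡ bit (adjacent u v)
  adj-sem {b} A u v = trans (cong₂ (λ m k → J (off + (m + (m + (m + (k + toℕ v)))))) P1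
    (trans (mul-sem {b} 1 A (toℕ u)) (cong (_* toℕ u) P1))) (edgeAt u v)

  wgt-sem : ∀ {b} A u v → sem {b = b} wgtT A (toℕ u ∷ toℕ v ∷ []) ≡ orZero (T? (adjacent u v)) (weight u v)
  wgt-sem {b} A u v = trans (cong₂ (λ m k → J (off + (m + (m + (m + k))))) P1
    (cong₂ (λ k l → k + (l + toℕ v)) (trans (mul-sem {b} 1 A (P 1)) (cong₂ _*_ P1 P1))
           (trans (mul-sem {b} 1 A (toℕ u)) (cong (_* toℕ u) P1)))) (weightAt u v)

  distinct-sem : ∀ {b} A x → sem {b = b} distinctT A (x ∷ []) ≢ 0 ⇔
    (∀ i t j s → tyF x i t ≢ 0 → tyF x j s ≢ 0 → cF x i t ≡ cF x j s → i ≡ j × t ≡ s)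
  distinct-sem {b} A x = mk⇔
    (λ h i t j s → to (apart i t j s)
      (to (fold-all P2 _) (to (fold-all P2 _) (to (fold-all P2 _) (to (fold-all P2 _) h i) t) j) s))
    (λ h → from (fold-all P2 _) λ i → from (fold-all P2 _) λ t → from (fold-all P2 _) λ j →
           from (fold-all P2 _) λ s → from (apart i t j s) (h i t j s))
    where
    apart : ∀ (i t j s : Fin r) → sem {b = b} apartT A (toℕ i ∷ toℕ t ∷ toℕ j ∷ toℕ s ∷ x ∷ []) ≢ 0 ⇔
      (tyF x i t ≢ 0 → tyF x j s ≢ 0 → cF x i t ≡ cF x j s → i ≡ j × t ≡ s)
    apart i t j s
      rewrite tape-sem {b} 2 A (toℕ i) (toℕ t) x | tape-sem {b} 2 A (toℕ j) (toℕ s) x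
            | tape-sem {b} 3 A (toℕ i) (toℕ t) x | tape-sem {b} 3 A (toℕ j) (toℕ s) x
      = go (tyF x i t) (tyF x j s) (cF x i t) (cF x j s)
      where
      same : (δ (toℕ i) (toℕ j) ≢ 0 × δ (toℕ t) (toℕ s) ≢ 0) ⇔ (i ≡ j × t ≡ s)
      same = mk⇔ (λ (p , q) → Fin.toℕ-injective (δ-≢0 _ _ p) , Fin.toℕ-injective (δ-≢0 _ _ q))
        λ { (refl , refl) → from (δ-⇔ (toℕ i) (toℕ i)) refl , from (δ-⇔ (toℕ t) (toℕ t)) refl }
      go : ∀ a b c d →
        cond a (cond b (cond (δ c d) (cond (δ (toℕ i) (toℕ j)) (δ (toℕ t) (toℕ s)) 0) 1) 1) 1 ≢ 0 ⇔
        (a ≢ 0 → b ≢ 0 → c ≡ d → i ≡ j × t ≡ s)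
      go zero    b       c d = mk⇔ (λ _ a≢0 → contradiction refl a≢0) (λ _ ())
      go (suc _) zero    c d = mk⇔ (λ _ _ b≢0 → contradiction refl b≢0) (λ _ ())
      go (suc _) (suc _) c d with δ c d in eq
      ... | zero  = mk⇔ (λ _ _ _ c≡d → contradiction eq (from (δ-⇔ c d) c≡d)) (λ _ ())
      ... | suc _ = mk⇔ (λ h _ _ _ → to same (to (and-⇔ _) h))
                        (λ h → from (and-⇔ _) (from same (h (λ ()) (λ ())
                           (δ-≢0 c d (λ z → contradiction (trans (sym eq) z) λ ())))))

  gas-sem : ∀ {b} A x → sem {b = b} gasT A (x ∷ []) ≢ 0 ⇔ (∀ i → ∑ (wF x i) ≤ gasCapacity)
  gas-sem {b} A x = mk⇔
    (λ h i → subst₂ _≤_ (row-sem {b} 1 A (toℕ i) x) gas (to (le-⇔ _ _) (to (fold-all P2 _) h i)))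
    (λ h → from (fold-all P2 _) λ i → from (le-⇔ _ _)
       (subst₂ _≤_ (sym (row-sem {b} 1 A (toℕ i) x)) (sym gas) (h i)))

  demands-sem : ∀ {b} A → sem {b = b} demandsT A [] ≢ 0 ⇔ (∀ v → dem v ≤ loadCapacity)
  demands-sem {b} A = mk⇔
    (λ h v → subst₂ _≤_ (dem-sem {b} A v) capacity (to (le-⇔ _ _) (to (fold-all P1 _) h v)))
    (λ h → from (fold-all P1 _) λ v → from (le-⇔ _ _) (subst₂ _≤_ (sym (dem-sem {b} A v)) (sym capacity) (h v)))

  nondepots-sem : ∀ {b} A → sem {b = b} nondepotsT A [] ≡ ∑ nondepotClient
  nondepots-sem {b} A = trans (fold-∑ P1 _)
    (∑-cong {n} (λ v → cong₂ (λ c d → cond c (cond d 0 1) 0) (cli-sem {b} A v) (dep-sem {b} A v)))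

  depots-sem : ∀ {b} A → sem {b = b} depotsT A [] ≡ ∑ depotClient
  depots-sem {b} A = trans (fold-∑ P1 _)
    (∑-cong {n} (λ v → cong₂ (λ c d → cond c d 0) (cli-sem {b} A v) (dep-sem {b} A v)))

  -- Meaning of the dynamic program

  edgeTest : ℕ → ℕ → ℕ → (ℕ → ℕ) → ℕ
  edgeTest u v w B = cond (sem {b = true} adjT B (u ∷ v ∷ [])) (δ (sem {b = true} wgtT B (u ∷ v ∷ [])) w) 0

  edge-sem : ∀ B u v w → edgeTest (toℕ u) (toℕ v) w B ≢ 0 ⇔ (Σ (Adj u v) λ e → weight u v e ≡ w)
  edge-sem B u v w rewrite adj-sem {true} B u v | wgt-sem {true} B u v = go (T? (adjacent u v)) refl
    where
    go : (d : Dec (T (adjacent u v))) → d ≡ T? (adjacent u v) →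
         cond (bit (adjacent u v)) (δ (orZero (T? (adjacent u v)) (weight u v)) w) 0 ≢ 0 ⇔
         (Σ (Adj u v) λ e → weight u v e ≡ w)
    go (yes e) _ = mk⇔
      (λ h → e , trans (sym (orZero-yes (T? (adjacent u v)) (weight u v) e))
                       (δ-≢0 _ w (proj₂ (to (and-⇔ (bit (adjacent u v))) h))))
      (λ { (e′ , eq) → from (and-⇔ (bit (adjacent u v)))
             (bit-T e , from (δ-⇔ _ w) (trans (orZero-yes (T? (adjacent u v)) (weight u v) e) eq)) })
      where
      bit-T : ∀ {c} → T c → bit c ≢ 0
      bit-T {true} _ = λ ()
    go (no ¬e) _ = mk⇔ (λ h → contradiction (T-bit (proj₁ (to (and-⇔ (bit (adjacent u v))) h))) ¬e)
                       (λ { (e , _) → contradiction e ¬e })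
      where
      T-bit : ∀ {c} → bit c ≢ 0 → T c
      T-bit {true}  _ = _
      T-bit {false} h = contradiction refl h

  clip-< : ∀ B (v : Fin n) → clip (J 0) B (toℕ v) ≡ B (toℕ v)
  clip-< B v = cond-true (m>n⇒m∸n≢0 (subst (toℕ v <_) (sym size) (Fin.toℕ<n v)))

  cap≡ : J 3 ≡ loadCapacity
  cap≡ = capacity

  inf≰ : ∀ {x} → x ≤ loadCapacity → ¬ (suc (J 3) ≤ x)
  inf≰ x≤ le = <⇒≱ (subst (_< _) cap≡ le) x≤

  -- The bound on x rules out the default value of the minimum, which exceeds the capacity by one;
  -- so a real predecessor must be responsible.
  move-sem : ∀ B (v : Fin n) w {x} → x ≤ loadCapacity →
             sem moveT B (toℕ v ∷ w ∷ []) ≤ x ⇔ (∃[ u ] Step w u v × B (toℕ u) ≤ x)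
  move-sem B v zero x≤ = mk⇔
    (λ le → v , inj₁ (refl , refl) , subst (_≤ _) (clip-< B v) le)
    (λ { (u , inj₁ (_ , refl) , le) → subst (_≤ _) (sym (clip-< B v)) le
       ; (u , inj₂ (h , _) , _) → contradiction refl h })
  move-sem B v w@(suc _) {x} x≤ = mk⇔ forth back
    where
    least = fold-min (P 1) (suc (J 3)) (λ u → edgeTest u (toℕ v) w B) (λ u → clip (J 0) B u) x
    forth : sem moveT B (toℕ v ∷ w ∷ []) ≤ x → ∃[ u ] Step w u v × B (toℕ u) ≤ x
    forth le with to least le
    ... | inj₁ inf≤ = contradiction inf≤ (inf≰ x≤)
    ... | inj₂ (u , u<n , h , le′) = u′ ,
      inj₂ ((λ ()) , to (edge-sem B u′ v w) (subst (λ a → edgeTest a (toℕ v) w B ≢ 0) (sym u′≡) h)) ,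
      subst (_≤ x) (clip-< B u′) (subst (λ a → clip (J 0) B a ≤ x) (sym u′≡) le′)
      where
      u<n′ : u < n
      u<n′ = subst (u <_) P1 u<n
      u′ : Fin n
      u′ = fromℕ< u<n′
      u′≡ : toℕ u′ ≡ u
      u′≡ = Fin.toℕ-fromℕ< u<n′
    back : ∃[ u ] Step w u v × B (toℕ u) ≤ x → sem moveT B (toℕ v ∷ w ∷ []) ≤ x
    back (u , inj₂ (_ , edge) , le) = from least (inj₂ (toℕ u , subst (toℕ u <_) (sym P1) (Fin.toℕ<n u) ,
      from (edge-sem B u v w) edge , subst (_≤ x) (sym (clip-< B u)) le))

  module _ (col : Fin n → ℕ) where

    serve-sem : ∀ B v w ty c {x} → x ≤ loadCapacity →
      sem serveT B (toℕ v ∷ w ∷ ty ∷ c ∷ col v ∷ []) ≤ x ⇔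
      (Serve col ty c v × sem moveT B (toℕ v ∷ w ∷ []) + cond ty (dem v) 0 ≤ x)
    serve-sem B v w zero c {x} x≤ = mk⇔
      (λ le → (λ h → contradiction refl h) , subst (_≤ x) (sym (+-identityʳ _)) le)
      (λ (_ , le) → subst (_≤ x) (+-identityʳ _) le)
    serve-sem B v w ty@(suc _) c {x} x≤
      rewrite cli-sem {true} B v | dep-sem {true} B v | dem-sem {true} B v = mk⇔ forth back
      where
      M = sem moveT B (toℕ v ∷ w ∷ []) + dem v
      inf = suc (J 3)
      forth : cond (cli v) (cond (δ (col v) c) (cond (δ ty (suc (dep v))) M inf) inf) inf ≤ x →
              Serve col ty c v × M ≤ x
      forth le with cli v in eq₁
      ... | zero = contradiction le (inf≰ x≤)
      ... | suc _ with δ (col v) c in eq₂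
      ...   | zero = contradiction le (inf≰ x≤)
      ...   | suc _ with δ ty (suc (dep v)) in eq₃
      ...     | zero = contradiction le (inf≰ x≤)
      ...     | suc _ = (λ _ → (λ ()) , δ-≢0 (col v) c (λ z → contradiction (trans (sym eq₂) z) λ ()) ,
                           δ-≢0 ty (suc (dep v)) (λ z → contradiction (trans (sym eq₃) z) λ ())) , le
      back : Serve col ty c v × M ≤ x →
             cond (cli v) (cond (δ (col v) c) (cond (δ ty (suc (dep v))) M inf) inf) inf ≤ x
      back (serve , le) with serve (λ ())
      ... | client , colour , type = subst (_≤ x) (sym (trans (cond-true client)
        (trans (cond-true (from (δ-⇔ (col v) c) colour)) (cond-true (from (δ-⇔ ty (suc (dep v))) type))))) le

  colF : ℕ → Fin n → ℕ
  colF x v = col x (toℕ v)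

  module Journeys (x : ℕ) (i : Fin r) (s : Fin n) where
    W Ty C : ℕ → ℕ
    W = tape x 1 (toℕ i)
    Ty = tape x 2 (toℕ i)
    C = tape x 3 (toℕ i)

    η : Vec ℕ 3
    η = toℕ s ∷ toℕ i ∷ x ∷ []

    loads : ℕ → ℕ → ℕ
    loads k = foldℕ k (λ a → sem {b = true} initT (λ _ → 0) (a ∷ toℕ s ∷ []))
                      (λ t B a → sem stepT B (a ∷ t ∷ toℕ i ∷ x ∷ []))

    loads-step : ∀ k v {y} → y ≤ loadCapacity → loads (suc k) (toℕ v) ≤ y ⇔
      (Serve (colF x) (Ty k) (C k) v ×
       sem moveT (loads k) (toℕ v ∷ W k ∷ []) + cond (Ty k) (dem v) 0 ≤ y)
    loads-step k v y≤
      rewrite tape-sem {true} 1 (loads k) (toℕ i) k x | tape-sem {true} 2 (loads k) (toℕ i) k x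
            | tape-sem {true} 3 (loads k) (toℕ i) k x | col-sem {true} (loads k) (toℕ v) x
      = serve-sem (colF x) (loads k) v (W k) (Ty k) (C k) y≤

    loads-start : ∀ v {y} → y ≤ loadCapacity → loads 0 (toℕ v) ≤ y ⇔ (v ≡ s × s ∈ depots)
    loads-start v {y} y≤ rewrite dep-sem {true} (λ _ → 0) v = mk⇔ forth back
      where
      inf = suc (J 3)
      forth : cond (δ (toℕ v) (toℕ s)) (cond (dep v) 0 inf) inf ≤ y → v ≡ s × s ∈ depots
      forth le with δ (toℕ v) (toℕ s) in eq
      ... | zero = contradiction le (inf≰ y≤)
      ... | suc _ with Fin.toℕ-injective (δ-≢0 (toℕ v) (toℕ s) (λ z → contradiction (trans (sym eq) z) λ ()))
      ...   | refl with v ∈? depots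
      ...     | yes v∈D = refl , v∈D
      ...     | no _    = contradiction le (inf≰ y≤)
      back : v ≡ s × s ∈ depots → cond (δ (toℕ v) (toℕ s)) (cond (dep v) 0 inf) inf ≤ y
      back (refl , v∈D) = subst (_≤ y) (sym (trans (cong (λ d → cond d (cond (dep v) 0 inf) inf) (δ-refl (toℕ v)))
        (cong (λ d → cond d 0 inf) (bit-yes (v ∈? depots) v∈D)))) z≤n

    carry : (ℕ → Fin n) → ℕ → ℕ
    carry at k = foldℕ k 0 (λ t a → a + cond (Ty t) (dem (at (suc t))) 0)

    carry-∑ : ∀ at → carry at r ≡ ∑ (λ t → cond (tyF x i t) (dem (at (suc (toℕ t)))) 0)
    carry-∑ at = fold-∑ {r} refl (λ t → cond (Ty t) (dem (at (suc t))) 0)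

    record Journey (k : ℕ) (v : Fin n) (y : ℕ) : Set where
      field
        at     : ℕ → Fin n
        begin  : at 0 ≡ s × s ∈ depots
        finish : at k ≡ v
        moves  : ∀ {t} → t < k → Step (W t) (at t) (at (suc t))
        serves : ∀ {t} → t < k → Serve (colF x) (Ty t) (C t) (at (suc t))
        carry≤ : carry at k ≤ y
    open Journey

    prolong : (ℕ → Fin n) → ℕ → Fin n → ℕ → Fin n
    prolong p k v t with t ≤? k
    ... | yes _ = p t
    ... | no  _ = v

    prolong-≤ : ∀ p {k v t} → t ≤ k → prolong p k v t ≡ p t
    prolong-≤ p {k} {v} {t} t≤k with t ≤? k
    ... | yes _ = refl
    ... | no ¬p = contradiction t≤k ¬p

    prolong-last : ∀ p {k v} → prolong p k v (suc k) ≡ v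
    prolong-last p {k} {v} with suc k ≤? k
    ... | yes le = contradiction le (<⇒≱ ≤-refl)
    ... | no _   = refl

    journey : ∀ k v {y} → y ≤ loadCapacity → loads k (toℕ v) ≤ y → Journey k v y
    journey zero v y≤ le with to (loads-start v y≤) le
    ... | refl , s∈D = record { at = λ _ → s ; begin = refl , s∈D ; finish = refl
                              ; moves = λ () ; serves = λ () ; carry≤ = z≤n }
    journey (suc k) v {y} y≤ le with to (loads-step k v y≤) le
    -- The threshold is the value of `moveT` itself: the journey up to time k carries at most this
    -- much, which leaves room for the demand served last.
    ... | serve , le′ with to (move-sem (loads k) v (W k) (≤-trans (m≤m+n _ _) (≤-trans le′ y≤))) ≤-refl
    ...   | u , step , le″ = record
      { at     = q
      ; begin  = trans (prolong-≤ p {k} {v} z≤n) (proj₁ (begin j)) , proj₂ (begin j)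
      ; finish = last
      ; moves  = λ {t} t<1+k → stepAt t (m≤n⇒m<n∨m≡n (s≤s⁻¹ t<1+k))
      ; serves = λ {t} t<1+k → serveAt t (m≤n⇒m<n∨m≡n (s≤s⁻¹ t<1+k))
      ; carry≤ = ≤-trans (+-mono-≤ (≤-trans (≤-reflexive same) (carry≤ j))
                   (≤-reflexive (cong (λ a → cond (Ty k) (dem a) 0) last))) le′ }
      where
      j : Journey k u (sem moveT (loads k) (toℕ v ∷ W k ∷ []))
      j = journey k u (≤-trans (m≤m+n _ _) (≤-trans le′ y≤)) le″
      p q : ℕ → Fin n
      p = at j
      q = prolong p k v
      last : q (suc k) ≡ v
      last = prolong-last p {k}
      same : carry q k ≡ carry p k
      same = foldℕ-cong k refl (λ {t} a t<k → cong (λ b → a + cond (Ty t) (dem b) 0) (prolong-≤ p t<k))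
      stepAt : ∀ t → t < k ⊎ t ≡ k → Step (W t) (q t) (q (suc t))
      stepAt t (inj₁ t<k)  = subst₂ (Step (W t)) (sym (prolong-≤ p (<⇒≤ t<k))) (sym (prolong-≤ p t<k)) (moves j t<k)
      stepAt t (inj₂ refl) = subst₂ (Step (W t)) (sym (trans (prolong-≤ p ≤-refl) (finish j))) (sym last) step
      serveAt : ∀ t → t < k ⊎ t ≡ k → Serve (colF x) (Ty t) (C t) (q (suc t))
      serveAt t (inj₁ t<k)  = subst (Serve (colF x) (Ty t) (C t)) (sym (prolong-≤ p t<k)) (serves j t<k)
      serveAt t (inj₂ refl) = subst (Serve (colF x) (Ty t) (C t)) (sym last) serve

    loads-journey : ∀ k {v y} → y ≤ loadCapacity → Journey k v y → loads k (toℕ v) ≤ y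
    loads-journey zero {v} y≤ j =
      from (loads-start v y≤) (trans (sym (finish j)) (proj₁ (begin j)) , proj₂ (begin j))
    loads-journey (suc k) {v} {y} y≤ j = subst (λ u → loads (suc k) (toℕ u) ≤ y) (finish j)
      (from (loads-step k (at j (suc k)) y≤) (serves j (n<1+n k) ,
      ≤-trans (+-monoˡ-≤ _ (from (move-sem (loads k) (at j (suc k)) (W k) c≤)
        (at j k , moves j (n<1+n k) , loads-journey k c≤ shorter))) (carry≤ j)))
      where
      c = carry (at j) k
      c≤ : c ≤ loadCapacity
      c≤ = ≤-trans (m≤m+n c _) (≤-trans (carry≤ j) y≤)
      shorter : Journey k (at j k) c
      shorter = record { at = at j ; begin = begin j ; finish = refl
        ; moves = λ t<k → moves j (m<n⇒m<1+n t<k) ; serves = λ t<k → serves j (m<n⇒m<1+n t<k)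
        ; carry≤ = ≤-refl }

    load-sem : ∀ A → sem loadT A η ≡ loads r (toℕ s)
    load-sem A = trans (clip-< (loads (P 2)) s) (cong (λ k → loads k (toℕ s)) P2)

  route-sem : ∀ A x (i : Fin r) → sem routeT A (toℕ i ∷ x ∷ []) ≢ 0 ⇔
              Route (wF x i) (tyF x i) (cF x i) (colF x)
  route-sem A x i = mk⇔ forth back
    where
    forth : sem routeT A (toℕ i ∷ x ∷ []) ≢ 0 → Route (wF x i) (tyF x i) (cF x i) (colF x)
    forth h with to (fold-any P1 _) h
    ... | s , h′ = record
      { at     = at
      ; start  = subst (_∈ depots) (sym (proj₁ begin)) (proj₂ begin)
      ; closed = trans finish (sym (proj₁ begin))
      ; steps  = λ t → moves (Fin.toℕ<n t)
      ; serves = λ t → serves (Fin.toℕ<n t)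
      ; load≤  = subst (_≤ loadCapacity) (carry-∑ at) carry≤ }
      where
      open Journeys x i s
      open Journey (journey r s ≤-refl (subst₂ _≤_ (load-sem A) cap≡ (to (le-⇔ _ _) h′)))
    back : Route (wF x i) (tyF x i) (cF x i) (colF x) → sem routeT A (toℕ i ∷ x ∷ []) ≢ 0
    back R = from (fold-any P1 _) (s , from (le-⇔ _ _) (subst₂ _≤_ (sym (load-sem A)) (sym cap≡)
      (loads-journey r ≤-refl (record
        { at = R.at ; begin = refl , R.start ; finish = R.closed
        ; moves  = λ t<r → subst (λ t → Step (W t) (R.at t) (R.at (suc t)))
                             (Fin.toℕ-fromℕ< t<r) (R.steps (fromℕ< t<r))
        ; serves = λ t<r → subst (λ t → Serve (colF x) (Ty t) (C t) (R.at (suc t)))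
                             (Fin.toℕ-fromℕ< t<r) (R.serves (fromℕ< t<r))
        ; carry≤ = subst (_≤ loadCapacity) (sym (carry-∑ R.at)) R.load≤ }))))
      where
      module R = Route {wF x i} {tyF x i} {cF x i} {colF x} R
      s = R.at 0
      open Journeys x i s

  accept-sem : ∀ A x → sem acceptT A (x ∷ []) ≢ 0 ⇔ Good (wF x) (tyF x) (cF x) (colF x)
  accept-sem A x
    = mk⇔ forth back
    where
    forth : sem acceptT A (x ∷ []) ≢ 0 → Good (wF x) (tyF x) (cF x) (colF x)
    forth h₀ with to (and-⇔ _) h₀
    ... | a₁ , h₁ with to (and-⇔ _) h₁
    ... | a₂ , h₂ with to (and-⇔ _) h₂
    ... | a₃ , h₃ with to (and-⇔ _) h₃
    ... | a₄ , h₄ with to (and-⇔ _) h₄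
    ... | a₅ , h₅ with to (and-⇔ _) h₅
    ... | a₆ , a₇ = record
      { weight≤   = subst₂ _≤_ (total-sem {false} A x) P2 (to (le-⇔ _ _) a₁)
      ; gas≤      = to (gas-sem {false} A x) a₂
      ; distinct  = to (distinct-sem {false} A x) a₃
      ; route     = λ i → to (route-sem A x i) (to (fold-all P2 (λ i → sem routeT A (i ∷ x ∷ []))) a₄ i)
      ; nondepots = subst₂ _≤_ (nondepots-sem {false} A) (count-sem {false} 1 A x) (to (le-⇔ _ _) a₅)
      ; fleet≤    = subst₂ _≤_ (cong₂ _+_ (used-sem {false} A x) (depots-sem {false} A))
                               (cong₂ _+_ vans (count-sem {false} 2 A x)) (to (le-⇔ _ _) a₆)
      ; demands   = to (demands-sem {false} A) a₇ }
    back : Good (wF x) (tyF x) (cF x) (colF x) → sem acceptT A (x ∷ []) ≢ 0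
    back G = from (and-⇔ _) (from (le-⇔ _ _) (subst₂ _≤_ (sym (total-sem {false} A x)) (sym P2) (Good.weight≤ G)) ,
      from (and-⇔ _) (from (gas-sem {false} A x) (Good.gas≤ G) ,
      from (and-⇔ _) (from (distinct-sem {false} A x) (Good.distinct G) ,
      from (and-⇔ (sem routesT A (x ∷ [])))
        (from (fold-all P2 (λ i → sem routeT A (i ∷ x ∷ []))) (λ i → from (route-sem A x i) (Good.route G i)) ,
      from (and-⇔ _) (from (le-⇔ _ _)
        (subst₂ _≤_ (sym (nondepots-sem {false} A)) (sym (count-sem {false} 1 A x)) (Good.nondepots G)) ,
      from (and-⇔ _) (from (le-⇔ _ _) (subst₂ _≤_ (sym (cong₂ _+_ (used-sem {false} A x) (depots-sem {false} A)))
                               (sym (cong₂ _+_ vans (count-sem {false} 2 A x))) (Good.fleet≤ G)) ,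
      from (demands-sem {false} A) (Good.demands G)))))))

-- Logarithms and powers

double : ∀ a → a + a ≡ 2 * a
double a = cong (a +_) (sym (+-identityʳ a))

foldℕ-double : ∀ N → foldℕ N 1 (λ _ a → a + a) ≡ 2 ^ N
foldℕ-double N = trans (foldℕ-cong N refl (λ a _ → double a)) (foldℕ-^ N 2)

^-*-distrib : ∀ a b k → (a * b) ^ k ≡ a ^ k * b ^ k
^-*-distrib a b zero    = refl
^-*-distrib a b (suc k) = trans (cong (a * b *_) (^-*-distrib a b k))
  (trans (*-assoc a b _) (trans (cong (a *_) (trans (sym (*-assoc b (a ^ k) (b ^ k)))
    (trans (cong (_* b ^ k) (*-comm b (a ^ k))) (*-assoc (a ^ k) b (b ^ k))))) (sym (*-assoc a (a ^ k) _))))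

-- With x < (q + 1) k and q = ⌊ x / k ⌋, this follows from q + 1 ≤ 2 ^ q.
^-≤-2^ : ∀ k .{{_ : NonZero k}} x → x ^ k ≤ k ^ k * 2 ^ x
^-≤-2^ k x = begin
  x ^ k                    ≤⟨ ^-monoˡ-≤ k x≤ ⟩
  (k * 2 ^ q) ^ k          ≡⟨ ^-*-distrib k (2 ^ q) k ⟩
  k ^ k * (2 ^ q) ^ k      ≡⟨ cong (k ^ k *_) (^-*-assoc 2 q k) ⟩
  k ^ k * 2 ^ (q * k)      ≤⟨ *-monoʳ-≤ (k ^ k) (^-monoʳ-≤ 2 qk≤x) ⟩
  k ^ k * 2 ^ x            ∎
  where
  open ≤-Reasoning
  q = x / k
  qk≤x : q * k ≤ x
  qk≤x = ≤-trans (m≤n+m (q * k) (x % k)) (≤-reflexive (sym (m≡m%n+[m/n]*n x k)))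
  x≤ : x ≤ k * 2 ^ q
  x≤ = begin
    x                ≡⟨ m≡m%n+[m/n]*n x k ⟩
    x % k + q * k    ≤⟨ +-monoˡ-≤ (q * k) (<⇒≤ (m%n<n x k)) ⟩
    suc q * k        ≤⟨ *-monoˡ-≤ k (n<2^n q) ⟩
    2 ^ q * k        ≡⟨ *-comm (2 ^ q) k ⟩
    k * 2 ^ q        ∎

power₂ : ℕ → ℕ → ℕ
power₂ N e = foldℕ N 1 (λ j a → cond (e ∸ j) (a + a) a)

log₂ : ℕ → ℕ
log₂ n = foldℕ n 0 (λ _ e → cond (n ∸ power₂ n e) (e + 1) e)

power₂-≡ : ∀ N {e} → e ≤ N → power₂ N e ≡ 2 ^ e
power₂-≡ N {e} e≤N = trans (foldℕ-guard N {e} 1 (λ a → a + a) e≤N) (foldℕ-double e)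

-- After k rounds the search has either stopped or reached e = k, and n rounds suffice because n < 2
-- ^ n. As e grows only while 2 ^ e < n, the power never exceeds 2 n.
log₂-bounds : ∀ n → 1 ≤ n → n ≤ 2 ^ log₂ n × 2 ^ log₂ n ≤ 2 * n
log₂-bounds n 1≤n with search n ≤-refl
  where
  e : ℕ → ℕ
  e k = foldℕ k 0 (λ _ e → cond (n ∸ power₂ n e) (e + 1) e)
  search : ∀ k → k ≤ n → e k ≤ k × 2 ^ e k ≤ 2 * n × (n ≤ 2 ^ e k ⊎ e k ≡ k)
  search zero    _   = z≤n , ≤-trans 1≤n (m≤m+n n _) , inj₂ refl
  search (suc k) k<n with search k (<⇒≤ k<n)
  ... | e≤k , ≤2n , end rewrite power₂-≡ n (≤-trans e≤k (<⇒≤ k<n)) with n ∸ 2 ^ e k in eq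
  ...   | zero  = m≤n⇒m≤1+n e≤k , ≤2n , inj₁ (m∸n≡0⇒m≤n eq)
  ...   | suc _ with end
  ...     | inj₁ n≤   = contradiction (trans (sym eq) (m≤n⇒m∸n≡0 n≤)) λ ()
  ...     | inj₂ refl′ = ≤-trans (≤-reflexive (+-comm (e k) 1)) (s≤s e≤k) ,
    ≤-trans (≤-reflexive (cong (2 ^_) (+-comm (e k) 1))) (*-monoʳ-≤ 2 (<⇒≤ small)) ,
    inj₂ (trans (+-comm (e k) 1) (cong suc refl′))
    where
    small : 2 ^ e k < n
    small = ≰⇒> λ n≤ → contradiction (trans (sym eq) (m≤n⇒m∸n≡0 n≤)) λ ()
... | _ , ≤2n , inj₁ n≤ = n≤ , ≤2n
... | _ , ≤2n , inj₂ eq = subst (λ e → n ≤ 2 ^ e) (sym eq) (<⇒≤ (n<2^n n)) , ≤2n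

length-cartesianProduct : ∀ {A B : Set} (xs : List A) (ys : List B) →
                          length (cartesianProduct xs ys) ≡ length xs * length ys
length-cartesianProduct []       ys = refl
length-cartesianProduct (x ∷ xs) ys = trans (length-++ (map (x ,_) ys))
  (cong₂ _+_ (length-map (x ,_) ys) (length-cartesianProduct xs ys))

-- Correctness and running time

-- There are four tables of r² entries. The summand 2 keeps the number of digits positive for r = 0,
-- as `^-≤-2^` requires, and yields 2 ≤ X.
digits : ℕ → ℕ
digits r = 2 + ((r * r + r * r) + (r * r + r * r))

-- Tape layout: digit 1 + (q , (i , t)) for q < 4 and i , t < r.
module Layout (r : ℕ) (G : Fin 4 → Fin (r * r) → ℕ) where

  table : ℕ → ℕ
  table zero    = 0
  table (suc j) with j <? 4 * (r * r)
  ... | yes j< = uncurry G (remQuot {4} (r * r) (fromℕ< j<))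
  ... | no _   = 0

  table-< : ∀ {b} → 0 < b → (∀ q p → G q p < b) → ∀ j → table j < b
  table-< b>0 h zero    = b>0
  table-< b>0 h (suc j) with j <? 4 * (r * r)
  ... | yes j< = h _ _
  ... | no _   = b>0

  table-combine : ∀ q p → table (suc (toℕ (combine q p))) ≡ G q p
  table-combine q p with toℕ (combine q p) <? 4 * (r * r)
  ... | no ¬p = contradiction (Fin.toℕ<n (combine q p)) ¬p
  ... | yes j< = trans (cong (λ k → uncurry G (remQuot {4} (r * r) k)) (Fin.fromℕ<-toℕ (combine q p) j<))
                       (cong (uncurry G) (Fin.remQuot-combine q p))

  table-entry : ∀ q i t → table (suc (r * r * toℕ q + (r * toℕ i + toℕ t))) ≡ G q (combine i t)
  table-entry q i t = trans (cong (λ k → table (suc k)) (sym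
    (trans (Fin.toℕ-combine q (combine {r} {r} i t)) (cong (r * r * toℕ q +_) (Fin.toℕ-combine i t)))))
    (table-combine q (combine i t))

  entry-< : ∀ (q : Fin 4) (i t : Fin r) → suc (r * r * toℕ q + (r * toℕ i + toℕ t)) < digits r
  entry-< q i t = s<s (m<n⇒m<1+n (subst₂ _<_
    (trans (Fin.toℕ-combine q (combine {r} {r} i t)) (cong (r * r * toℕ q +_) (Fin.toℕ-combine i t)))
    four (Fin.toℕ<n (combine q (combine i t)))))
    where
    four : 4 * (r * r) ≡ (r * r + r * r) + (r * r + r * r)
    four = trans (*-distribʳ-+ (r * r) 2 2) (cong₂ _+_ (sym (double (r * r))) (sym (double (r * r))))

-- What is read back from the tape equals the data of the routing pointwise only, so `Good` is
-- transported along pointwise equalities.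
good-resp : ∀ {n} (I : LoadGasCVRP n) r {w w′ ty ty′ c c′ : Fin r → Fin r → ℕ} {col col′ : Fin n → ℕ} →
  (∀ i t → w i t ≡ w′ i t) → (∀ i t → ty i t ≡ ty′ i t) → (∀ i t → c i t ≡ c′ i t) → (∀ v → col v ≡ col′ v) →
  Spec.Good I r w ty c col → Spec.Good I r w′ ty′ c′ col′
good-resp I r {w} {w′} {ty} {ty′} {c} {c′} {col} {col′} hw hty hc hcol G = record
  { weight≤   = subst (_≤ r) (∑-cong {r} (λ i → ∑-cong {r} (hw i))) G.weight≤
  ; gas≤      = λ i → subst (_≤ gasCapacity) (∑-cong {r} (hw i)) (G.gas≤ i)
  ; distinct  = λ i t j s h h′ eq → G.distinct i t j s (subst (_≢ 0) (sym (hty i t)) h)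
      (subst (_≢ 0) (sym (hty j s)) h′) (trans (hc i t) (trans eq (sym (hc j s))))
  ; route     = λ i → record
      { at = R.at i ; start = R.start i ; closed = R.closed i
      ; steps  = λ t → subst (λ x → Step x _ _) (hw i t) (R.steps i t)
      ; serves = λ t h → let a , b , d = R.serves i t (subst (_≢ 0) (sym (hty i t)) h) in
          a , trans (sym (hcol _)) (trans b (hc i t)) , trans (sym (hty i t)) d
      ; load≤  = subst (_≤ loadCapacity)
          (∑-cong {r} (λ t → cong (λ x → cond x (dem (R.at i (suc (toℕ t)))) 0) (hty i t))) (R.load≤ i) }
  ; nondepots = subst (∑ nondepotClient ≤_)
      (∑-cong {r} (λ i → ∑-cong {r} (λ t → cong (λ x → δ x 1) (hty i t)))) G.nondepots
  ; fleet≤    = subst₂ _≤_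
      (cong (_+ ∑ depotClient) (∑-cong {r} (λ i → cong (λ x → cond x 1 0) (∑-cong {r} (hty i)))))
      (cong (fleet +_) (∑-cong {r} (λ i → ∑-cong {r} (λ t → cong (λ x → δ x 2) (hty i t))))) G.fleet≤
  ; demands   = G.demands }
  where
  open LoadGasCVRP I
  open Spec I r
  module G = Good G
  module R (i : Fin r) = Route {w i} {ty i} {c i} {col} (G.route i)

record Prepared (n r : ℕ) (P : ℕ → ℕ) : Set where
  field
    P1 : P 1 ≡ n
    P2 : P 2 ≡ r
    P3 : P 3 ≡ r * r
    P4 : P 4 ≡ digits r
    P5 : P 5 ≡ 2
    P6 : P 6 ≡ suc (log₂ n)
    P7 : P 7 ≡ 2 ^ digits r
    P8 : P 8 ≡ suc (log₂ n) * 2 ^ digits r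
    P9 : P 9 ≡ (suc (log₂ n) * 2 ^ digits r) ^ digits r

r<2^digits : ∀ r → r < 2 ^ digits r
r<2^digits r = ≤-trans (n<2^n r) (^-monoʳ-≤ 2 (≤-trans (r≤rr r) (≤-trans (m≤m+n (r * r) _)
  (≤-trans (m≤m+n (r * r + r * r) _) (m≤n+m _ 2)))))
  where
  r≤rr : ∀ r → r ≤ r * r
  r≤rr zero    = z≤n
  r≤rr (suc r) = m≤m*n (suc r) (suc r)

module Correctness {off ga : ℕ} {J : ℕ → ℕ} {n} {I : LoadGasCVRP n} {r} (enc : Encodes off ga J I r)
  (nonzero : LoadGasCVRP.NoZeroWeightEdges I) {P : ℕ → ℕ} (prepared : Prepared n r P) where
  open Prepared prepared
  open Encodes enc using (size; budget)
  open Meaning {off} {ga} {J} {P} {n} {I} {r} enc P1 P2 P3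
  open Terms off ga
  open Spec I r

  L K B : ℕ
  L = log₂ n
  K = digits r
  B = suc L * 2 ^ K

  1≤n : 1 ≤ n
  1≤n = ≤-trans (s≤s z≤n) (Fin.toℕ<n (proj₁ (LoadGasCVRP.depots-nonempty I)))

  result : ℕ
  result = sem {b = false} resultT noArray []

  accepts : result ≡ 1 → ∃[ x ] sem acceptT noArray (x ∷ []) ≢ 0
  accepts eq with to (fold-any {P 9} refl (λ x → sem acceptT noArray (x ∷ [])))
    (λ e → contradiction (trans (sym eq) (cong (λ x → cond x 1 0) e)) λ ())
  ... | x , h = toℕ x , h

  accepted : ∀ {x} → x < P 9 → sem acceptT noArray (x ∷ []) ≢ 0 → result ≡ 1
  accepted {x} x< h = cond-true (from (fold-any {P 9} refl (λ x → sem acceptT noArray (x ∷ [])))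
    (fromℕ< x< , subst (λ y → sem acceptT noArray (y ∷ []) ≢ 0) (sym (Fin.toℕ-fromℕ< x<)) h))

  bits-≡ : ∀ v q → bits v q ≡ digit n 2 (suc L) v q
  bits-≡ v q rewrite P1 | P5 | P6 = refl

  v<2^ : ∀ (v : Fin n) → toℕ v < 2 ^ suc L
  v<2^ v = ≤-trans (Fin.toℕ<n v) (≤-trans (proj₁ (log₂-bounds n 1≤n)) (^-monoʳ-≤ 2 (n≤1+n L)))

  bits≤1 : ∀ (v : Fin n) {q} → q ≤ L → bits (toℕ v) q ≤ 1
  bits≤1 v {q} q≤L = subst (_≤ 1) (sym (bits-≡ (toℕ v) q))
    (s≤s⁻¹ (digit-< n 2 (suc L) (v<2^ v) (<⇒≤ (Fin.toℕ<n v)) (s≤s q≤L)))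

  bits-separate : ∀ (x y : Fin n) → x ≢ y → ∃[ q ] q ≤ L × bits (toℕ x) q ≢ bits (toℕ y) q
  bits-separate x y x≢y with digits-separate n 2 (suc L) (v<2^ x) (v<2^ y)
    (<⇒≤ (Fin.toℕ<n x)) (<⇒≤ (Fin.toℕ<n y)) (x≢y ∘ Fin.toℕ-injective)
  ... | q , q< , ≢ = q , s≤s⁻¹ q< , λ eq → ≢ (trans (sym (bits-≡ (toℕ x) q)) (trans eq (bits-≡ (toℕ y) q)))

  2^K≤B : 2 ^ K ≤ B
  2^K≤B = m≤m+n (2 ^ K) (L * 2 ^ K)

  L<B : L < B
  L<B = m≤m*n (suc L) (2 ^ K) {{>-nonZero (m^n>0 2 K)}}

  solvable : LoadGasCVRP-Yes I r → result ≡ 1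
  solvable (R , cheap) = accepted x<P9 (from (accept-sem noArray x) good)
    where
    module C = Completeness I r nonzero R cheap
    stops : List (Fin n)
    -- All slots are listed, with repetitions, so that the number of bit positions is exactly r², as
    -- in `colT`.
    stops = map (uncurry C.target) (pairs r)
    length-stops : length stops ≡ r * r
    length-stops = trans (length-map (uncurry C.target) (pairs r)) (trans (length-cartesianProduct (allFin r) (allFin r))
      (cong₂ _*_ (length-tabulate {n = r} (λ x → x)) (length-tabulate {n = r} (λ x → x))))
    ∈-stops : ∀ i t → C.target i t ∈ₗ stops
    ∈-stops i t = ∈-map⁺ (uncurry C.target) (∈-cartesianProduct⁺ (∈-allFin i) (∈-allFin t))
    separated = colours-separate Fin._≟_ (bits ∘ toℕ) L bits≤1 bits-separate stops
    h : ℕ → ℕ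
    h = proj₁ separated
    colr : Fin n → ℕ
    colr v = colour (bits (toℕ v)) h (r * r)
    colr-injective : ∀ i t j s → colr (C.target i t) ≡ colr (C.target j s) → C.target i t ≡ C.target j s
    colr-injective i t j s eq = proj₂ (proj₂ separated) (∈-stops i t) (∈-stops j s)
      (subst (λ M → colour (bits (toℕ (C.target i t))) h M ≡ colour (bits (toℕ (C.target j s))) h M) (sym length-stops) eq)
    colr-< : ∀ v → colr v < B
    colr-< v = ≤-trans (colour-< (bits (toℕ v)) h (r * r) (λ {p} _ → bits≤1 v (proj₁ (proj₂ separated) p)))
      (≤-trans (^-monoʳ-≤ 2 (≤-trans (m≤m+n (r * r) _) (≤-trans (m≤m+n (r * r + r * r) _) (m≤n+m _ 2)))) 2^K≤B)
    G : Fin 4 → Fin (r * r) → ℕ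
    G zero                   p = h (toℕ p)
    G (suc zero)             p = uncurry C.w (remQuot {r} r p)
    G (suc (suc zero))       p = uncurry C.ty (remQuot {r} r p)
    G (suc (suc (suc zero))) p = colr (uncurry C.target (remQuot {r} r p))
    G-< : ∀ q p → G q p < B
    G-< zero                   p = ≤-trans (s≤s (proj₁ (proj₂ separated) (toℕ p))) L<B
    G-< (suc zero)             p = ≤-trans (s≤s (C.w≤r _ _)) (≤-trans (r<2^digits r) 2^K≤B)
    G-< (suc (suc zero))       p = ≤-trans (s≤s (C.ty≤2 _ _)) (≤-trans (<⇒≤ (n<1+n 3))
      (≤-trans (^-monoʳ-≤ 2 (m≤m+n 2 ((r * r + r * r) + (r * r + r * r)))) 2^K≤B))
    G-< (suc (suc (suc zero))) p = colr-< _
    open Layout r G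
    x : ℕ
    x = encode B K table
    table-<B : ∀ j → table j < B
    table-<B = table-< (≤-trans z<s L<B) G-<
    x<P9 : x < P 9
    x<P9 = subst (x <_) (sym P9) (encode-< B K table table-<B)
    read : ∀ {j} → j < K → digit (P 9) (P 8) (P 4) x j ≡ table j
    read {j} j<K = trans (cong₂ (λ b k → digit (P 9) b k x j) P8 P4)
      (digit-encode (P 9) B K table table-<B (<⇒≤ x<P9) j<K)
    entry : ∀ q i t → tape x (toℕ q) (toℕ i) (toℕ t) ≡ G q (combine i t)
    entry q i t = trans (read (entry-< q i t)) (table-entry q i t)
    cell : ∀ (f : Fin r → Fin r → ℕ) i t → uncurry f (remQuot {r} r (combine i t)) ≡ f i t
    cell f i t = cong (uncurry f) (Fin.remQuot-combine i t)
    hash≡ : ∀ {p} → p < r * r → hash x p ≡ h p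
    hash≡ {p} p< = trans (cong (λ k → digit (P 9) (P 8) (P 4) x (suc k)) position≡)
      (trans (entry zero i t) (cong h (trans (cong toℕ (Fin.combine-remQuot {r} r p′)) (Fin.toℕ-fromℕ< p<))))
      where
      p′ : Fin (r * r)
      p′ = fromℕ< p<
      i = proj₁ (remQuot {r} r p′)
      t = proj₂ (remQuot {r} r p′)
      position≡ : p ≡ r * r * 0 + (r * toℕ i + toℕ t)
      position≡ = sym (trans (cong (_+ (r * toℕ i + toℕ t)) (*-zeroʳ (r * r)))
        (trans (sym (Fin.toℕ-combine i t)) (trans (cong toℕ (Fin.combine-remQuot {r} r p′)) (Fin.toℕ-fromℕ< p<))))
    good : Good (wF x) (tyF x) (cF x) (colF x)
    good = good-resp I r
      (λ i t → sym (trans (entry (suc zero) i t) (cell C.w i t)))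
      (λ i t → sym (trans (entry (suc (suc zero)) i t) (cell C.ty i t)))
      (λ i t → sym (trans (entry (suc (suc (suc zero))) i t) (cell (λ i t → colr (C.target i t)) i t)))
      (λ v → foldℕ-cong (r * r) refl (λ a p< → cong (λ q → (a + a) + bits (toℕ v) q) (sym (hash≡ p<))))
      (C.complete colr colr-injective)

  result-⇔ : result ≡ 1 ⇔ LoadGasCVRP-Yes I r
  result-⇔ = mk⇔ (λ eq → let x , h = accepts eq in Soundness.sound I r (to (accept-sem noArray x) h)) solvable

-- With K digits, the power (1 + ⌈log₂ n⌉) ^ K is at most K ^ K · 2 ^ (1 + ⌈log₂ n⌉), where the last
-- factor is at most 4 n. The other factor of the base contributes (2 ^ K) ^ K.
budgetFactor : ℕ → ℕ
budgetFactor r = 4 * (digits r * 2 ^ digits r) ^ digits r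

tapes≤ : ∀ n r → 1 ≤ n → (suc (log₂ n) * 2 ^ digits r) ^ digits r ≤ budgetFactor r * n
tapes≤ n r 1≤n = begin
  (suc L * A) ^ K              ≡⟨ ^-*-distrib (suc L) A K ⟩
  suc L ^ K * A ^ K            ≤⟨ *-monoˡ-≤ (A ^ K) (^-≤-2^ K (suc L)) ⟩
  K ^ K * 2 ^ suc L * A ^ K    ≤⟨ *-monoˡ-≤ (A ^ K) (*-monoʳ-≤ (K ^ K) (*-monoʳ-≤ 2 (proj₂ (log₂-bounds n 1≤n)))) ⟩
  K ^ K * (2 * (2 * n)) * A ^ K ≡⟨ cong (λ x → K ^ K * x * A ^ K) (sym (*-assoc 2 2 n)) ⟩
  K ^ K * (4 * n) * A ^ K      ≡⟨ rearrange (K ^ K) n (A ^ K) ⟩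
  4 * (K ^ K * A ^ K) * n      ≡⟨ cong (λ x → 4 * x * n) (sym (^-*-distrib K A K)) ⟩
  budgetFactor r * n                      ∎
  where
  open ≤-Reasoning
  L = log₂ n
  K = digits r
  A = 2 ^ K
  rearrange : ∀ a n b → a * (4 * n) * b ≡ 4 * (a * b) * n
  rearrange = solve-∀

-- Apart from n, every parameter is bounded through the number N of tapes: as K is positive, N is at
-- least the base B, and B dominates the rest.
module ParameterBounds (n r : ℕ) (1≤n : 1 ≤ n) where
  K A B N X : ℕ
  K = digits r
  A = 2 ^ K
  B = suc (log₂ n) * A
  N = B ^ K
  X = budgetFactor r * n
  A>0 : 0 < A
  A>0 = m^n>0 2 K
  B>0 : 0 < B
  B>0 = ≤-trans A>0 (m≤m+n A _)
  n≤X : n ≤ X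
  n≤X = m≤n*m n (budgetFactor r) {{>-nonZero
    (≤-trans (m^n>0 (K * A) {{>-nonZero (≤-trans A>0 (m≤m+n A _))}} K) (m≤m+n _ _))}}
  N≤X : N ≤ X
  N≤X = tapes≤ n r 1≤n
  B≤X : B ≤ X
  B≤X = ≤-trans (m≤m*n B (B ^ pred K) {{>-nonZero (m^n>0 B {{>-nonZero B>0}} (pred K))}}) N≤X
  A≤X : A ≤ X
  A≤X = ≤-trans (m≤m+n A _) B≤X
  L≤X : suc (log₂ n) ≤ X
  L≤X = ≤-trans (m≤m*n (suc (log₂ n)) A {{>-nonZero A>0}}) B≤X
  K≤X : K ≤ X
  K≤X = ≤-trans (<⇒≤ (n<2^n K)) A≤X
  2≤X : 2 ≤ X
  2≤X = ≤-trans (m≤m+n 2 _) K≤X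
  r≤X : r ≤ X
  r≤X = ≤-trans (<⇒≤ (r<2^digits r)) A≤X
  rr≤X : r * r ≤ X
  rr≤X = ≤-trans (≤-trans (m≤m+n (r * r) _) (≤-trans (m≤m+n (r * r + r * r) _) (m≤n+m _ 2))) K≤X

flag≤1 : ∀ x → cond x 1 0 ≤ 1
flag≤1 zero    = z≤n
flag≤1 (suc _) = ≤-refl

-- The parameters computed so far are kept abstract: as closed expressions
-- they would grow too fast to be checked.
module Staging (expected : ℕ → ℕ) where
  Known : ℕ → (ℕ → ℕ) → Set
  Known k P = ∀ i → T (i <ᵇ k) → P (suc i) ≡ expected i

  known-next : ∀ {k P v} → Known k P → v ≡ expected k → Known (suc k) (assignPar P (suc k) v)
  known-next {k} {P} {v} known v≡ i i<1+k with i ≡ᵇ k in eq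
  ... | true  = trans v≡ (cong expected (sym (≡ᵇ⇒≡ i k (subst T (sym eq) _))))
  ... | false = known i (<⇒<ᵇ (≤∧≢⇒< (s≤s⁻¹ (<ᵇ⇒< i (suc k) i<1+k)) (λ i≡k → subst T eq (≡⇒≡ᵇ i k i≡k))))

module Execution {off ga : ℕ} {J : ℕ → ℕ} {n} {I : LoadGasCVRP n} {r} (enc : Encodes off ga J I r)
  (nonzero : LoadGasCVRP.NoZeroWeightEdges I) where
  open Encodes enc using (size; budget)

  1≤n : 1 ≤ n
  1≤n = ≤-trans (s≤s z≤n) (Fin.toℕ<n (proj₁ (LoadGasCVRP.depots-nonempty I)))

  open ParameterBounds n r 1≤n

  expected : ℕ → ℕ
  expected 0 = n
  expected 1 = r
  expected 2 = r * r
  expected 3 = K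
  expected 4 = 2
  expected 5 = suc (log₂ n)
  expected 6 = A
  expected 7 = B
  expected 8 = N
  expected _ = 0

  expected≤X : ∀ k → expected k ≤ X
  expected≤X 0 = n≤X
  expected≤X 1 = r≤X
  expected≤X 2 = rr≤X
  expected≤X 3 = K≤X
  expected≤X 4 = 2≤X
  expected≤X 5 = L≤X
  expected≤X 6 = A≤X
  expected≤X 7 = B≤X
  expected≤X 8 = N≤X
  expected≤X (suc (suc (suc (suc (suc (suc (suc (suc (suc _))))))))) = z≤n

  open Staging expected

  record Outcome (P : ℕ → ℕ) (es : Script) : Set where
    constructor _&_
    field
      bounds  : ValuesBounded J P X es
      decides : runScript J P es 0 ≡ 1 ⇔ LoadGasCVRP-Yes I r

  stage : ∀ {k P e es} → ⟦_⟧ J P e noArray [] ≡ expected k → Known k P →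
          (∀ {Q} → Known (suc k) Q → Outcome Q es) → Outcome P ((suc k , e) ∷ es)
  stage {k} {P} v≡ known rest with rest (known-next {k} {P} known v≡)
  ... | bounds & decides = (≤-trans (≤-reflexive v≡) (expected≤X k) , bounds) & decides

  last-stage : ∀ {P} → Known 9 P → Outcome P ((0 , Terms.resultT off ga) ∷ [])
  last-stage {P} known = (≤-trans (flag≤1 (⟦_⟧ J P (Terms.someAcceptedT off ga) noArray [])) (<⇒≤ 2≤X) , tt) & result-⇔
    where
    prepared : Prepared n r P
    prepared = record
      { P1 = known 0 _ ; P2 = known 1 _ ; P3 = known 2 _ ; P4 = known 3 _ ; P5 = known 4 _
      ; P6 = known 5 _ ; P7 = known 6 _ ; P8 = known 7 _ ; P9 = known 8 _ }
    open Correctness enc nonzero prepared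

  outcome : Outcome (λ _ → 0) (Terms.script off ga)
  outcome =
    stage size (λ _ ()) λ {_} k →
    stage budget k λ {P} k →
    stage (trans (foldℕ-* (P 2) (P 2)) (cong₂ _*_ (k 1 _) (k 1 _))) k λ {_} k →
    stage (cong (λ y → 2 + ((y + y) + (y + y))) (k 2 _)) k λ {_} k →
    stage refl k λ {_} k →
    stage (cong (λ y → suc (log₂ y)) (k 0 _)) k λ {P} k →
    stage (trans (foldℕ-double (P 4)) (cong (2 ^_) (k 3 _))) k λ {P} k →
    stage (trans (foldℕ-* (P 6) (P 7)) (cong₂ _*_ (k 5 _) (k 6 _))) k λ {P} k →
    stage (trans (foldℕ-cong (P 4) refl (λ a _ → foldℕ-* (P 8) a))
      (trans (foldℕ-^ (P 4) (P 8)) (cong₂ _^_ (k 7 _) (k 3 _)))) k last-stage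

-- Stated for an arbitrary script, so that its value is never unfolded.
script-decides : ∀ es input {Yes : Set} {b} →
  (runScript (cells input) (λ _ → 0) es 0 ≡ 1 ⇔ Yes) → scriptCost (cells input) (λ _ → 0) es ≤ b →
  DecidesWithin (compileScript es) input Yes b
script-decides es input iff cost≤ =
  let σ , t , run , t≤ , out = runs-script (cells input) (λ _ → 0) es {initial input} (λ _ → refl) (λ _ → refl)
  in σ , t , run , ≤-trans t≤ cost≤ ,
     mk⇔ (λ eq → to iff (trans (sym (out 0)) eq)) (λ yes → trans (out 0) (from iff yes))

script-computes : ∀ es f → (∀ m → runScript (cells (m ∷ [])) (λ _ → 0) es 0 ≡ f m) → Computable f
script-computes es f value = compileScript es , λ m →
  let σ , t , run , _ , out = runs-script (cells (m ∷ [])) (λ _ → 0) es {initial (m ∷ [])} (λ _ → refl) (λ _ → refl)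
  in σ , t , run , trans (out 0) (value m)

-- Computability of the factor that depends on r

budgetFactor-script : ℕ → Script
budgetFactor-script D =
  (1 , inp (lit 0)) ∷
  (2 , mulT 1 $$ (par 1 ∷ [])) ∷
  (3 , lit 2 ⊞ ((par 2 ⊞ par 2) ⊞ (par 2 ⊞ par 2))) ∷
  (4 , fold 3 (lit 1) (v1 ⊞ v1)) ∷
  (5 , mulT 3 $$ (par 4 ∷ [])) ∷
  (6 , fold 3 (lit 1) (mulT 5 $$ (v1 ∷ []))) ∷
  (7 , (par 6 ⊞ par 6) ⊞ (par 6 ⊞ par 6)) ∷
  -- The degree is a constant of the program, but as a loop count it has to be stored in a
  -- parameter.
  (8 , lit D) ∷
  (0 , fold 8 (lit 1) (mulT 7 $$ (v1 ∷ []))) ∷ []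

module _ (D m : ℕ) where
  mem : ℕ → ℕ
  mem = cells (m ∷ [])

  factorParameter : ℕ → ℕ
  factorParameter 0 = m
  factorParameter 1 = m * m
  factorParameter 2 = digits m
  factorParameter 3 = 2 ^ digits m
  factorParameter 4 = digits m * 2 ^ digits m
  factorParameter 5 = (digits m * 2 ^ digits m) ^ digits m
  factorParameter 6 = budgetFactor m
  factorParameter 7 = D
  factorParameter _ = 0

  open Staging factorParameter

  record Yields (P : ℕ → ℕ) (es : Script) (v : ℕ) : Set where
    constructor yields
    field value : runScript mem P es 0 ≡ v

  factorStage : ∀ {k P e es v} → ⟦_⟧ mem P e noArray [] ≡ factorParameter k → Known k P →
    (∀ {Q} → Known (suc k) Q → Yields Q es v) → Yields P ((suc k , e) ∷ es) v
  factorStage {k} {P} v≡ known rest with rest (known-next {k} {P} known v≡)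
  ... | yields eq = yields eq

  budgetFactor-value : Yields (λ _ → 0) (budgetFactor-script D) (budgetFactor m ^ D)
  budgetFactor-value =
    factorStage refl (λ _ ()) λ {P} k →
    factorStage (trans (foldℕ-* (P 1) (P 1)) (cong₂ _*_ (k 0 _) (k 0 _))) k λ {_} k →
    factorStage (cong (λ y → 2 + ((y + y) + (y + y))) (k 1 _)) k λ {P} k →
    factorStage (trans (foldℕ-double (P 3)) (cong (2 ^_) (k 2 _))) k λ {P} k →
    factorStage (trans (foldℕ-* (P 3) (P 4)) (cong₂ _*_ (k 2 _) (k 3 _))) k λ {P} k →
    factorStage (power-≡ (P 5) (P 3) (k 4 _) (k 2 _)) k λ {P} k →
    factorStage (trans (quadruple (P 6)) (cong (4 *_) (k 5 _))) k λ {_} k →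
    factorStage refl k λ {P} k →
    yields (power-≡ (P 7) (P 8) (k 6 _) (k 7 _))
    where
    quadruple : ∀ y → (y + y) + (y + y) ≡ 4 * y
    quadruple = solve-∀
    power-≡ : ∀ b k {c l} → b ≡ c → k ≡ l → foldℕ k 1 (λ _ a → foldℕ b 0 (λ _ x → x + a)) ≡ c ^ l
    power-≡ b k refl refl = trans (foldℕ-cong k refl (λ a _ → foldℕ-* b a)) (foldℕ-^ k b)

budgetFactor-computable : ∀ D → Computable (λ m → budgetFactor m ^ D)
budgetFactor-computable D =
  script-computes (budgetFactor-script D) (λ m → budgetFactor m ^ D) (λ m → Yields.value (budgetFactor-value D m))

-- The decision procedures

module Decision (off ga : ℕ) where

  -- Opaque, because the degree is a numeral too large to be unfolded.
  abstract
    polynomial : ∃[ D ] ∀ I P X → 2 ≤ X → I 0 ≤ X → (∀ p → P p ≤ X) →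
                 ValuesBounded I P X (Terms.script off ga) → scriptCost I P (Terms.script off ga) ≤ X ^ D
    polynomial = script-poly (Terms.script off ga)

  degree : ℕ
  degree = proj₁ polynomial

  decider : Program
  decider = compileScript (Terms.script off ga)

  decider-correct : ∀ {n} {I : LoadGasCVRP n} {r} input → Encodes off ga (cells input) I r →
    LoadGasCVRP.NoZeroWeightEdges I →
    DecidesWithin decider input (LoadGasCVRP-Yes I r) (budgetFactor r ^ degree * n ^ degree)
  decider-correct {n} {I} {r} input enc nonzero =
    script-decides (Terms.script off ga) input (Outcome.decides outcome) cost≤
    where
    open Execution enc nonzero
    open ParameterBounds n r 1≤n
    cost≤ : scriptCost (cells input) (λ _ → 0) (Terms.script off ga) ≤ budgetFactor r ^ degree * n ^ degree
    -- Initially all parameters are 0, so the bound X concerns only the width and the values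
    -- assigned later.
    cost≤ = ≤-trans (proj₂ polynomial (cells input) (λ _ → 0) (budgetFactor r * n) 2≤X
        (≤-trans (≤-reflexive (Encodes.size enc)) n≤X) (λ _ → z≤n) (Outcome.bounds outcome))
      (≤-reflexive (^-*-distrib (budgetFactor r) n degree))
-- No walk weighs more than the whole routing, so a gas capacity of r excludes no routing of weight
-- at most r.
withGas-⇔ : ∀ {n} (I : LoadCVRP n) r → LoadGasCVRP-Yes (withGas I r r) r ⇔ LoadCVRP-Yes I r
withGas-⇔ I r = mk⇔ (λ (R , ≤r) → GasRouting.routing R , ≤r)
  (λ (R , ≤r) → record { routing = R
     ; gas≤capacity = λ i → ≤-trans (∑-≤ (λ j → LoadCVRP.walkWeight I (Routing.walk R j)) i) ≤r } , ≤r)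

decides-resp : ∀ {P input Yes Yes′ b} → Yes ⇔ Yes′ → DecidesWithin P input Yes b → DecidesWithin P input Yes′ b
decides-resp e (σ , t , run , t≤ , d) = σ , t , run , t≤ , mk⇔ (to e ∘ to d) (from d ∘ from e)

corollary4p3 : (∃[ P ] ∃[ f ] ∃[ d ] Computable f ×
    (∀ n (I : LoadCVRP n) (r : ℕ) → LoadCVRP.NoZeroWeightEdges I →
    DecidesWithin P (encodeLoadCVRP I r) (LoadCVRP-Yes I r) (f r * n ^ d)))
    ×
    (∃[ P ] ∃[ f ] ∃[ d ] Computable f ×
    (∀ n (I : LoadGasCVRP n) (r : ℕ) → LoadGasCVRP.NoZeroWeightEdges I →
    DecidesWithin P (encodeLoadGasCVRP I r) (LoadGasCVRP-Yes I r) (f r * n ^ d)))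
corollary4p3 =
  -- The tables follow four header cells, and the budget in cell 1 doubles as gas capacity; with a
  -- genuine gas capacity, in cell 4, there are five header cells.
  (decider 4 1 , (λ r → budgetFactor r ^ degree 4 1) , degree 4 1 , budgetFactor-computable (degree 4 1) ,
    λ n I r nonzero → decides-resp (withGas-⇔ I r)
      (decider-correct 4 1 (encodeLoadCVRP I r) (encodes-load I r) nonzero)) ,
  (decider 5 4 , (λ r → budgetFactor r ^ degree 5 4) , degree 5 4 , budgetFactor-computable (degree 5 4) ,
    λ n I r nonzero → decider-correct 5 4 (encodeLoadGasCVRP I r) (encodes-gas I r) nonzero)
  where open Decision
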